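{- Let $a,b$ be integers with $0\le a<b$. For $n\ge1$ let $\chi^{ab}_n(q)$ be the characteristic polynomial of the arrangement $\mathcal{A}^{ab}_{n-1}$ in $V_{n-1}=\{x\in\mathbb{R}^n:\sum x_i=0\}$ given by $x_i-x_j=-a+1,-a+2,\dots,b-1$, $1\le i<j\le n$. Let $S$ be the shift operator on polynomials, $(Sg)(q)=g(q-1)$. Then $$\chi^{ab}_n(q)=(b-a)^{ -n}\,\big(S^a+S^{a+1}+\cdots+S^{b-1}\big)^n\, q^{n-1}.$$
   Context: For an arrangement $\mathcal{A}$ in a real vector space $V$, the intersection poset $L_{\mathcal{A}}$ is the set of nonempty intersections of subsets of hyperplanes of $\mathcal{A}$ (including $V$ itself, the minimum $\hat0$), ordered by reverse inclusion, and the characteristic polynomial is $\chi_{\mathcal{A}}(q)=\sum_{z\in L_{\mathcal{A}}}\mu(\hat0,z)\,q^{\dim z}$, where $\mu$ is the Möbius function of $L_{\mathcal{A}}$. Here $\dim V_{n-1}=n-1$.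
   Formalization: The arrangement is taken in the rational space {x in Q^n : sum x_i = 0} instead of the real V_{n-1}, and the polynomial identity is stated as equality of values at every rational q. -}

module Defs where

open import Level using (0ℓ)
open import Data.Nat as ℕ using (ℕ; zero; suc; _∸_; _<_; NonZero; >-nonZero)
open import Data.Nat.Properties using (m<n⇒0<n∸m; m^n>0)
open import Data.Integer as ℤ using (ℤ; +_)
open import Data.Rational as ℚ using (ℚ; 0ℚ; 1ℚ; _+_; _*_; _-_; _/_)
open import Data.Fin using (Fin; toℕ; zero; suc)
open import Data.Product using (Σ; ∃; _×_; _,_)
open import Data.List using (List)
open import Data.List.Relation.Unary.All using (All)
open import Data.Bool using (Bool; true; if_then_else_)
open import Relation.Binary.PropositionalEquality using (_≡_; _≢_)
open import Relation.Nullary using (¬_; yes; no; isYes)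
open import Data.Fin using (_≟_)
open import Function.Bundles using (_⇔_)

ΣFin : ∀ {m} → (Fin m → ℚ) → ℚ
ΣFin {zero}  f = 0ℚ
ΣFin {suc m} f = f zero + ΣFin (λ i → f (suc i))

ΣFinℤ : ∀ {m} → (Fin m → ℤ) → ℤ
ΣFinℤ {zero}  f = + 0
ΣFinℤ {suc m} f = f zero ℤ.+ ΣFinℤ (λ i → f (suc i))

_^ℚ_ : ℚ → ℕ → ℚ
q ^ℚ zero  = 1ℚ
q ^ℚ suc k = q * (q ^ℚ k)

ℤ→ℚ : ℤ → ℚ
ℤ→ℚ c = c / 1

Pt : ℕ → Set
Pt n = Fin n → ℚ

InV : ∀ {n} → Pt n → Set
InV x = ΣFin x ≡ 0ℚ

-- subsets of V_{n-1}, given as predicates on ℚ^n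
SubV : ℕ → Set₁
SubV n = Pt n → Set

_≐_ : ∀ {n} → SubV n → SubV n → Set
A ≐ B = ∀ x → (A x → B x) × (B x → A x)

_⊆_ : ∀ {n} → SubV n → SubV n → Set
A ⊆ B = ∀ x → A x → B x

Nonempty : ∀ {n} → SubV n → Set
Nonempty A = ∃ λ x → A x

LinIndep : ∀ {n k} → (Fin k → Pt n) → Set
LinIndep {n} {k} v =
  (c : Fin k → ℚ) → (∀ t → ΣFin (λ i → c i * v i t) ≡ 0ℚ) → ∀ i → c i ≡ 0ℚ

AffIndep : ∀ {n k} → (Fin (suc k) → Pt n) → Set
AffIndep {n} {k} p = LinIndep {n} {k} (λ i t → p (suc i) t - p zero t)

HasDim : ∀ {n} → SubV n → ℕ → Set
HasDim {n} A d =
  (∃ λ (p : Fin (suc d) → Pt n) → (∀ i → A (p i)) × AffIndep p)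
  × ¬ (∃ λ (p : Fin (suc (suc d)) → Pt n) → (∀ i → A (p i)) × AffIndep p)

-- a hyperplane x_i - x_j = c is encoded by the triple (i , j , c)
Hyp : ℕ → Set
Hyp n = Fin n × Fin n × ℤ

InArr : ∀ {n} → (a b : ℕ) → Hyp n → Set
InArr a b (i , j , c) =
  (toℕ i < toℕ j) × ((ℤ.+ 1 ℤ.- ℤ.+ a) ℤ.≤ c) × (c ℤ.≤ (ℤ.+ b ℤ.- ℤ.+ 1))

HypSet : ∀ {n} → Hyp n → SubV n
HypSet (i , j , c) x = InV x × (x i - x j ≡ ℤ→ℚ c)

-- intersection (inside V_{n-1}) of a finite family of hyperplanes;
-- the empty family gives V_{n-1}
Inter : ∀ {n} → List (Hyp n) → SubV n
Inter B x = InV x × All (λ h → HypSet h x) B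

IsFlat : ∀ {n} → (a b : ℕ) → SubV n → Set
IsFlat {n} a b z =
  Nonempty z × ∃ λ (B : List (Hyp n)) → All (InArr a b) B × (z ≐ Inter B)

-- Data describing the intersection poset L with its Möbius function
-- μ(0̂, -) and dimension function.  L is enumerated without repetitions
-- as zs : Fin m → SubV n; the order (reverse inclusion) is recorded by a
-- boolean function le; bot is the index of 0̂ = V_{n-1}.

record PosetData (n a b : ℕ) : Set₁ where
  field
    m    : ℕ
    zs   : Fin m → SubV n
    flat : ∀ i → IsFlat a b (zs i)
    cover : ∀ z → IsFlat a b z → ∃ λ i → zs i ≐ z
    distinct : ∀ i j → zs i ≐ zs j → i ≡ j
    le   : Fin m → Fin m → Bool
    le-spec : ∀ w z → (le w z ≡ true) ⇔ (zs z ⊆ zs w)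
    bot  : Fin m
    bot-spec : zs bot ≐ InV
    μ    : Fin m → ℤ
    μ-spec : ∀ z →
      ΣFinℤ (λ w → if le w z then μ w else + 0)
        ≡ (if isYes (bot ≟ z) then + 1 else + 0)
    dim  : Fin m → ℕ
    dim-spec : ∀ i → HasDim (zs i) (dim i)

charPoly : ∀ {n a b} → PosetData n a b → ℚ → ℚ
charPoly P q = ΣFin (λ i → ℤ→ℚ (μ i) * (q ^ℚ dim i))
  where open PosetData P

S : (ℚ → ℚ) → (ℚ → ℚ)
S g q = g (q - 1ℚ)

iter : ℕ → ((ℚ → ℚ) → (ℚ → ℚ)) → (ℚ → ℚ) → (ℚ → ℚ)
iter zero    T g = g
iter (suc k) T g = T (iter k T g)

Sab : ℕ → ℕ → (ℚ → ℚ) → (ℚ → ℚ)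
Sab a b g q = ΣFin {b ∸ a} (λ t → iter (a ℕ.+ toℕ t) S g q)

invPow : (a b n : ℕ) → a < b → ℚ
invPow a b n a<b = (+ 1) / ((b ∸ a) ℕ.^ n)
  where
  instance
    nz₁ : NonZero (b ∸ a)
    nz₁ = >-nonZero (m<n⇒0<n∸m a<b)
    nz : NonZero ((b ∸ a) ℕ.^ n)
    nz = >-nonZero (m^n>0 (b ∸ a) n)

{-# OPTIONS --safe #-}
module Submission where

-- For a large integer q, χ(q) is the number of points x of (ℤ/q)ⁿ with x₁ = 0 that lie on no
-- hyperplane modulo q: a flat of dimension k contains q^k such points, and cutting the circle ℤ/q
-- at a gap left by x lifts x to a rational point with the same incidences, so Möbius inversion
-- over the flats through x leaves exactly the points on no hyperplane.  Placing the labels around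
-- the circle in order of position, an ascent needs a step of at least a and a descent one of at
-- least b; the resulting recursion is solved by applying (z^a + ⋯ + z^(b-1))^n to the power series
-- Σ e^(n-1) z^(de) with d = b - a.  Finally D ↦ d [d ∣ D] - 1 is annihilated by averaging over d
-- consecutive integers, hence its product with a polynomial of degree < n is annihilated by n
-- averagings; so that power series may be replaced by d^(-n) Σ D^(n-1) z^D, which is the claim for
-- all large integers q, and both sides are polynomials in q.

open import Defs
open import Data.Nat as ℕ using (ℕ; zero; suc; _∸_; _<_; _≤_; s≤s; z≤n)
import Data.Nat.Properties as ℕₚ
open import Data.Nat.DivMod using (_%_; m<n⇒m%n≡m; m<n⇒m/n≡0; [m+n]%n≡m%n; m≡m%n+[m/n]*n; n/n≡1; +-distrib-/-∣ˡ)
import Data.Nat.DivMod as DM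
import Data.Nat.Divisibility as ℕ∣
open import Data.Integer as ℤ using (ℤ; _%ℕ_; _/ℕ_)
import Data.Integer.Properties as ℤₚ
open import Data.Integer.DivMod using (n%ℕd<d; a≡a%ℕn+[a/ℕn]*n)
open import Data.Integer.Divisibility.Signed using (_∣_; divides; _∣?_; ∣m∣n⇒∣m+n; ∣m⇒∣-m; ∣⇒∣ᵤ; ∣-refl)
open import Data.Integer.Tactic.RingSolver using () renaming (solve-∀ to ℤ-solve-∀)
open import Data.Rational as ℚ using (ℚ; 0ℚ; 1ℚ; _+_; _*_; _-_; -_; _/_)
import Data.Rational.Properties as ℚₚ
import Data.Rational.Unnormalised as ℚᵘ
import Data.Rational.Unnormalised.Properties as ℚᵘₚ
open import Data.Fin as Fin using (Fin; toℕ; zero; suc; punchIn; punchOut)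
import Data.Fin.Properties as Finₚ
open import Data.Vec using (Vec; []; _∷_; lookup; insertAt; map; tabulate)
open import Data.Vec.Properties using (insertAt-lookup; insertAt-punchIn; lookup-map; lookup∘tabulate; ∷-injectiveˡ; ∷-injectiveʳ; tabulate∘lookup; tabulate-cong)
import Data.Vec.Functional as Func
import Data.Vec.Functional.Properties as Funcₚ
open import Data.List as List using (List; []; _∷_; allFin; upTo; cartesianProduct; filter)
open import Data.List.Membership.Propositional using (_∈_)
open import Data.List.Membership.Propositional.Properties using (∈-cartesianProduct⁺; ∈-allFin; ∈-map⁺; ∈-upTo⁺; ∈-filter⁺; ∈-filter⁻)
open import Data.List.Relation.Unary.All as All using (All; []; _∷_)
open import Data.Product using (∃; ∃₂; _×_; _,_; proj₁; proj₂)
open import Data.Sum using (_⊎_; inj₁; inj₂)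
open import Data.Empty using (⊥)
open import Data.Bool using (true; false; if_then_else_)
open import Function using (_∘_; id)
open import Function.Bundles using (_⇔_; mk⇔; Equivalence)
open import Level using (0ℓ)
open import Relation.Binary using (tri<; tri≈; tri>)
open import Relation.Binary.PropositionalEquality using (_≡_; _≢_; refl; sym; trans; cong; cong₂; subst; subst₂; module ≡-Reasoning)
open import Relation.Nullary using (¬_; Dec; yes; no; isYes; contradiction; does)
open import Relation.Nullary.Decidable using (_×-dec_; _→-dec_; _⊎-dec_; ¬?; dec⇒maybe; dec-true; dec-false)
open import Tactic.RingSolver using (solve-∀)
open import Tactic.RingSolver.Core.AlmostCommutativeRing using (AlmostCommutativeRing; fromCommutativeRing)

-- Sums, brackets and the embedding of the integers

-- A placement of n labels is a cyclic order together with n steps that sum to q. An order with k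
-- descents has generating function z^(an + dk) / (1 - z)^n, so only the distribution of descents
-- matters. It can be read off from a = 0, b = 1, where every tuple with x₁ = 0 is admissible and
-- the total is Σ e^(n-1) z^e. Replacing z by z^d there and restoring the denominators gives the
-- factor z^(an) ((1 - z^d) / (1 - z))^n = (z^a + ⋯ + z^(b-1))^n; hence the dilation by d. No sum
-- over orders is formed: labels are removed one at a time, and since the cost of the next step
-- depends on the label left behind, the recursion carries its rank j among those remaining. On the
-- side of flats, elimination in a system of equations x_i - x_j = c only adds and negates. It runs
-- identically over ℚ and over ℤ/q, which is why a flat of dimension k has exactly q^k points; on
-- this side a large q serves only the cut of the circle.

ℚ-ring : AlmostCommutativeRing 0ℓ 0ℓ
ℚ-ring = fromCommutativeRing ℚₚ.+-*-commutativeRing (λ x → dec⇒maybe (0ℚ ℚₚ.≟ x))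

Σ-cong : ∀ {m} {f g : Fin m → ℚ} → (∀ i → f i ≡ g i) → ΣFin f ≡ ΣFin g
Σ-cong {zero}  e = refl
Σ-cong {suc m} e = cong₂ _+_ (e zero) (Σ-cong (λ i → e (suc i)))

Σ-zero : ∀ {m} {f : Fin m → ℚ} → (∀ i → f i ≡ 0ℚ) → ΣFin f ≡ 0ℚ
Σ-zero {zero}  e = refl
Σ-zero {suc m} e = trans (cong₂ _+_ (e zero) (Σ-zero (λ i → e (suc i)))) (ℚₚ.+-identityˡ 0ℚ)

+-interchange : ∀ a b c d → (a + b) + (c + d) ≡ (a + c) + (b + d)
+-interchange = solve-∀ ℚ-ring

Σ-+ : ∀ {m} (f g : Fin m → ℚ) → ΣFin (λ i → f i + g i) ≡ ΣFin f + ΣFin g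
Σ-+ {zero}  f g = sym (ℚₚ.+-identityˡ 0ℚ)
Σ-+ {suc m} f g = trans (cong (f zero + g zero +_) (Σ-+ (f ∘ suc) (g ∘ suc)))
                        (+-interchange (f zero) (g zero) (ΣFin (f ∘ suc)) (ΣFin (g ∘ suc)))

Σ-*ˡ : ∀ {m} c (f : Fin m → ℚ) → ΣFin (λ i → c * f i) ≡ c * ΣFin f
Σ-*ˡ {zero}  c f = sym (ℚₚ.*-zeroʳ c)
Σ-*ˡ {suc m} c f = trans (cong (c * f zero +_) (Σ-*ˡ c (f ∘ suc)))
                         (sym (ℚₚ.*-distribˡ-+ c (f zero) (ΣFin (f ∘ suc))))

Σ-*ʳ : ∀ {m} c (f : Fin m → ℚ) → ΣFin (λ i → f i * c) ≡ ΣFin f * c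
Σ-*ʳ c f = trans (Σ-cong (λ i → ℚₚ.*-comm (f i) c)) (trans (Σ-*ˡ c f) (ℚₚ.*-comm c (ΣFin f)))

Σ-neg : ∀ {m} (f : Fin m → ℚ) → ΣFin (λ i → - f i) ≡ - ΣFin f
Σ-neg {zero}  f = refl
Σ-neg {suc m} f = trans (cong (- f zero +_) (Σ-neg (f ∘ suc))) (sym (ℚₚ.neg-distrib-+ (f zero) (ΣFin (f ∘ suc))))

Σ-- : ∀ {m} (f g : Fin m → ℚ) → ΣFin (λ i → f i - g i) ≡ ΣFin f - ΣFin g
Σ-- f g = trans (Σ-+ f (λ i → - g i)) (cong (ΣFin f +_) (Σ-neg g))

Σ-swap : ∀ {m n} (f : Fin m → Fin n → ℚ) →
  ΣFin (λ i → ΣFin (f i)) ≡ ΣFin (λ j → ΣFin (λ i → f i j))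
Σ-swap {zero} {n} f = sym (Σ-zero {n} (λ _ → refl))
Σ-swap {suc m} f = trans (cong (ΣFin (f zero) +_) (Σ-swap (f ∘ suc))) (sym (Σ-+ (f zero) (λ j → ΣFin (λ i → f (suc i) j))))

Σ-remove : ∀ {m} (k : Fin (suc m)) (f : Fin (suc m) → ℚ) →
  ΣFin f ≡ f k + ΣFin (λ i → f (punchIn k i))
Σ-remove zero f = refl
Σ-remove {suc m} (suc k) f = trans (cong (f zero +_) (Σ-remove k (f ∘ suc))) (lem (f zero) (f (suc k)) (ΣFin (λ i → f (suc (punchIn k i)))))
  where
  lem : ∀ a b c → a + (b + c) ≡ b + (a + c)
  lem = solve-∀ ℚ-ring

Σ-single : ∀ {m} (k : Fin m) (f : Fin m → ℚ) → (∀ i → i ≢ k → f i ≡ 0ℚ) → ΣFin f ≡ f k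
Σ-single {suc m} k f e = trans (Σ-remove k f)
  (trans (cong (f k +_) (Σ-zero (λ i → e _ (Finₚ.punchInᵢ≢i k i)))) (ℚₚ.+-identityʳ (f k)))

Σ-last : ∀ {m} (f : ℕ → ℚ) → ΣFin {suc m} (f ∘ toℕ) ≡ ΣFin {m} (f ∘ toℕ) + f m
Σ-last {zero}  f = trans (ℚₚ.+-identityʳ (f 0)) (sym (ℚₚ.+-identityˡ (f 0)))
Σ-last {suc m} f = trans (cong (f 0 +_) (Σ-last {m} (f ∘ suc)))
                         (sym (ℚₚ.+-assoc (f 0) (ΣFin {m} (f ∘ suc ∘ toℕ)) (f (suc m))))

Σ-reverse : ∀ d (f : ℕ → ℚ) → ΣFin {d} (λ r → f (d ∸ suc (toℕ r))) ≡ ΣFin {d} (f ∘ toℕ)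
Σ-reverse zero    f = refl
Σ-reverse (suc d) f = trans (ℚₚ.+-comm (f d) (ΣFin {d} (λ r → f (d ∸ suc (toℕ r)))))
  (trans (cong (_+ f d) (Σ-reverse d f)) (sym (Σ-last {d} f)))

⟦_⟧ : {A : Set} → Dec A → ℚ
⟦ yes _ ⟧ = 1ℚ
⟦ no _ ⟧  = 0ℚ

⟦⟧-cong : {A B : Set} → (A → B) → (B → A) → (p : Dec A) (q : Dec B) → ⟦ p ⟧ ≡ ⟦ q ⟧
⟦⟧-cong f g (yes p) (yes q) = refl
⟦⟧-cong f g (no p)  (no q)  = refl
⟦⟧-cong f g (yes p) (no q)  = contradiction (f p) q
⟦⟧-cong f g (no p)  (yes q) = contradiction (g q) p

⟦⟧-yes : {A : Set} → A → (p : Dec A) → ⟦ p ⟧ ≡ 1ℚ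
⟦⟧-yes a (yes _) = refl
⟦⟧-yes a (no na) = contradiction a na

⟦⟧-no : {A : Set} → ¬ A → (p : Dec A) → ⟦ p ⟧ ≡ 0ℚ
⟦⟧-no na (no _) = refl
⟦⟧-no na (yes a) = contradiction a na

⟦⟧-× : {A B : Set} (p : Dec A) (q : Dec B) (r : Dec (A × B)) → ⟦ p ⟧ * ⟦ q ⟧ ≡ ⟦ r ⟧
⟦⟧-× (yes a) q r = trans (ℚₚ.*-identityˡ ⟦ q ⟧) (⟦⟧-cong (a ,_) proj₂ q r)
⟦⟧-× (no na) q r = trans (ℚₚ.*-zeroˡ ⟦ q ⟧) (sym (⟦⟧-no (na ∘ proj₁) r))

Σ-unique : ∀ {m} {A : Fin m → Set} (A? : ∀ i → Dec (A i)) (k : Fin m) → A k →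
  (∀ i → A i → i ≡ k) → ΣFin (λ i → ⟦ A? i ⟧) ≡ 1ℚ
Σ-unique A? k ak u = trans (Σ-single k _ (λ i i≢k → ⟦⟧-no (i≢k ∘ u i) (A? i))) (⟦⟧-yes ak (A? k))

ℤ→ℚ-+ : ∀ x y → ℤ→ℚ (x ℤ.+ y) ≡ ℤ→ℚ x + ℤ→ℚ y
ℤ→ℚ-+ x y = ℚₚ.toℚᵘ-injective (begin
  ℚ.toℚᵘ (ℤ→ℚ (x ℤ.+ y))                 ≈⟨ ℚₚ.toℚᵘ-fromℚᵘ (ℚᵘ.mkℚᵘ (x ℤ.+ y) 0) ⟩
  ℚᵘ.mkℚᵘ (x ℤ.+ y) 0                    ≡⟨ cong (λ t → ℚᵘ.mkℚᵘ t 0) (sym (cong₂ ℤ._+_ (ℤₚ.*-identityʳ x) (ℤₚ.*-identityʳ y))) ⟩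
  ℚᵘ.mkℚᵘ x 0 ℚᵘ.+ ℚᵘ.mkℚᵘ y 0           ≈⟨ ℚᵘₚ.+-cong (ℚₚ.toℚᵘ-fromℚᵘ (ℚᵘ.mkℚᵘ x 0)) (ℚₚ.toℚᵘ-fromℚᵘ (ℚᵘ.mkℚᵘ y 0)) ⟨
  ℚ.toℚᵘ (ℤ→ℚ x) ℚᵘ.+ ℚ.toℚᵘ (ℤ→ℚ y)     ≈⟨ ℚₚ.toℚᵘ-homo-+ (ℤ→ℚ x) (ℤ→ℚ y) ⟨
  ℚ.toℚᵘ (ℤ→ℚ x + ℤ→ℚ y)                 ∎)
  where open ℚᵘₚ.≃-Reasoning

ℤ→ℚ-* : ∀ x y → ℤ→ℚ (x ℤ.* y) ≡ ℤ→ℚ x * ℤ→ℚ y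
ℤ→ℚ-* x y = ℚₚ.toℚᵘ-injective (begin
  ℚ.toℚᵘ (ℤ→ℚ (x ℤ.* y))                 ≈⟨ ℚₚ.toℚᵘ-fromℚᵘ (ℚᵘ.mkℚᵘ (x ℤ.* y) 0) ⟩
  ℚᵘ.mkℚᵘ x 0 ℚᵘ.* ℚᵘ.mkℚᵘ y 0           ≈⟨ ℚᵘₚ.*-cong (ℚₚ.toℚᵘ-fromℚᵘ (ℚᵘ.mkℚᵘ x 0)) (ℚₚ.toℚᵘ-fromℚᵘ (ℚᵘ.mkℚᵘ y 0)) ⟨
  ℚ.toℚᵘ (ℤ→ℚ x) ℚᵘ.* ℚ.toℚᵘ (ℤ→ℚ y)     ≈⟨ ℚₚ.toℚᵘ-homo-* (ℤ→ℚ x) (ℤ→ℚ y) ⟨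
  ℚ.toℚᵘ (ℤ→ℚ x * ℤ→ℚ y)                 ∎)
  where open ℚᵘₚ.≃-Reasoning

ℤ→ℚ-injective : ∀ {x y} → ℤ→ℚ x ≡ ℤ→ℚ y → x ≡ y
ℤ→ℚ-injective {x} {y} e with ℚₚ./-injective-≃ (ℚᵘ.mkℚᵘ x 0) (ℚᵘ.mkℚᵘ y 0) e
... | ℚᵘ.*≡* eq = trans (sym (ℤₚ.*-identityʳ x)) (trans eq (ℤₚ.*-identityʳ y))

a+b≡c⇒a≡c-b : ∀ a b c → a + b ≡ c → a ≡ c - b
a+b≡c⇒a≡c-b a b _ refl = lem a b
  where
  lem : ∀ a b → a ≡ a + b - b
  lem = solve-∀ ℚ-ring

ℤ→ℚ-neg : ∀ x → ℤ→ℚ (ℤ.- x) ≡ - ℤ→ℚ x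
ℤ→ℚ-neg x = trans (a+b≡c⇒a≡c-b _ (ℤ→ℚ x) 0ℚ (trans (sym (ℤ→ℚ-+ (ℤ.- x) x)) (cong ℤ→ℚ (ℤₚ.+-inverseˡ x))))
                  (ℚₚ.+-identityˡ (- ℤ→ℚ x))

ℤ→ℚ-- : ∀ x y → ℤ→ℚ (x ℤ.- y) ≡ ℤ→ℚ x - ℤ→ℚ y
ℤ→ℚ-- x y = trans (ℤ→ℚ-+ x (ℤ.- y)) (cong (ℤ→ℚ x +_) (ℤ→ℚ-neg y))

ι : ℕ → ℚ
ι n = ℤ→ℚ (ℤ.+ n)

ι-+ : ∀ m n → ι (m ℕ.+ n) ≡ ι m + ι n
ι-+ m n = ℤ→ℚ-+ (ℤ.+ m) (ℤ.+ n)

ι-* : ∀ m n → ι (m ℕ.* n) ≡ ι m * ι n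
ι-* m n = trans (cong ℤ→ℚ (ℤₚ.pos-* m n)) (ℤ→ℚ-* (ℤ.+ m) (ℤ.+ n))

ι-suc : ∀ n → ι (suc n) ≡ ι n + 1ℚ
ι-suc n = trans (ι-+ 1 n) (ℚₚ.+-comm 1ℚ (ι n))

ι-injective : ∀ {m n} → ι m ≡ ι n → m ≡ n
ι-injective = ℤₚ.+-injective ∘ ℤ→ℚ-injective

ι-^ : ∀ m k → ι (m ℕ.^ k) ≡ ι m ^ℚ k
ι-^ m zero    = refl
ι-^ m (suc k) = trans (ι-* m (m ℕ.^ k)) (cong (ι m *_) (ι-^ m k))

Σ-constant : ∀ n c → ΣFin {n} (λ _ → c) ≡ ι n * c
Σ-constant zero    c = sym (ℚₚ.*-zeroˡ c)
Σ-constant (suc n) c = trans (cong (c +_) (Σ-constant n c))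
  (trans (lem c (ι n)) (cong (_* c) (sym (ι-suc n))))
  where
  lem : ∀ c x → c + x * c ≡ (x + 1ℚ) * c
  lem = solve-∀ ℚ-ring

x-y≡0⇒x≡y : ∀ x y → x - y ≡ 0ℚ → x ≡ y
x-y≡0⇒x≡y x y e = trans (lem x y) (trans (cong (_+ y) e) (ℚₚ.+-identityˡ y))
  where lem : ∀ x y → x ≡ x - y + y
        lem = solve-∀ ℚ-ring

*-zero-cancelˡ : ∀ x y → x ≢ 0ℚ → x * y ≡ 0ℚ → y ≡ 0ℚ
*-zero-cancelˡ x y x≢0 e = begin
  y                  ≡⟨ ℚₚ.*-identityˡ y ⟨
  1ℚ * y             ≡⟨ cong (_* y) (ℚₚ.*-inverseˡ x) ⟨
  (ℚ.1/ x) * x * y   ≡⟨ ℚₚ.*-assoc (ℚ.1/ x) x y ⟩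
  (ℚ.1/ x) * (x * y) ≡⟨ cong ((ℚ.1/ x) *_) e ⟩
  (ℚ.1/ x) * 0ℚ      ≡⟨ ℚₚ.*-zeroʳ (ℚ.1/ x) ⟩
  0ℚ                 ∎
  where
  open ≡-Reasoning
  instance _ = ℚ.≢-nonZero x≢0

-- Power series

-- Power series with rational coefficients; z is multiplication by the variable
-- and ∇ multiplication by 1 - z.
Seq : Set
Seq = ℕ → ℚ

infix 4 _≗_
_≗_ : Seq → Seq → Set
f ≗ g = ∀ D → f D ≡ g D

z : Seq → Seq
z f zero    = 0ℚ
z f (suc D) = f D

z^ : ℕ → Seq → Seq
z^ zero    f = f
z^ (suc k) f = z (z^ k f)

infixl 6 _⊖_
_⊖_ : Seq → Seq → Seq
(f ⊖ g) D = f D - g D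

⨁ : ∀ {m} → (Fin m → Seq) → Seq
⨁ f D = ΣFin (λ i → f i D)

∇ : Seq → Seq
∇ f = f ⊖ z f

⊖-cong : ∀ {f f′ g g′} → f ≗ f′ → g ≗ g′ → f ⊖ g ≗ f′ ⊖ g′
⊖-cong e e′ D = cong₂ _-_ (e D) (e′ D)

-- The properties of multiplication by a fixed power series that the recursion needs. `dil` does not
-- qualify, since it turns `z` into `z^ d`.
record Linear (T : Seq → Seq) : Set where
  field
    T-cong : ∀ {f g} → f ≗ g → T f ≗ T g
    T-⨁    : ∀ {m} (f : Fin m → Seq) → T (⨁ f) ≗ ⨁ (λ i → T (f i))
    T-⊖    : ∀ f g → T (f ⊖ g) ≗ T f ⊖ T g
    T-z    : ∀ f → T (z f) ≗ z (T f)
open Linear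

z-cong : ∀ {f g} → f ≗ g → z f ≗ z g
z-cong e zero    = refl
z-cong e (suc D) = e D

id-linear : Linear id
id-linear = record
  { T-cong = id ; T-⨁ = λ f D → refl ; T-⊖ = λ f g D → refl ; T-z = λ f D → refl }

z-linear : Linear z
z-linear = record { T-cong = z-cong ; T-⨁ = z-⨁ ; T-⊖ = z-⊖ ; T-z = λ f D → refl }
  where
  z-⨁ : ∀ {m} (f : Fin m → Seq) → z (⨁ f) ≗ ⨁ (λ i → z (f i))
  z-⨁ {m} f zero = sym (Σ-zero {m} (λ _ → refl))
  z-⨁ f (suc D)  = refl
  z-⊖ : ∀ f g → z (f ⊖ g) ≗ z f ⊖ z g
  z-⊖ f g zero    = refl
  z-⊖ f g (suc D) = refl

∘-linear : ∀ {T U} → Linear T → Linear U → Linear (T ∘ U)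
∘-linear {T} {U} lt lu = record
  { T-cong = T-cong lt ∘ T-cong lu
  ; T-⨁ = λ f D → trans (T-cong lt (T-⨁ lu f) D) (T-⨁ lt (λ i → U (f i)) D)
  ; T-⊖ = λ f g D → trans (T-cong lt (T-⊖ lu f g) D) (T-⊖ lt (U f) (U g) D)
  ; T-z = λ f D → trans (T-cong lt (T-z lu f) D) (T-z lt (U f) D)
  }

z^-linear : ∀ k → Linear (z^ k)
z^-linear zero    = id-linear
z^-linear (suc k) = ∘-linear z-linear (z^-linear k)

⨁-linear : ∀ {m} {T : Fin m → Seq → Seq} → (∀ i → Linear (T i)) → Linear (λ f → ⨁ (λ i → T i f))
⨁-linear {m} {T} l = record
  { T-cong = λ e D → Σ-cong (λ i → T-cong (l i) e D)
  ; T-⨁ = λ f D → trans (Σ-cong (λ i → T-⨁ (l i) f D)) (Σ-swap (λ i j → T i (f j) D))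
  ; T-⊖ = λ f g D → trans (Σ-cong (λ i → T-⊖ (l i) f g D)) (Σ-- (λ i → T i f D) (λ i → T i g D))
  ; T-z = λ f D → trans (Σ-cong (λ i → T-z (l i) f D)) (sym (T-⨁ z-linear (λ i → T i f) D))
  }

_^∘_ : (Seq → Seq) → ℕ → Seq → Seq
(T ^∘ zero)  f = f
(T ^∘ suc k) f = T ((T ^∘ k) f)

^∘-linear : ∀ {T} → Linear T → ∀ k → Linear (T ^∘ k)
^∘-linear l zero    = id-linear
^∘-linear l (suc k) = ∘-linear l (^∘-linear l k)

T-z^ : ∀ {T} → Linear T → ∀ k f → T (z^ k f) ≗ z^ k (T f)
T-z^ l zero    f D = refl
T-z^ l (suc k) f D = trans (T-z l (z^ k f) D) (z-cong (T-z^ l k f) D)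

T-∇ : ∀ {T} → Linear T → ∀ f → T (∇ f) ≗ ∇ (T f)
T-∇ {T} l f D = trans (T-⊖ l f (z f) D) (cong (λ t → T f D - t) (T-z l f D))

^∘-comm : ∀ T k f → (T ^∘ k) (T f) ≡ T ((T ^∘ k) f)
^∘-comm T zero    f = refl
^∘-comm T (suc k) f = cong T (^∘-comm T k f)

z^-+ : ∀ j k f → z^ (j ℕ.+ k) f ≡ z^ j (z^ k f)
z^-+ zero    k f = refl
z^-+ (suc j) k f = cong z (z^-+ j k f)

z^-< : ∀ {k D} f → D < k → z^ k f D ≡ 0ℚ
z^-< {suc k} {zero}  f _         = refl
z^-< {suc k} {suc D} f (s≤s D<k) = z^-< f D<k

z^-+-eval : ∀ k f D → z^ k f (k ℕ.+ D) ≡ f D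
z^-+-eval zero    f D = refl
z^-+-eval (suc k) f D = z^-+-eval k f D

-- Each coefficient is its difference plus the preceding coefficient. Identities may thus be checked
-- after multiplication by 1 - z, and no quotient of series is ever formed.
∇-injective : ∀ {f g} → ∇ f ≗ ∇ g → f ≗ g
∇-injective {f} {g} e zero    = trans (sym (ℚₚ.+-identityʳ (f 0))) (trans (e 0) (ℚₚ.+-identityʳ (g 0)))
∇-injective {f} {g} e (suc D) = trans (lem (f (suc D)) (f D))
  (trans (cong₂ _+_ (e (suc D)) (∇-injective {f} {g} e D)) (sym (lem (g (suc D)) (g D))))
  where
  lem : ∀ x y → x ≡ (x - y) + y
  lem = solve-∀ ℚ-ring

-- Multiplication by 1 + z + ⋯ + z^(d-1) = (1 - z^d) / (1 - z).
B : ℕ → Seq → Seq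
B d f = ⨁ {d} (λ r → z^ (toℕ r) f)

B-linear : ∀ d → Linear (B d)
B-linear d = ⨁-linear {d} (λ r → z^-linear (toℕ r))

telescope : ∀ d (f : ℕ → ℚ) → ΣFin {d} (λ r → f (toℕ r) - f (suc (toℕ r))) ≡ f 0 - f d
telescope zero    f = sym (ℚₚ.+-inverseʳ (f 0))
telescope (suc d) f = trans (cong (f 0 - f 1 +_) (telescope d (f ∘ suc))) (lem (f 0) (f 1) (f (suc d)))
  where
  lem : ∀ x y w → (x - y) + (y - w) ≡ x - w
  lem = solve-∀ ℚ-ring

B-∇ : ∀ d f → B d (∇ f) ≗ f ⊖ z^ d f
B-∇ d f D = trans (Σ-cong {d} (λ r → T-∇ (z^-linear (toℕ r)) f D)) (telescope d (λ r → z^ r f D))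

δ₀ : Seq
δ₀ D = ⟦ D ℕₚ.≟ 0 ⟧

module Dilation (d′ : ℕ) where
  d = suc d′

  -- Substitution of z^d for z.
  dil : Seq → Seq
  dil f D = ⟦ D % d ℕₚ.≟ 0 ⟧ * f (D DM./ d)

  dil-cong : ∀ {f g} → f ≗ g → dil f ≗ dil g
  dil-cong e D = cong (⟦ D % d ℕₚ.≟ 0 ⟧ *_) (e (D DM./ d))

  dil-⨁ : ∀ {m} (f : Fin m → Seq) → dil (⨁ f) ≗ ⨁ (λ i → dil (f i))
  dil-⨁ f D = sym (Σ-*ˡ ⟦ D % d ℕₚ.≟ 0 ⟧ (λ i → f i (D DM./ d)))

  dil-⊖ : ∀ f g → dil (f ⊖ g) ≗ dil f ⊖ dil g
  dil-⊖ f g D = lem ⟦ D % d ℕₚ.≟ 0 ⟧ (f (D DM./ d)) (g (D DM./ d))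
    where
    lem : ∀ c x y → c * (x - y) ≡ c * x - c * y
    lem = solve-∀ ℚ-ring

  [d+D]/d : ∀ D → (d ℕ.+ D) DM./ d ≡ suc (D DM./ d)
  [d+D]/d D = trans (+-distrib-/-∣ˡ {d} D {d} ℕ∣.∣-refl) (cong (ℕ._+ D DM./ d) (n/n≡1 d))

  [d+D]%d : ∀ D → (d ℕ.+ D) % d ≡ D % d
  [d+D]%d D = trans (cong (_% d) (ℕₚ.+-comm d D)) ([m+n]%n≡m%n D d)

  dil-z : ∀ f → dil (z f) ≗ z^ d (dil f)
  dil-z f D with D ℕₚ.<? d
  ... | yes D<d = trans (cong (λ t → ⟦ D % d ℕₚ.≟ 0 ⟧ * z f t) (m<n⇒m/n≡0 D<d))
                        (trans (ℚₚ.*-zeroʳ ⟦ D % d ℕₚ.≟ 0 ⟧) (sym (z^-< (dil f) D<d)))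
  ... | no D≮d = subst (λ t → dil (z f) t ≡ z^ d (dil f) t) (ℕₚ.m+[n∸m]≡n (ℕₚ.≮⇒≥ D≮d)) (eq (D ∸ d))
    where
    eq : ∀ E → dil (z f) (d ℕ.+ E) ≡ z^ d (dil f) (d ℕ.+ E)
    eq E = trans (cong₂ (λ s t → ⟦ s ℕₚ.≟ 0 ⟧ * z f t) ([d+D]%d E) ([d+D]/d E))
                 (sym (z^-+-eval d (dil f) E))

  dil-∇ : ∀ f → dil (∇ f) ≗ dil f ⊖ z^ d (dil f)
  dil-∇ f D = trans (dil-⊖ f (z f) D) (cong (λ t → dil f D - t) (dil-z f D))

  dil-δ₀ : dil δ₀ ≗ δ₀
  dil-δ₀ D = trans
    (⟦⟧-× (D % d ℕₚ.≟ 0) (D DM./ d ℕₚ.≟ 0) both?)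
    (⟦⟧-cong (λ { (p , q) → trans (m≡m%n+[m/n]*n D d) (cong₂ (λ s t → s ℕ.+ t ℕ.* d) p q) })
             (λ D≡0 → cong (_% d) D≡0 , cong (DM._/ d) D≡0) both? (D ℕₚ.≟ 0))
    where both? = (D % d ℕₚ.≟ 0) ×-dec (D DM./ d ℕₚ.≟ 0)

-- The recursion for the number of placements and its solution

module Closed (a d′ : ℕ) where
  open Dilation d′

  b : ℕ
  b = a ℕ.+ d

  -- The least step to the label v from the label placed just before it, which has been removed
  -- from the numbering and exceeded exactly the labels below j.
  lower : ℕ → ℕ → ℕ
  lower j v = if does (v ℕₚ.<? j) then b else a

  -- Multiplication by z^a + ⋯ + z^(b-1), the counterpart of `Sab` on power series.
  A : Seq → Seq
  A f = z^ a (B d f)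

  A-linear : Linear A
  A-linear = ∘-linear (z^-linear a) (B-linear d)

  -- The count itself when a = 0 and b = 1: no pair of labels is then constrained, each of the j
  -- labels below the previous one has e positions on a circle of length e + 1, and each of the
  -- others has e + 1. The value at 0 is 0 even for n = 0, where a power 0^0 would give 1.
  level : ℕ → ℕ → Seq
  level n j zero    = 0ℚ
  level n j (suc e) = (ι e ^ℚ j) * (ι (suc e) ^ℚ (n ∸ j))

  series : ℕ → ℕ → Seq
  series n j = (A ^∘ suc n) (dil (level n j))

  -- A descent costs d more than an ascent; before dilation this is a single factor z.
  jump : ℕ → ℕ → Seq → Seq
  jump j v f = if does (v ℕₚ.<? j) then z f else f

  -- Neighbours in v differ in one factor, e + 1 against e, so their difference is the product of
  -- the other n factors.
  level-step : ∀ n v e → v ≤ n → level (suc n) v (suc e) - level (suc n) (suc v) (suc e) ≡ level n v (suc e)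
  level-step n v e v≤n = begin
    x ^ℚ v * (y ^ℚ (suc n ∸ v)) - (x ^ℚ suc v) * (y ^ℚ (n ∸ v))
      ≡⟨ cong (λ t → x ^ℚ v * (y ^ℚ t) - (x ^ℚ suc v) * (y ^ℚ (n ∸ v))) (ℕₚ.+-∸-assoc 1 v≤n) ⟩
    x ^ℚ v * (y * (y ^ℚ (n ∸ v))) - (x * x ^ℚ v) * (y ^ℚ (n ∸ v))
      ≡⟨ cong (λ t → x ^ℚ v * (t * (y ^ℚ (n ∸ v))) - (x * x ^ℚ v) * (y ^ℚ (n ∸ v))) (ι-suc e) ⟩
    x ^ℚ v * ((x + 1ℚ) * (y ^ℚ (n ∸ v))) - (x * x ^ℚ v) * (y ^ℚ (n ∸ v))
      ≡⟨ lem x (x ^ℚ v) (y ^ℚ (n ∸ v)) ⟩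
    x ^ℚ v * (y ^ℚ (n ∸ v)) ∎
    where
    open ≡-Reasoning
    x = ι e
    y = ι (suc e)
    lem : ∀ x p q → p * ((x + 1ℚ) * q) - (x * p) * q ≡ p * q
    lem = solve-∀ ℚ-ring

  -- Models the sum over the next label v: descents to the labels below j follow one chain, ascents
  -- to the others a second one.
  split-telescope : ∀ N j (P Q : ℕ → ℚ) → j ≤ N →
    ΣFin {N} (λ v → if does (toℕ v ℕₚ.<? j) then P (toℕ v) - P (suc (toℕ v)) else Q (toℕ v) - Q (suc (toℕ v)))
      ≡ (P 0 - P j) + (Q j - Q N)
  split-telescope N zero P Q _ = trans (telescope N Q) (lem (P 0) (Q 0) (Q N))
    where
    lem : ∀ p q r → q - r ≡ (p - p) + (q - r)
    lem = solve-∀ ℚ-ring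
  split-telescope (suc N) (suc j) P Q (s≤s j≤N) =
    trans (cong (P 0 - P 1 +_) (split-telescope N j (P ∘ suc) (Q ∘ suc) j≤N))
          (lem (P 0) (P 1) (P (suc j)) (Q (suc j) - Q (suc N)))
    where
    lem : ∀ p p′ p″ r → (p - p′) + ((p′ - p″) + r) ≡ (p - p″) + r
    lem = solve-∀ ℚ-ring

  0^suc : ∀ n → 0ℚ ^ℚ suc n ≡ 0ℚ
  0^suc n = ℚₚ.*-zeroˡ (0ℚ ^ℚ n)

  -- Both sides are e^(n+1). This cancels the outer ends of the two telescoping sums in `∇-level`;
  -- at e = 0 it relies on the exponent being positive.
  level-carry : ∀ n e → level (suc n) (suc n) (suc e) ≡ level (suc n) 0 e
  level-carry n zero    = trans (cong (_* (ι 1 ^ℚ (n ∸ n))) (0^suc n)) (ℚₚ.*-zeroˡ (ι 1 ^ℚ (n ∸ n)))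
  level-carry n (suc e) = trans
    (cong (λ t → (ι (suc e) ^ℚ suc n) * (ι (suc (suc e)) ^ℚ t)) (ℕₚ.n∸n≡0 n))
    (ℚₚ.*-comm (ι (suc e) ^ℚ suc n) 1ℚ)

  -- The recursion over the next label for a = 0 and b = 1. Labels below j contribute differences of
  -- `P`, the others differences of `Q`, and both sums telescope.
  ∇-level : ∀ n j → j ≤ suc n → ∇ (level (suc n) j) ≗ ⨁ {suc n} (λ v → jump j (toℕ v) (level n (toℕ v)))
  ∇-level n j j≤1+n zero = sym (Σ-zero {suc n} term)
    where
    term : ∀ v → jump j (toℕ v) (level n (toℕ v)) 0 ≡ 0ℚ
    term v with does (toℕ v ℕₚ.<? j)
    ... | true  = refl
    ... | false = refl
  ∇-level n j j≤1+n (suc e) = begin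
    Q j - P j                                    ≡⟨ lem (Q j) (P j) (P 0) ⟩
    (P 0 - P j) + (Q j - P 0)                    ≡⟨ cong (λ t → (P 0 - P j) + (Q j - t)) (sym (level-carry n e)) ⟩
    (P 0 - P j) + (Q j - Q (suc n))              ≡⟨ sym (split-telescope (suc n) j P Q j≤1+n) ⟩
    ΣFin {suc n} (λ v → if does (toℕ v ℕₚ.<? j) then P (toℕ v) - P (suc (toℕ v)) else Q (toℕ v) - Q (suc (toℕ v)))
                                                 ≡⟨ Σ-cong {suc n} term ⟩
    ΣFin {suc n} (λ v → jump j (toℕ v) (level n (toℕ v)) (suc e)) ∎
    where
    open ≡-Reasoning
    P Q : ℕ → ℚ
    P v = level (suc n) v e
    Q v = level (suc n) v (suc e)
    lem : ∀ q p r → q - p ≡ (r - p) + (q - r)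
    lem = solve-∀ ℚ-ring
    P-step : ∀ v e → v ≤ n → level (suc n) v e - level (suc n) (suc v) e ≡ level n v e
    P-step v zero    _   = refl
    P-step v (suc e) v≤n = level-step n v e v≤n
    term : ∀ v → (if does (toℕ v ℕₚ.<? j) then P (toℕ v) - P (suc (toℕ v)) else Q (toℕ v) - Q (suc (toℕ v)))
             ≡ jump j (toℕ v) (level n (toℕ v)) (suc e)
    term v with does (toℕ v ℕₚ.<? j)
    ... | true  = P-step (toℕ v) e (Finₚ.toℕ≤pred[n] v)
    ... | false = level-step n (toℕ v) e (Finₚ.toℕ≤pred[n] v)

  z^lower : ∀ j v f → z^ a (if does (v ℕₚ.<? j) then z^ d f else f) ≡ z^ (lower j v) f
  z^lower j v f with does (v ℕₚ.<? j)
  ... | true  = sym (z^-+ a d f)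
  ... | false = refl

  A-∇ : ∀ f → A (∇ (dil f)) ≗ z^ a (dil (∇ f))
  A-∇ f = T-cong (z^-linear a) (λ D → trans (B-∇ d (dil f) D) (sym (dil-∇ f D)))

  -- One factor `A` is spent: it turns 1 - z into z^a (1 - z^d), and 1 - z^d acts on a dilated
  -- series as 1 - z does before dilation.
  ∇-series : ∀ n f → ∇ ((A ^∘ suc n) (dil f)) ≗ (A ^∘ n) (z^ a (dil (∇ f)))
  ∇-series n f D = begin
    ∇ ((A ^∘ suc n) (dil f)) D        ≡⟨ sym (T-∇ (^∘-linear A-linear (suc n)) (dil f) D) ⟩
    (A ^∘ suc n) (∇ (dil f)) D        ≡⟨ cong (λ (g : Seq) → g D) (sym (^∘-comm A n (∇ (dil f)))) ⟩
    (A ^∘ n) (A (∇ (dil f))) D        ≡⟨ T-cong (^∘-linear A-linear n) (A-∇ f) D ⟩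
    (A ^∘ n) (z^ a (dil (∇ f))) D     ∎
    where open ≡-Reasoning

  -- `level 0 0` is z / (1 - z); its difference z is dilated to z^d and then shifted by a.
  ∇-series-zero : ∇ (series 0 0) ≗ z^ b δ₀
  ∇-series-zero D = begin
    ∇ (series 0 0) D                  ≡⟨ ∇-series 0 (level 0 0) D ⟩
    z^ a (dil (∇ (level 0 0))) D      ≡⟨ T-cong (z^-linear a) (dil-cong ∇level≗) D ⟩
    z^ a (dil (z δ₀)) D               ≡⟨ T-cong (z^-linear a) (dil-z δ₀) D ⟩
    z^ a (z^ d (dil δ₀)) D            ≡⟨ T-cong (z^-linear a) (T-cong (z^-linear d) dil-δ₀) D ⟩
    z^ a (z^ d δ₀) D                  ≡⟨ cong (λ (g : Seq) → g D) (sym (z^-+ a d δ₀)) ⟩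
    z^ b δ₀ D                         ∎
    where
    open ≡-Reasoning
    ∇level≗ : ∇ (level 0 0) ≗ z δ₀
    ∇level≗ zero          = refl
    ∇level≗ (suc zero)    = refl
    ∇level≗ (suc (suc e)) = refl

  ∇-series-suc : ∀ n j → j ≤ suc n →
    ∇ (series (suc n) j) ≗ ⨁ {suc n} (λ v → z^ (lower j (toℕ v)) (series n (toℕ v)))
  ∇-series-suc n j j≤1+n D = begin
    ∇ (series (suc n) j) D                             ≡⟨ ∇-series (suc n) (level (suc n) j) D ⟩
    (A ^∘ suc n) (z^ a (dil (∇ (level (suc n) j)))) D  ≡⟨ T-z^ lin a (dil (∇ (level (suc n) j))) D ⟩
    z^ a ((A ^∘ suc n) (dil (∇ (level (suc n) j)))) D  ≡⟨ T-cong U (dil-cong (∇-level n j j≤1+n)) D ⟩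
    z^ a ((A ^∘ suc n) (dil (⨁ g))) D                  ≡⟨ T-cong U (dil-⨁ g) D ⟩
    z^ a ((A ^∘ suc n) (⨁ (λ v → dil (g v)))) D        ≡⟨ T-⨁ U (λ v → dil (g v)) D ⟩
    ⨁ (λ v → z^ a ((A ^∘ suc n) (dil (g v)))) D        ≡⟨ Σ-cong {suc n} term ⟩
    ⨁ {suc n} (λ v → z^ (lower j (toℕ v)) (series n (toℕ v))) D ∎
    where
    open ≡-Reasoning
    lin = ^∘-linear A-linear (suc n)
    U = ∘-linear (z^-linear a) lin
    g : Fin (suc n) → Seq
    g v = jump j (toℕ v) (level n (toℕ v))
    inner : ∀ v → (A ^∘ suc n) (dil (g v)) ≗ (if does (toℕ v ℕₚ.<? j) then z^ d (series n (toℕ v)) else series n (toℕ v))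
    inner v E with does (toℕ v ℕₚ.<? j)
    ... | true  = trans (T-cong lin (dil-z (level n (toℕ v))) E) (T-z^ lin d (dil (level n (toℕ v))) E)
    ... | false = refl
    term : ∀ v → z^ a ((A ^∘ suc n) (dil (g v))) D ≡ z^ (lower j (toℕ v)) (series n (toℕ v)) D
    term v = trans (T-cong (z^-linear a) (inner v) D) (cong (λ (h : Seq) → h D) (z^lower j (toℕ v) (series n (toℕ v))))

  -- Convolution with z^k / (1 - z), where g is the length of a step of at least k. The term g = D
  -- is left out, which makes no difference once f vanishes at 0.
  ∫ : ℕ → Seq → Seq
  ∫ k f D = ΣFin {D} (λ g → ⟦ k ℕₚ.≤? toℕ g ⟧ * f (D ∸ toℕ g))

  ∫-suc : ∀ k f → ∫ (suc k) f ≗ z (∫ k f)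
  ∫-suc k f zero    = refl
  ∫-suc k f (suc D) = trans
    (cong₂ _+_ (trans (cong (_* f (suc D)) (⟦⟧-no (λ ()) (suc k ℕₚ.≤? 0))) (ℚₚ.*-zeroˡ (f (suc D))))
               (Σ-cong {D} (λ g → cong (_* f (D ∸ toℕ g))
                 (⟦⟧-cong ℕ.s≤s⁻¹ s≤s (suc k ℕₚ.≤? suc (toℕ g)) (k ℕₚ.≤? toℕ g)))))
    (ℚₚ.+-identityˡ (∫ k f D))

  ∫-z^ : ∀ k f → ∫ k f ≗ z^ k (∫ 0 f)
  ∫-z^ zero    f D = refl
  ∫-z^ (suc k) f D = trans (∫-suc k f D) (z-cong (∫-z^ k f) D)

  ∇-∫ : ∀ k f → f 0 ≡ 0ℚ → ∇ (∫ k f) ≗ z^ k f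
  ∇-∫ k f f0 D = begin
    ∇ (∫ k f) D          ≡⟨ ⊖-cong (∫-z^ k f) (z-cong (∫-z^ k f)) D ⟩
    ∇ (z^ k (∫ 0 f)) D   ≡⟨ sym (T-∇ (z^-linear k) (∫ 0 f) D) ⟩
    z^ k (∇ (∫ 0 f)) D   ≡⟨ T-cong (z^-linear k) ∇-∫₀ D ⟩
    z^ k f D             ∎
    where
    open ≡-Reasoning
    lem : ∀ x y → (1ℚ * x + y) - y ≡ x
    lem = solve-∀ ℚ-ring
    ∇-∫₀ : ∇ (∫ 0 f) ≗ f
    ∇-∫₀ zero    = sym f0
    ∇-∫₀ (suc D) = trans (cong₂ (λ s t → s - t)
        (cong₂ _+_ (cong (_* f (suc D)) (⟦⟧-yes z≤n (0 ℕₚ.≤? 0)))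
                   (Σ-cong {D} (λ g → cong (_* f (D ∸ toℕ g)) (⟦⟧-cong (λ _ → z≤n) (λ _ → z≤n) (0 ℕₚ.≤? suc (toℕ g)) (0 ℕₚ.≤? toℕ g)))))
        refl)
      (lem (f (suc D)) (∫ 0 f D))

  ∇-⟦≤⟧ : ∀ k → ∇ (λ D → ⟦ k ℕₚ.≤? D ⟧) ≗ z^ k δ₀
  ∇-⟦≤⟧ zero zero    = refl
  ∇-⟦≤⟧ zero (suc D) = cong₂ (λ s t → s - t) (⟦⟧-yes z≤n (0 ℕₚ.≤? suc D)) (⟦⟧-yes z≤n (0 ℕₚ.≤? D))
  ∇-⟦≤⟧ (suc k) zero = cong (λ t → t - 0ℚ) (⟦⟧-no (λ ()) (suc k ℕₚ.≤? 0))
  ∇-⟦≤⟧ (suc k) (suc zero) = trans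
    (cong₂ (λ s t → s - t) (⟦⟧-cong ℕ.s≤s⁻¹ s≤s (suc k ℕₚ.≤? 1) (k ℕₚ.≤? 0)) (⟦⟧-no (λ ()) (suc k ℕₚ.≤? 0)))
    (∇-⟦≤⟧ k zero)
  ∇-⟦≤⟧ (suc k) (suc (suc D)) = trans
    (cong₂ (λ s t → s - t) (⟦⟧-cong ℕ.s≤s⁻¹ s≤s (suc k ℕₚ.≤? suc (suc D)) (k ℕₚ.≤? suc D))
                           (⟦⟧-cong ℕ.s≤s⁻¹ s≤s (suc k ℕₚ.≤? suc D) (k ℕₚ.≤? D)))
    (∇-⟦≤⟧ k (suc D))

  -- After multiplication by 1 - z the recursion for `K` becomes the one of `∇-series-suc`. The
  -- bound j ≤ n persists because the next j is a label v of `Fin (suc n)`.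
  series-unique : (K : ℕ → ℕ → Seq) → (∀ n j → K n j 0 ≡ 0ℚ) →
    (∀ D → K 0 0 D ≡ ⟦ b ℕₚ.≤? D ⟧) →
    (∀ n j D → K (suc n) j D ≡ ΣFin {suc n} (λ v → ∫ (lower j (toℕ v)) (K n (toℕ v)) D)) →
    ∀ n j → j ≤ n → K n j ≗ series n j
  series-unique K K0 Kzero Ksuc zero zero z≤n = ∇-injective λ D → begin
    ∇ (K 0 0) D                      ≡⟨ ⊖-cong Kzero (z-cong Kzero) D ⟩
    ∇ (λ D → ⟦ b ℕₚ.≤? D ⟧) D        ≡⟨ ∇-⟦≤⟧ b D ⟩
    z^ b δ₀ D                        ≡⟨ sym (∇-series-zero D) ⟩
    ∇ (series 0 0) D                 ∎
    where open ≡-Reasoning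
  series-unique K K0 Kzero Ksuc (suc n) j j≤1+n = ∇-injective λ D → begin
    ∇ (K (suc n) j) D                ≡⟨ ⊖-cong (Ksuc n j) (z-cong (Ksuc n j)) D ⟩
    ∇ (⨁ {suc n} I) D                ≡⟨ T-⊖′ I D ⟩
    ⨁ {suc n} (λ v → ∇ (I v)) D      ≡⟨ Σ-cong {suc n} (λ v → ∇-∫ (lower j (toℕ v)) (K n (toℕ v)) (K0 n (toℕ v)) D) ⟩
    ⨁ {suc n} (λ v → z^ (lower j (toℕ v)) (K n (toℕ v))) D
      ≡⟨ Σ-cong {suc n} (λ v → T-cong (z^-linear (lower j (toℕ v)))
           (series-unique K K0 Kzero Ksuc n (toℕ v) (Finₚ.toℕ≤pred[n] v)) D) ⟩
    ⨁ {suc n} (λ v → z^ (lower j (toℕ v)) (series n (toℕ v))) D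
                                     ≡⟨ sym (∇-series-suc n j j≤1+n D) ⟩
    ∇ (series (suc n) j) D           ∎
    where
    open ≡-Reasoning
    I : Fin (suc n) → Seq
    I v = ∫ (lower j (toℕ v)) (K n (toℕ v))
    T-⊖′ : ∀ {m} (f : Fin m → Seq) → ∇ (⨁ f) ≗ ⨁ (λ v → ∇ (f v))
    T-⊖′ f D = trans (cong (λ t → ⨁ f D - t) (T-⨁ z-linear f D))
                     (sym (Σ-- (λ v → f v D) (λ v → z (f v) D)))

-- Polynomial functions and averaging

-- Poly n f: f is a polynomial function of degree < n.
data Poly : ℕ → (ℚ → ℚ) → Set where
  null : ∀ {f} → (∀ x → f x ≡ 0ℚ) → Poly 0 f
  horner : ∀ {n f} c g → Poly n g → (∀ x → f x ≡ c + x * g x) → Poly (suc n) f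

Poly-cong : ∀ {n f g} → (∀ x → g x ≡ f x) → Poly n f → Poly n g
Poly-cong e (null z)         = null (λ x → trans (e x) (z x))
Poly-cong e (horner c h p q) = horner c h p (λ x → trans (e x) (q x))

Poly-suc : ∀ {n f} → Poly n f → Poly (suc n) f
Poly-suc {f = f} (null z) = horner 0ℚ f (null z) (λ x → trans (z x) (sym (trans (cong (λ t → 0ℚ + x * t) (z x)) (lem x))))
  where
  lem : ∀ x → 0ℚ + x * 0ℚ ≡ 0ℚ
  lem = solve-∀ ℚ-ring
Poly-suc (horner c g p q) = horner c g (Poly-suc p) q

Poly-+ : ∀ {n f g} → Poly n f → Poly n g → Poly n (λ x → f x + g x)
Poly-+ (null z) (null w) = null (λ x → trans (cong₂ _+_ (z x) (w x)) (ℚₚ.+-identityˡ 0ℚ))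
Poly-+ (horner c f p q) (horner c′ g p′ q′) =
  horner (c + c′) (λ x → f x + g x) (Poly-+ p p′) (λ x → trans (cong₂ _+_ (q x) (q′ x)) (lem c x (f x) c′ (g x)))
  where
  lem : ∀ c x y c′ w → (c + x * y) + (c′ + x * w) ≡ c + c′ + x * (y + w)
  lem = solve-∀ ℚ-ring

Poly-*ˡ : ∀ {n f} s → Poly n f → Poly n (λ x → s * f x)
Poly-*ˡ s (null z) = null (λ x → trans (cong (s *_) (z x)) (ℚₚ.*-zeroʳ s))
Poly-*ˡ s (horner c f p q) =
  horner (s * c) (λ x → s * f x) (Poly-*ˡ s p) (λ x → trans (cong (s *_) (q x)) (lem s c x (f x)))
  where
  lem : ∀ s c x y → s * (c + x * y) ≡ s * c + x * (s * y)
  lem = solve-∀ ℚ-ring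

Poly-shift : ∀ {n f} s → Poly n f → Poly n (λ x → f (x + s))
Poly-shift s (null z) = null (λ x → z (x + s))
Poly-shift s (horner c g p q) = Poly-cong
  (λ x → trans (q (x + s)) (lem c x s (g (x + s))))
  (Poly-+ (horner c (λ x → g (x + s)) (Poly-shift s p) (λ x → refl)) (Poly-suc (Poly-*ˡ s (Poly-shift s p))))
  where
  lem : ∀ c x s y → c + (x + s) * y ≡ c + x * y + s * y
  lem = solve-∀ ℚ-ring

Poly-^ : ∀ n → Poly (suc n) (λ x → x ^ℚ n)
Poly-^ zero    = horner 1ℚ (λ _ → 0ℚ) (null (λ _ → refl)) (λ x → sym (trans (cong (1ℚ +_) (ℚₚ.*-zeroʳ x)) (ℚₚ.+-identityʳ 1ℚ)))
Poly-^ (suc n) = horner 0ℚ (λ x → x ^ℚ n) (Poly-^ n) (λ x → sym (ℚₚ.+-identityˡ (x ^ℚ suc n)))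

Poly-weaken : ∀ {n f} k → Poly n f → Poly (k ℕ.+ n) f
Poly-weaken zero    p = p
Poly-weaken (suc k) p = Poly-suc (Poly-weaken k p)

IsPoly : (ℚ → ℚ) → Set
IsPoly f = ∃ λ n → Poly n f

IsPoly-+ : ∀ {f g} → IsPoly f → IsPoly g → IsPoly (λ x → f x + g x)
IsPoly-+ {f} (m , p) (n , q) =
  m ℕ.+ n , Poly-+ (subst (λ k → Poly k f) (ℕₚ.+-comm n m) (Poly-weaken n p)) (Poly-weaken m q)

IsPoly-*ˡ : ∀ {f} s → IsPoly f → IsPoly (λ x → s * f x)
IsPoly-*ˡ s (n , p) = n , Poly-*ˡ s p

IsPoly-Σ : ∀ {m} {f : Fin m → ℚ → ℚ} → (∀ i → IsPoly (f i)) → IsPoly (λ x → ΣFin (λ i → f i x))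
IsPoly-Σ {zero}  p = 0 , null (λ _ → refl)
IsPoly-Σ {suc m} p = IsPoly-+ (p zero) (IsPoly-Σ (p ∘ suc))

-- If g has quotient h by x - r, then c + x g has quotient g + r h.
Poly-factor : ∀ {n f} → Poly (suc n) f → ∀ r →
  ∃ λ h → Poly n h × (∀ x → f x ≡ f r + (x - r) * h x)
Poly-factor {f = f} (horner c g (null z) q) r = g , null z , λ x →
  trans (const x) (sym (trans (cong₂ _+_ (const r) (trans (cong ((x - r) *_) (z x)) (ℚₚ.*-zeroʳ (x - r)))) (ℚₚ.+-identityʳ c)))
  where
  const : ∀ x → f x ≡ c
  const x = trans (q x) (trans (cong (c +_) (trans (cong (x *_) (z x)) (ℚₚ.*-zeroʳ x))) (ℚₚ.+-identityʳ c))
Poly-factor {f = f} (horner c g p@(horner _ _ _ _) q) r with Poly-factor p r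
... | h , ph , e = (λ x → g x + r * h x) , Poly-+ p (Poly-suc (Poly-*ˡ r ph)) , λ x → begin
    f x                                              ≡⟨ q x ⟩
    c + x * g x                                      ≡⟨ lem₁ c x r (g x) ⟩
    c + r * g x + (x - r) * g x                      ≡⟨ cong (λ t → c + r * t + (x - r) * g x) (e x) ⟩
    c + r * (g r + (x - r) * h x) + (x - r) * g x    ≡⟨ lem₂ c x r (g r) (g x) (h x) ⟩
    c + r * g r + (x - r) * (g x + r * h x)          ≡⟨ cong (_+ (x - r) * (g x + r * h x)) (sym (q r)) ⟩
    f r + (x - r) * (g x + r * h x)                  ∎
  where
  open ≡-Reasoning
  lem₁ : ∀ c x r y → c + x * y ≡ c + r * y + (x - r) * y
  lem₁ = solve-∀ ℚ-ring
  lem₂ : ∀ c x r y y′ w → c + r * (y + (x - r) * w) + (x - r) * y′ ≡ c + r * y + (x - r) * (y′ + r * w)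
  lem₂ = solve-∀ ℚ-ring

-- The roots come as an injective sequence, so after `r 0` is split off the tail serves the quotient
-- and no roots have to be counted.
Poly-zero : ∀ {n f} → Poly n f → (r : ℕ → ℚ) → (∀ {j k} → r j ≡ r k → j ≡ k) →
  (∀ k → f (r k) ≡ 0ℚ) → ∀ x → f x ≡ 0ℚ
Poly-zero (null z) r inj root x = z x
Poly-zero {suc n} {f} p@(horner _ _ _ _) r inj root x with Poly-factor p (r 0)
... | h , ph , e = trans (e x) (trans (cong₂ _+_ (root 0)
      (trans (cong ((x - r 0) *_) (Poly-zero ph (r ∘ suc) (ℕₚ.suc-injective ∘ inj) root′ x)) (ℚₚ.*-zeroʳ (x - r 0))))
      (ℚₚ.+-identityˡ 0ℚ))
  where
  root′ : ∀ k → h (r (suc k)) ≡ 0ℚ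
  root′ k = *-zero-cancelˡ (r (suc k) - r 0) (h (r (suc k)))
    (λ e₀ → contradiction (inj (x-y≡0⇒x≡y (r (suc k)) (r 0) e₀)) (λ ()))
    (trans (sym (ℚₚ.+-identityˡ ((r (suc k) - r 0) * h (r (suc k)))))
      (trans (cong (_+ (r (suc k) - r 0) * h (r (suc k))) (sym (root 0))) (trans (sym (e (r (suc k)))) (root (suc k)))))

iter-S : ∀ k (g : ℚ → ℚ) q → iter k S g q ≡ g (q - ι k)
iter-S zero    g q = cong g (sym (ℚₚ.+-identityʳ q))
iter-S (suc k) g q = trans (iter-S k g (q - 1ℚ)) (cong g (trans (lem q (ι k)) (cong (λ t → q - t) (sym (ι-suc k)))))
  where
  lem : ∀ q k → q - 1ℚ - k ≡ q - (k + 1ℚ)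
  lem = solve-∀ ℚ-ring

IsPoly-iter-Sab : ∀ {a b f} n → IsPoly f → IsPoly (iter n (Sab a b) f)
IsPoly-iter-Sab zero p = p
IsPoly-iter-Sab {a} {b} {f} (suc n) p = IsPoly-Σ {b ∸ a} λ t →
  let (k , q) = IsPoly-iter-Sab {a} {b} n p in
  k , Poly-cong (λ x → iter-S (a ℕ.+ toℕ t) (iter n (Sab a b) f) x) (Poly-shift (- ι (a ℕ.+ toℕ t)) q)

-- Annihilation by repeated averaging

module Averaging (d′ : ℕ) where
  open Dilation d′

  -- Up to a shift of the argument by b - 1, both `A` and `Sab` become this forward sum, which
  -- involves no truncated subtraction.
  window : Seq → Seq
  window f D = ΣFin {d} (λ r → f (D ℕ.+ toℕ r))

  -- The commutator of `window` with multiplication by D. It commutes with `window`, which drives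
  -- the induction of `window^-x`.
  weighted : Seq → Seq
  weighted f D = ΣFin {d} (λ r → ι (toℕ r) * f (D ℕ.+ toℕ r))

  window^-cong : ∀ k {f g} → (∀ D → 1 ≤ D → f D ≡ g D) → ∀ D → 1 ≤ D → (window ^∘ k) f D ≡ (window ^∘ k) g D
  window^-cong zero    e D 1≤D = e D 1≤D
  window^-cong (suc k) e D 1≤D = Σ-cong {d} λ r → window^-cong k e (D ℕ.+ toℕ r) (ℕₚ.≤-trans 1≤D (ℕₚ.m≤m+n D (toℕ r)))

  window^-cong′ : ∀ k {f g} → f ≗ g → (window ^∘ k) f ≗ (window ^∘ k) g
  window^-cong′ zero    e D = e D
  window^-cong′ (suc k) e D = Σ-cong {d} λ r → window^-cong′ k e (D ℕ.+ toℕ r)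

  window^-+ : ∀ k f g → (window ^∘ k) (λ D → f D + g D) ≗ (λ D → (window ^∘ k) f D + (window ^∘ k) g D)
  window^-+ zero    f g D = refl
  window^-+ (suc k) f g D = trans (Σ-cong {d} (λ r → window^-+ k f g (D ℕ.+ toℕ r)))
    (Σ-+ {d} (λ r → (window ^∘ k) f (D ℕ.+ toℕ r)) (λ r → (window ^∘ k) g (D ℕ.+ toℕ r)))

  window^-*ˡ : ∀ k c f → (window ^∘ k) (λ D → c * f D) ≗ (λ D → c * (window ^∘ k) f D)
  window^-*ˡ zero    c f D = refl
  window^-*ˡ (suc k) c f D = trans (Σ-cong {d} (λ r → window^-*ˡ k c f (D ℕ.+ toℕ r)))
    (Σ-*ˡ {d} c (λ r → (window ^∘ k) f (D ℕ.+ toℕ r)))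

  window^-0 : ∀ k {f} → (∀ D → f D ≡ 0ℚ) → ∀ D → (window ^∘ k) f D ≡ 0ℚ
  window^-0 zero    e D = e D
  window^-0 (suc k) e D = Σ-zero {d} (λ r → window^-0 k e (D ℕ.+ toℕ r))

  +-right-comm : ∀ D r s → D ℕ.+ r ℕ.+ s ≡ D ℕ.+ s ℕ.+ r
  +-right-comm D r s = trans (ℕₚ.+-assoc D r s) (trans (cong (D ℕ.+_) (ℕₚ.+-comm r s)) (sym (ℕₚ.+-assoc D s r)))

  window-weighted : ∀ f → window (weighted f) ≗ weighted (window f)
  window-weighted f D = begin
    ΣFin {d} (λ s → ΣFin {d} (λ r → ι (toℕ r) * f (D ℕ.+ toℕ s ℕ.+ toℕ r)))
      ≡⟨ Σ-swap {d} {d} (λ s r → ι (toℕ r) * f (D ℕ.+ toℕ s ℕ.+ toℕ r)) ⟩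
    ΣFin {d} (λ r → ΣFin {d} (λ s → ι (toℕ r) * f (D ℕ.+ toℕ s ℕ.+ toℕ r)))
      ≡⟨ Σ-cong {d} (λ r → trans (Σ-*ˡ {d} (ι (toℕ r)) (λ s → f (D ℕ.+ toℕ s ℕ.+ toℕ r)))
           (cong (ι (toℕ r) *_) (Σ-cong {d} (λ s → cong f (+-right-comm D (toℕ s) (toℕ r)))))) ⟩
    weighted (window f) D ∎
    where open ≡-Reasoning

  window^-weighted : ∀ k f → (window ^∘ k) (weighted f) ≗ weighted ((window ^∘ k) f)
  window^-weighted zero    f D = refl
  window^-weighted (suc k) f D = trans (Σ-cong {d} (λ r → window^-weighted k f (D ℕ.+ toℕ r)))
                                       (window-weighted ((window ^∘ k) f) D)

  window-x : ∀ f → window (λ D → ι D * f D) ≗ (λ D → ι D * window f D + weighted f D)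
  window-x f D = begin
    ΣFin {d} (λ r → ι (D ℕ.+ toℕ r) * f (D ℕ.+ toℕ r))
      ≡⟨ Σ-cong {d} (λ r → trans (cong (_* f (D ℕ.+ toℕ r)) (ι-+ D (toℕ r)))
                                 (ℚₚ.*-distribʳ-+ (f (D ℕ.+ toℕ r)) (ι D) (ι (toℕ r)))) ⟩
    ΣFin {d} (λ r → ι D * f (D ℕ.+ toℕ r) + ι (toℕ r) * f (D ℕ.+ toℕ r))
      ≡⟨ Σ-+ {d} (λ r → ι D * f (D ℕ.+ toℕ r)) (λ r → ι (toℕ r) * f (D ℕ.+ toℕ r)) ⟩
    ΣFin {d} (λ r → ι D * f (D ℕ.+ toℕ r)) + weighted f D
      ≡⟨ cong (_+ weighted f D) (Σ-*ˡ {d} (ι D) (λ r → f (D ℕ.+ toℕ r))) ⟩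
    ι D * window f D + weighted f D ∎
    where open ≡-Reasoning

  -- A factor D costs one more averaging: moving one `window` past it leaves D times `window f`,
  -- covered by induction, and `weighted f`, which the remaining averagings annihilate.
  window^-x : ∀ k f → (∀ D → (window ^∘ k) f D ≡ 0ℚ) → ∀ D → (window ^∘ suc k) (λ D → ι D * f D) D ≡ 0ℚ
  window^-x zero    f e D = window^-0 1 (λ E → trans (cong (ι E *_) (e E)) (ℚₚ.*-zeroʳ (ι E))) D
  window^-x (suc k) f e D = begin
    (window ^∘ suc (suc k)) xf D
      ≡⟨ cong (λ (h : Seq) → h D) (sym (^∘-comm window (suc k) xf)) ⟩
    (window ^∘ suc k) (window xf) D
      ≡⟨ window^-cong′ (suc k) (window-x f) D ⟩
    (window ^∘ suc k) (λ D → ι D * window f D + weighted f D) D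
      ≡⟨ window^-+ (suc k) (λ D → ι D * window f D) (weighted f) D ⟩
    (window ^∘ suc k) (λ D → ι D * window f D) D + (window ^∘ suc k) (weighted f) D
      ≡⟨ cong₂ _+_ (window^-x k (window f) (λ E → trans (cong (λ (h : Seq) → h E) (^∘-comm window k f)) (e E)) D)
                   (trans (window^-weighted (suc k) f D)
                          (Σ-zero {d} (λ r → trans (cong (ι (toℕ r) *_) (e (D ℕ.+ toℕ r))) (ℚₚ.*-zeroʳ (ι (toℕ r)))))) ⟩
    0ℚ + 0ℚ
      ≡⟨ ℚₚ.+-identityˡ 0ℚ ⟩
    0ℚ ∎
    where
    open ≡-Reasoning
    xf : Seq
    xf D = ι D * f D

  -- Each Horner step multiplies by D once and therefore uses up one averaging.
  window^-Poly : ∀ {m g} (u : Seq) → (∀ D → window u D ≡ 0ℚ) → Poly m g →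
    ∀ D → (window ^∘ m) (λ D → u D * g (ι D)) D ≡ 0ℚ
  window^-Poly u u0 (null z) D = trans (cong (u D *_) (z (ι D))) (ℚₚ.*-zeroʳ (u D))
  window^-Poly {suc m} {g} u u0 (horner c h p q) D = begin
    (window ^∘ suc m) (λ D → u D * g (ι D)) D
      ≡⟨ window^-cong′ (suc m) (λ E → trans (cong (u E *_) (q (ι E))) (lem (u E) c (ι E) (h (ι E)))) D ⟩
    (window ^∘ suc m) (λ D → c * u D + ι D * (u D * h (ι D))) D
      ≡⟨ window^-+ (suc m) (λ D → c * u D) (λ D → ι D * (u D * h (ι D))) D ⟩
    (window ^∘ suc m) (λ D → c * u D) D + (window ^∘ suc m) (λ D → ι D * (u D * h (ι D))) D
      ≡⟨ cong₂ _+_ constant (window^-x m (λ D → u D * h (ι D)) (window^-Poly u u0 p) D) ⟩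
    0ℚ + 0ℚ
      ≡⟨ ℚₚ.+-identityˡ 0ℚ ⟩
    0ℚ ∎
    where
    open ≡-Reasoning
    lem : ∀ u c x y → u * (c + x * y) ≡ c * u + x * (u * y)
    lem = solve-∀ ℚ-ring
    constant : (window ^∘ suc m) (λ D → c * u D) D ≡ 0ℚ
    constant = trans (window^-*ˡ (suc m) c u D)
      (trans (cong (c *_) (trans (cong (λ (h : Seq) → h D) (sym (^∘-comm window m u))) (window^-0 m u0 D)))
             (ℚₚ.*-zeroʳ c))

  d∣ : Seq
  d∣ D = ⟦ D % d ℕₚ.≟ 0 ⟧

  -- Sliding the window by one replaces D by D + d, which has the same remainder, so everything
  -- reduces to the window starting at 0.
  window-d∣ : ∀ D → window d∣ D ≡ 1ℚ
  window-d∣ zero = Σ-unique {d} (λ r → toℕ r % d ℕₚ.≟ 0) zero refl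
    (λ r e → Finₚ.toℕ-injective (trans (sym (m<n⇒m%n≡m (Finₚ.toℕ<n r))) e))
  window-d∣ (suc D) = begin
    ΣFin {d} (λ r → d∣ (suc D ℕ.+ toℕ r))
      ≡⟨ Σ-last {d′} (λ r → d∣ (suc D ℕ.+ r)) ⟩
    ΣFin {d′} (λ r → d∣ (suc D ℕ.+ toℕ r)) + d∣ (suc D ℕ.+ d′)
      ≡⟨ cong₂ _+_ (Σ-cong {d′} (λ r → cong d∣ (sym (ℕₚ.+-suc D (toℕ r)))))
                   (trans (cong d∣ (sym (ℕₚ.+-suc D d′)))
                     (trans (cong (λ t → ⟦ t ℕₚ.≟ 0 ⟧) ([m+n]%n≡m%n D d)) (cong d∣ (sym (ℕₚ.+-identityʳ D))))) ⟩
    ΣFin {d′} (λ r → d∣ (D ℕ.+ suc (toℕ r))) + d∣ (D ℕ.+ 0)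
      ≡⟨ ℚₚ.+-comm (ΣFin {d′} (λ r → d∣ (D ℕ.+ suc (toℕ r)))) (d∣ (D ℕ.+ 0)) ⟩
    window d∣ D
      ≡⟨ window-d∣ D ⟩
    1ℚ ∎
    where open ≡-Reasoning

  ε : Seq
  ε D = ι d * d∣ D - 1ℚ

  window-ε : ∀ D → window ε D ≡ 0ℚ
  window-ε D = begin
    window ε D
      ≡⟨ Σ-- {d} (λ r → ι d * d∣ (D ℕ.+ toℕ r)) (λ _ → 1ℚ) ⟩
    ΣFin {d} (λ r → ι d * d∣ (D ℕ.+ toℕ r)) - ΣFin {d} (λ _ → 1ℚ)
      ≡⟨ cong₂ (λ s t → s - t) (trans (Σ-*ˡ {d} (ι d) (λ r → d∣ (D ℕ.+ toℕ r))) (cong (ι d *_) (window-d∣ D))) (trans (Σ-constant d 1ℚ) (ℚₚ.*-identityʳ (ι d))) ⟩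
    ι d * 1ℚ - ι d
      ≡⟨ lem (ι d) ⟩
    0ℚ ∎
    where
    open ≡-Reasoning
    lem : ∀ x → x * 1ℚ - x ≡ 0ℚ
    lem = solve-∀ ℚ-ring

*-^ : ∀ x y k → (x * y) ^ℚ k ≡ (x ^ℚ k) * (y ^ℚ k)
*-^ x y zero    = refl
*-^ x y (suc k) = trans (cong (x * y *_) (*-^ x y k)) (lem x y (x ^ℚ k) (y ^ℚ k))
  where
  lem : ∀ x y p q → x * y * (p * q) ≡ x * p * (y * q)
  lem = solve-∀ ℚ-ring

-- Evaluation of the series at large integers

module Evaluation (a d′ : ℕ) where
  open Dilation d′
  open Averaging d′
  open Closed a d′

  -- This is b - 1, the largest shift in one factor. Evaluating n factors at D + n s keeps every
  -- shifted argument at least D.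
  s : ℕ
  s = a ℕ.+ d′

  z^-∸ : ∀ {k D} f → k ≤ D → z^ k f D ≡ f (D ∸ k)
  z^-∸ {k} {D} f k≤D = trans (cong (z^ k f) (sym (ℕₚ.m+[n∸m]≡n k≤D))) (z^-+-eval k f (D ∸ k))

  A-window : ∀ f D → A f (D ℕ.+ s) ≡ window f D
  A-window f D = begin
    A f (D ℕ.+ s)
      ≡⟨ cong (A f) (trans (sym (ℕₚ.+-assoc D a d′)) (trans (cong (ℕ._+ d′) (ℕₚ.+-comm D a)) (ℕₚ.+-assoc a D d′))) ⟩
    A f (a ℕ.+ (D ℕ.+ d′))
      ≡⟨ z^-+-eval a (B d f) (D ℕ.+ d′) ⟩
    ΣFin {d} (λ r → z^ (toℕ r) f (D ℕ.+ d′))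
      ≡⟨ Σ-cong {d} (λ r → trans (z^-∸ f (ℕₚ.≤-trans (Finₚ.toℕ≤pred[n] r) (ℕₚ.m≤n+m d′ D)))
                                 (cong f (ℕₚ.+-∸-assoc D (Finₚ.toℕ≤pred[n] r)))) ⟩
    ΣFin {d} (λ r → f (D ℕ.+ (d ∸ suc (toℕ r))))
      ≡⟨ Σ-reverse d (λ r → f (D ℕ.+ r)) ⟩
    window f D ∎
    where open ≡-Reasoning

  A^-window : ∀ n f D → (A ^∘ n) f (D ℕ.+ n ℕ.* s) ≡ (window ^∘ n) f D
  A^-window zero    f D = cong f (ℕₚ.+-identityʳ D)
  A^-window (suc n) f D = trans
    (cong (A ((A ^∘ n) f)) (trans (cong (D ℕ.+_) (ℕₚ.+-comm s (n ℕ.* s))) (sym (ℕₚ.+-assoc D (n ℕ.* s) s))))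
    (trans (A-window ((A ^∘ n) f) (D ℕ.+ n ℕ.* s))
      (Σ-cong {d} (λ r → trans (cong ((A ^∘ n) f) (+-right-comm D (n ℕ.* s) (toℕ r))) (A^-window n f (D ℕ.+ toℕ r)))))

  Sab-window : ∀ g D → Sab a b g (ι (D ℕ.+ s)) ≡ window (g ∘ ι) D
  Sab-window g D = trans (cong (λ k → ΣFin {k} (λ t → iter (a ℕ.+ toℕ t) S g (ι (D ℕ.+ s)))) (ℕₚ.m+n∸m≡n a d)) (begin
    ΣFin {d} (λ t → iter (a ℕ.+ toℕ t) S g (ι (D ℕ.+ s)))
      ≡⟨ Σ-cong {d} (λ t → trans (iter-S (a ℕ.+ toℕ t) g (ι (D ℕ.+ s))) (cong g (shift (toℕ t) (Finₚ.toℕ≤pred[n] t)))) ⟩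
    ΣFin {d} (λ t → g (ι (D ℕ.+ (d ∸ suc (toℕ t)))))
      ≡⟨ Σ-reverse d (λ r → g (ι (D ℕ.+ r))) ⟩
    window (g ∘ ι) D ∎)
    where
    open ≡-Reasoning
    lem : ∀ x y → x + y - y ≡ x
    lem = solve-∀ ℚ-ring
    shift : ∀ t → t ≤ d′ → ι (D ℕ.+ s) - ι (a ℕ.+ t) ≡ ι (D ℕ.+ (d′ ∸ t))
    shift t t≤d′ = trans
      (cong (λ x → x - ι (a ℕ.+ t)) (trans (cong ι regroup) (ι-+ (D ℕ.+ (d′ ∸ t)) (a ℕ.+ t))))
      (lem (ι (D ℕ.+ (d′ ∸ t))) (ι (a ℕ.+ t)))
      where
      regroup : D ℕ.+ (a ℕ.+ d′) ≡ D ℕ.+ (d′ ∸ t) ℕ.+ (a ℕ.+ t)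
      regroup = begin
        D ℕ.+ (a ℕ.+ d′)                 ≡⟨ cong (λ u → D ℕ.+ (a ℕ.+ u)) (sym (ℕₚ.m∸n+n≡m t≤d′)) ⟩
        D ℕ.+ (a ℕ.+ (d′ ∸ t ℕ.+ t))     ≡⟨ cong (D ℕ.+_) (trans (sym (ℕₚ.+-assoc a (d′ ∸ t) t)) (trans (cong (ℕ._+ t) (ℕₚ.+-comm a (d′ ∸ t))) (ℕₚ.+-assoc (d′ ∸ t) a t))) ⟩
        D ℕ.+ (d′ ∸ t ℕ.+ (a ℕ.+ t))     ≡⟨ sym (ℕₚ.+-assoc D (d′ ∸ t) (a ℕ.+ t)) ⟩
        D ℕ.+ (d′ ∸ t) ℕ.+ (a ℕ.+ t)     ∎

  iter-Sab-window : ∀ n g D → iter n (Sab a b) g (ι (D ℕ.+ n ℕ.* s)) ≡ (window ^∘ n) (g ∘ ι) D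
  iter-Sab-window zero    g D = cong (g ∘ ι) (ℕₚ.+-identityʳ D)
  iter-Sab-window (suc n) g D = trans
    (cong (λ t → Sab a b (iter n (Sab a b) g) (ι t)) (trans (cong (D ℕ.+_) (ℕₚ.+-comm s (n ℕ.* s))) (sym (ℕₚ.+-assoc D (n ℕ.* s) s))))
    (trans (Sab-window (iter n (Sab a b) g) (D ℕ.+ n ℕ.* s))
      (Σ-cong {d} (λ r → trans (cong (iter n (Sab a b) g ∘ ι) (+-right-comm D (n ℕ.* s) (toℕ r))) (iter-Sab-window n g (D ℕ.+ toℕ r)))))

  -- At a multiple D = d e the factor d^(n+1) turns e^n into d D^n. The bound 1 ≤ D matters for n =
  -- 0: there D^0 is 1 at D = 0 while `level` vanishes.
  dil-level : ∀ n D → 1 ≤ D →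
    (ι d ^ℚ suc n) * dil (level n 0) D ≡ ε D * (ι D ^ℚ n) + ι D ^ℚ n
  dil-level n D 1≤D with D % d ℕₚ.≟ 0
  ... | no _ = lem (ι d ^ℚ suc n) (level n 0 (D DM./ d)) (ι d) (ι D ^ℚ n)
    where
    lem : ∀ x y w p → x * (0ℚ * y) ≡ (w * 0ℚ - 1ℚ) * p + p
    lem = solve-∀ ℚ-ring
  ... | yes D%d≡0 with D DM./ d in eq
  ...   | zero  = contradiction (trans D≡ (cong (ℕ._* d) eq)) (λ { refl → contradiction 1≤D λ () })
    where D≡ = trans (m≡m%n+[m/n]*n D d) (cong (ℕ._+ D DM./ d ℕ.* d) D%d≡0)
  ...   | suc e = trans (lem₁ (ι d) (ι d ^ℚ n) (ι (suc e) ^ℚ n))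
                        (trans (cong (ι d *_) power) (lem₂ (ι d) (ι D ^ℚ n)))
    where
    D≡ : D ≡ suc e ℕ.* d
    D≡ = trans (m≡m%n+[m/n]*n D d) (cong₂ (λ x y → x ℕ.+ y ℕ.* d) D%d≡0 eq)
    power : (ι (suc e) ^ℚ n) * (ι d ^ℚ n) ≡ ι D ^ℚ n
    power = trans (sym (*-^ (ι (suc e)) (ι d) n)) (cong (_^ℚ n) (trans (sym (ι-* (suc e) d)) (cong ι (sym D≡))))
    lem₁ : ∀ x p q → (x * p) * (1ℚ * (1ℚ * q)) ≡ x * (q * p)
    lem₁ = solve-∀ ℚ-ring
    lem₂ : ∀ x p → x * p ≡ (x * 1ℚ - 1ℚ) * p + p
    lem₂ = solve-∀ ℚ-ring

  series-eval : ∀ n M → 1 ≤ M →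
    (ι d ^ℚ suc n) * series n 0 (M ℕ.+ suc n ℕ.* s)
      ≡ iter (suc n) (Sab a b) (λ x → x ^ℚ n) (ι (M ℕ.+ suc n ℕ.* s))
  series-eval n M 1≤M = begin
    (ι d ^ℚ suc n) * series n 0 (M ℕ.+ suc n ℕ.* s)
      ≡⟨ cong ((ι d ^ℚ suc n) *_) (A^-window (suc n) (dil (level n 0)) M) ⟩
    (ι d ^ℚ suc n) * (window ^∘ suc n) (dil (level n 0)) M
      ≡⟨ sym (window^-*ˡ (suc n) (ι d ^ℚ suc n) (dil (level n 0)) M) ⟩
    (window ^∘ suc n) (λ D → (ι d ^ℚ suc n) * dil (level n 0) D) M
      ≡⟨ window^-cong (suc n) (dil-level n) M 1≤M ⟩
    (window ^∘ suc n) (λ D → ε D * (ι D ^ℚ n) + ι D ^ℚ n) M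
      ≡⟨ window^-+ (suc n) (λ D → ε D * (ι D ^ℚ n)) (λ D → ι D ^ℚ n) M ⟩
    (window ^∘ suc n) (λ D → ε D * (ι D ^ℚ n)) M + (window ^∘ suc n) (λ D → ι D ^ℚ n) M
      -- D^n has degree below n + 1, so the n + 1 averagings annihilate its product with `ε`.
      ≡⟨ cong (_+ (window ^∘ suc n) (λ D → ι D ^ℚ n) M) (window^-Poly ε window-ε (Poly-^ n) M) ⟩
    0ℚ + (window ^∘ suc n) (λ D → ι D ^ℚ n) M
      ≡⟨ ℚₚ.+-identityˡ ((window ^∘ suc n) (λ D → ι D ^ℚ n) M) ⟩
    (window ^∘ suc n) (λ D → ι D ^ℚ n) M
      ≡⟨ sym (iter-Sab-window (suc n) (λ x → x ^ℚ n) M) ⟩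
    iter (suc n) (Sab a b) (λ x → x ^ℚ n) (ι (M ℕ.+ suc n ℕ.* s)) ∎
    where open ≡-Reasoning

-- Counting integer points: the first label

Σbox : ∀ n (D : ℕ) → (Vec ℕ n → ℚ) → ℚ
Σbox zero    D F = F []
Σbox (suc n) D F = ΣFin {D} (λ t → Σbox n D (λ x → F (toℕ t ∷ x)))

InBox : ∀ {n} → ℕ → Vec ℕ n → Set
InBox D x = ∀ i → lookup x i < D

Σbox-cong : ∀ n D {F G : Vec ℕ n → ℚ} → (∀ x → InBox D x → F x ≡ G x) → Σbox n D F ≡ Σbox n D G
Σbox-cong zero    D e = e [] (λ ())
Σbox-cong (suc n) D e = Σ-cong {D} λ t → Σbox-cong n D λ x bx →
  e (toℕ t ∷ x) (λ { zero → Finₚ.toℕ<n t ; (suc i) → bx i })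

Σbox-zero : ∀ n D {F : Vec ℕ n → ℚ} → (∀ x → InBox D x → F x ≡ 0ℚ) → Σbox n D F ≡ 0ℚ
Σbox-zero zero    D e = e [] (λ ())
Σbox-zero (suc n) D e = Σ-zero {D} λ t → Σbox-zero n D λ x bx →
  e (toℕ t ∷ x) (λ { zero → Finₚ.toℕ<n t ; (suc i) → bx i })

Σbox-Σ : ∀ n D {m} (F : Fin m → Vec ℕ n → ℚ) →
  Σbox n D (λ x → ΣFin (λ i → F i x)) ≡ ΣFin (λ i → Σbox n D (F i))
Σbox-Σ zero    D F = refl
Σbox-Σ (suc n) D F = trans (Σ-cong {D} (λ t → Σbox-Σ n D (λ i x → F i (toℕ t ∷ x))))
                           (Σ-swap {D} (λ t i → Σbox n D (λ x → F i (toℕ t ∷ x))))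

Σbox-swap : ∀ n k D (F : Vec ℕ n → Vec ℕ k → ℚ) →
  Σbox n D (λ x → Σbox k D (F x)) ≡ Σbox k D (λ y → Σbox n D (λ x → F x y))
Σbox-swap n zero    D F = refl
Σbox-swap n (suc k) D F = trans (Σbox-Σ n D {D} (λ t x → Σbox k D (λ y → F x (toℕ t ∷ y))))
                                (Σ-cong {D} (λ t → Σbox-swap n k D (λ x y → F x (toℕ t ∷ y))))

Σbox-*ˡ : ∀ n D c (F : Vec ℕ n → ℚ) → Σbox n D (λ x → c * F x) ≡ c * Σbox n D F
Σbox-*ˡ zero    D c F = refl
Σbox-*ˡ (suc n) D c F = trans (Σ-cong {D} (λ t → Σbox-*ˡ n D c (λ x → F (toℕ t ∷ x))))
                              (Σ-*ˡ {D} c (λ t → Σbox n D (λ x → F (toℕ t ∷ x))))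

Σbox-insert : ∀ n D (v : Fin (suc n)) (F : Vec ℕ (suc n) → ℚ) →
  Σbox (suc n) D F ≡ ΣFin {D} (λ g → Σbox n D (λ x → F (insertAt x v (toℕ g))))
Σbox-insert n       D zero    F = refl
Σbox-insert (suc n) D (suc v) F = trans
  (Σ-cong {D} (λ t → Σbox-insert n D v (λ x → F (toℕ t ∷ x))))
  (Σ-swap {D} {D} (λ t g → Σbox n D (λ x → F (toℕ t ∷ insertAt x v (toℕ g)))))

Σ-shift : ∀ g D (f : ℕ → ℚ) → g ≤ D → (∀ t → t < g → f t ≡ 0ℚ) →
  ΣFin {D} (f ∘ toℕ) ≡ ΣFin {D ∸ g} (λ t → f (g ℕ.+ toℕ t))
Σ-shift zero    D       f g≤D       e = refl
Σ-shift (suc g) (suc D) f (s≤s g≤D) e = trans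
  (cong₂ _+_ (e 0 (s≤s z≤n)) (Σ-shift g D (f ∘ suc) g≤D (λ t t<g → e (suc t) (s≤s t<g))))
  (ℚₚ.+-identityˡ (ΣFin {D ∸ g} (λ t → f (suc g ℕ.+ toℕ t))))

Σbox-shift : ∀ n g D (F : Vec ℕ n → ℚ) → g ≤ D → (∀ x i → lookup x i < g → F x ≡ 0ℚ) →
  Σbox n D F ≡ Σbox n (D ∸ g) (λ x → F (map (g ℕ.+_) x))
Σbox-shift zero    g D F g≤D e = refl
Σbox-shift (suc n) g D F g≤D e = trans
  (Σ-shift g D (λ t → Σbox n D (λ x → F (t ∷ x))) g≤D
    (λ t t<g → Σbox-zero n D (λ x _ → e (t ∷ x) zero t<g)))
  (Σ-cong {D ∸ g} (λ t → Σbox-shift n g D (λ x → F (g ℕ.+ toℕ t ∷ x)) g≤D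
    (λ x i x<g → e (g ℕ.+ toℕ t ∷ x) (suc i) x<g)))

data PunchView {n} (v : Fin (suc n)) : Fin (suc n) → Set where
  here  : PunchView v v
  there : ∀ i → PunchView v (punchIn v i)

punchView : ∀ {n} (v i : Fin (suc n)) → PunchView v i
punchView v i with v Finₚ.≟ i
... | yes refl = here
... | no v≢i   = subst (PunchView v) (Finₚ.punchIn-punchOut v≢i) (there (punchOut v≢i))

punchIn-≥ : ∀ {n} (v : Fin (suc n)) (i : Fin n) → toℕ v ≤ toℕ i → toℕ (punchIn v i) ≡ suc (toℕ i)
punchIn-≥ zero    i       _         = refl
punchIn-≥ (suc v) (suc i) (s≤s v≤i) = cong suc (punchIn-≥ v i v≤i)

punchIn-< : ∀ {n} (v : Fin (suc n)) (i : Fin n) → toℕ i < toℕ v → toℕ (punchIn v i) ≡ toℕ i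
punchIn-< (suc v) zero    _         = refl
punchIn-< (suc v) (suc i) (s≤s i<v) = cong suc (punchIn-< v i i<v)

punchIn-mono-< : ∀ {n} (v : Fin (suc n)) (i k : Fin n) → toℕ i < toℕ k → toℕ (punchIn v i) < toℕ (punchIn v k)
punchIn-mono-< zero    i       k       i<k       = s≤s i<k
punchIn-mono-< (suc v) zero    (suc k) i<k       = s≤s z≤n
punchIn-mono-< (suc v) (suc i) (suc k) (s≤s i<k) = s≤s (punchIn-mono-< v i k i<k)

punchIn-cancel-< : ∀ {n} (v : Fin (suc n)) (i k : Fin n) → toℕ (punchIn v i) < toℕ (punchIn v k) → toℕ i < toℕ k
punchIn-cancel-< zero    i       k       (s≤s p) = p
punchIn-cancel-< (suc v) zero    (suc k) p       = s≤s z≤n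
punchIn-cancel-< (suc v) (suc i) (suc k) (s≤s p) = s≤s (punchIn-cancel-< v i k p)

-- Ties go to the smaller label: equal positions are admissible only for a = 0, and they are then
-- read as ascents of length 0.
First : ∀ {n} → Fin n → (Fin n → ℕ) → Set
First v x = ∀ u → (toℕ u < toℕ v → x v < x u) × (toℕ v < toℕ u → x v ≤ x u)

first? : ∀ {n} (v : Fin n) (x : Fin n → ℕ) → Dec (First v x)
first? v x = Finₚ.all? λ u → ((toℕ u ℕₚ.<? toℕ v) →-dec (x v ℕₚ.<? x u)) ×-dec ((toℕ v ℕₚ.<? toℕ u) →-dec (x v ℕₚ.≤? x u))

First-≤ : ∀ {n v} {x : Fin n → ℕ} → First v x → ∀ u → x v ≤ x u
First-≤ {v = v} fv u with ℕₚ.<-cmp (toℕ u) (toℕ v)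
... | tri< u<v _ _ = ℕₚ.<⇒≤ (proj₁ (fv u) u<v)
... | tri≈ _ u≡v _ with Finₚ.toℕ-injective u≡v
...   | refl = ℕₚ.≤-refl
First-≤ fv u | tri> _ _ v<u = proj₂ (fv u) v<u

first-exists : ∀ {n} (x : Fin (suc n) → ℕ) → ∃ λ v → First v x
first-exists {zero}  x = zero , λ { zero → (λ ()) , (λ ()) }
first-exists {suc n} x with first-exists (x ∘ suc)
... | v , fv with x zero ℕₚ.≤? x (suc v)
...   | yes x₀≤ = zero , λ { zero → (λ ()) , (λ ()) ; (suc u) → (λ ()) , (λ _ → ℕₚ.≤-trans x₀≤ (First-≤ fv u)) }
...   | no x₀≰  = suc v , λ { zero → (λ _ → ℕₚ.≰⇒> x₀≰) , (λ ())
                            ; (suc u) → (λ { (s≤s u<v) → proj₁ (fv u) u<v }) , (λ { (s≤s v<u) → proj₂ (fv u) v<u }) }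

first-unique : ∀ {n v w} {x : Fin n → ℕ} → First v x → First w x → v ≡ w
first-unique {v = v} {w} fv fw with ℕₚ.<-cmp (toℕ v) (toℕ w)
... | tri< v<w _ _ = contradiction (proj₂ (fv w) v<w) (ℕₚ.<⇒≱ (proj₁ (fw v) v<w))
... | tri≈ _ v≡w _ = Finₚ.toℕ-injective v≡w
... | tri> _ _ w<v = contradiction (proj₂ (fw v) w<v) (ℕₚ.<⇒≱ (proj₁ (fv w) w<v))

m+n≤o⇒n≤o∸m : ∀ m {n o} → m ℕ.+ n ≤ o → n ≤ o ∸ m
m+n≤o⇒n≤o∸m m {n} {o} le = ℕₚ.m+n≤o⇒m≤o∸n n (subst (_≤ o) (ℕₚ.+-comm m n) le)

module Count (a d′ : ℕ) where
  open Closed a d′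

  -- Position 0 holds the label placed last, which exceeds exactly the labels below j. Position D is
  -- the return to the smallest label of all, so the closing step is a descent and takes at least b;
  -- `b ≤ D` says so when no labels remain.
  Good : ∀ {n} → ℕ → ℕ → (Fin n → ℕ) → Set
  Good j D x = (b ≤ D) × (∀ i → lower j (toℕ i) ≤ x i) × (∀ i → x i ℕ.+ b ≤ D) ×
    (∀ i k → toℕ i < toℕ k → (x k ℕ.+ b ≤ x i) ⊎ (x i ℕ.+ a ≤ x k))

  good? : ∀ {n} j D (x : Fin n → ℕ) → Dec (Good j D x)
  good? j D x = (b ℕₚ.≤? D) ×-dec Finₚ.all? (λ i → lower j (toℕ i) ℕₚ.≤? x i) ×-dec
    Finₚ.all? (λ i → x i ℕ.+ b ℕₚ.≤? D) ×-dec
    Finₚ.all? (λ i → Finₚ.all? λ k → (toℕ i ℕₚ.<? toℕ k) →-dec ((x k ℕ.+ b ℕₚ.≤? x i) ⊎-dec (x i ℕ.+ a ℕₚ.≤? x k)))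

  count : ℕ → ℕ → Seq
  count n j D = Σbox n D (λ x → ⟦ good? j D (lookup x) ⟧)

  1≤b : 1 ≤ b
  1≤b = ℕₚ.≤-trans (s≤s z≤n) (ℕₚ.m≤n+m (suc d′) a)

  lower-< : ∀ {j v} → v < j → lower j v ≡ b
  lower-< {j} {v} v<j = cong (λ t → if t then b else a) (dec-true (v ℕₚ.<? j) v<j)

  lower-≥ : ∀ {j v} → j ≤ v → lower j v ≡ a
  lower-≥ {j} {v} j≤v = cong (λ t → if t then b else a) (dec-false (v ℕₚ.<? j) (ℕₚ.≤⇒≯ j≤v))

  a≤lower : ∀ j v → a ≤ lower j v
  a≤lower j v with does (v ℕₚ.<? j)
  ... | true  = ℕₚ.m≤m+n a (suc d′)
  ... | false = ℕₚ.≤-refl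

  -- The label v is next after the origin, at distance g; `y` gives the others, measured from v and
  -- renumbered.
  module Remove {n} (v : Fin (suc n)) (g D : ℕ) (X : Fin (suc n) → ℕ) (y : Fin n → ℕ)
                (Xv : X v ≡ g) (Xp : ∀ i → X (punchIn v i) ≡ g ℕ.+ y i) (j : ℕ) where

    to : Good j D X × First v X → lower j (toℕ v) ≤ g × Good (toℕ v) (D ∸ g) y
    to ((b≤D , low , high , pair) , fv) = lowv , (highv , low′ , high′ , pair′)
      where
      lowv = subst (lower j (toℕ v) ≤_) Xv (low v)
      highv = m+n≤o⇒n≤o∸m g (subst (λ t → t ℕ.+ b ≤ D) Xv (high v))
      high′ : ∀ i → y i ℕ.+ b ≤ D ∸ g
      high′ i = m+n≤o⇒n≤o∸m g (subst (_≤ D) (trans (cong (ℕ._+ b) (Xp i)) (ℕₚ.+-assoc g (y i) b)) (high (punchIn v i)))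
      low′ : ∀ i → lower (toℕ v) (toℕ i) ≤ y i
      low′ i with toℕ i ℕₚ.<? toℕ v
      ... | yes i<v = subst (_≤ y i) (sym (lower-< i<v)) (case-pair (pair (punchIn v i) v p<v))
        where
        p<v : toℕ (punchIn v i) < toℕ v
        p<v = subst (_< toℕ v) (sym (punchIn-< v i i<v)) i<v
        case-pair : _ → b ≤ y i
        case-pair (inj₁ q) = ℕₚ.+-cancelˡ-≤ g b (y i) (subst (λ t → t ℕ.+ b ≤ g ℕ.+ y i) Xv (subst (X v ℕ.+ b ≤_) (Xp i) q))
        case-pair (inj₂ q) = contradiction (ℕₚ.m+n≤o⇒m≤o (X (punchIn v i)) q) (ℕₚ.<⇒≱ (proj₁ (fv (punchIn v i)) p<v))
      ... | no i≮v = subst (_≤ y i) (sym (lower-≥ v≤i)) (case-pair (pair v (punchIn v i) v<p))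
        where
        v≤i = ℕₚ.≮⇒≥ i≮v
        v<p : toℕ v < toℕ (punchIn v i)
        v<p = subst (toℕ v <_) (sym (punchIn-≥ v i v≤i)) (s≤s v≤i)
        case-pair : _ → a ≤ y i
        case-pair (inj₁ q) = contradiction (proj₂ (fv (punchIn v i)) v<p)
          (ℕₚ.<⇒≱ (ℕₚ.<-≤-trans (ℕₚ.m<m+n (X (punchIn v i)) 1≤b) q))
        case-pair (inj₂ q) = ℕₚ.+-cancelˡ-≤ g a (y i) (subst (λ t → t ℕ.+ a ≤ g ℕ.+ y i) Xv (subst (X v ℕ.+ a ≤_) (Xp i) q))
      pair′ : ∀ i k → toℕ i < toℕ k → (y k ℕ.+ b ≤ y i) ⊎ (y i ℕ.+ a ≤ y k)
      pair′ i k i<k = cancel (pair (punchIn v i) (punchIn v k) (punchIn-mono-< v i k i<k))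
        where
        cancel-+ : ∀ p q c → X (punchIn v p) ℕ.+ c ≤ X (punchIn v q) → y p ℕ.+ c ≤ y q
        cancel-+ p q c le = ℕₚ.+-cancelˡ-≤ g (y p ℕ.+ c) (y q)
          (subst₂ _≤_ (trans (cong (ℕ._+ c) (Xp p)) (ℕₚ.+-assoc g (y p) c)) (Xp q) le)
        cancel : _ → _
        cancel (inj₁ q) = inj₁ (cancel-+ k i b q)
        cancel (inj₂ q) = inj₂ (cancel-+ i k a q)

    from : g ≤ D → lower j (toℕ v) ≤ g × Good (toℕ v) (D ∸ g) y → Good j D X × First v X
    from g≤D (lowv , (b≤ , low , high , pair)) =
      (ℕₚ.≤-trans b≤ (ℕₚ.m∸n≤m D g) , (λ i → low′ i (punchView v i)) , (λ i → high′ i (punchView v i)) ,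
        (λ i k → pair′ i k (punchView v i) (punchView v k))) , (λ u → first′ u (punchView v u))
      where
      below : ∀ i → toℕ i < toℕ v → b ≤ y i
      below i i<v = subst (_≤ y i) (lower-< i<v) (low i)
      above : ∀ i → toℕ v ≤ toℕ i → a ≤ y i
      above i v≤i = subst (_≤ y i) (lower-≥ v≤i) (low i)
      p<v⇒i<v : ∀ i → toℕ (punchIn v i) < toℕ v → toℕ i < toℕ v
      p<v⇒i<v i p<v with toℕ i ℕₚ.<? toℕ v
      ... | yes i<v = i<v
      ... | no i≮v  = contradiction p<v (ℕₚ.≤⇒≯ (subst (toℕ v ≤_) (sym (punchIn-≥ v i (ℕₚ.≮⇒≥ i≮v))) (ℕₚ.m≤n⇒m≤1+n (ℕₚ.≮⇒≥ i≮v))))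
      v<p⇒v≤i : ∀ i → toℕ v < toℕ (punchIn v i) → toℕ v ≤ toℕ i
      v<p⇒v≤i i v<p with toℕ i ℕₚ.<? toℕ v
      ... | no i≮v  = ℕₚ.≮⇒≥ i≮v
      ... | yes i<v = contradiction (subst (toℕ v <_) (punchIn-< v i i<v) v<p) (ℕₚ.<⇒≯ i<v)
      low′ : ∀ i → PunchView v i → lower j (toℕ i) ≤ X i
      low′ _ here = subst (lower j (toℕ v) ≤_) (sym Xv) lowv
      low′ _ (there i) = subst (lower j (toℕ (punchIn v i)) ≤_) (sym (Xp i)) bound
        where
        bound : lower j (toℕ (punchIn v i)) ≤ g ℕ.+ y i
        bound with toℕ (punchIn v i) ℕₚ.<? j | toℕ i ℕₚ.<? toℕ v
        ... | no p≮j  | _       = subst (_≤ g ℕ.+ y i) (sym (lower-≥ (ℕₚ.≮⇒≥ p≮j))) (ℕₚ.≤-trans (ℕₚ.≤-trans (a≤lower j (toℕ v)) lowv) (ℕₚ.m≤m+n g (y i)))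
        ... | yes p<j | yes i<v = subst (_≤ g ℕ.+ y i) (sym (lower-< p<j)) (ℕₚ.≤-trans (below i i<v) (ℕₚ.m≤n+m (y i) g))
        -- Here v < p < j, so the step to v is itself a descent and already supplies b.
        ... | yes p<j | no i≮v  = subst (_≤ g ℕ.+ y i) (sym (lower-< p<j)) (ℕₚ.≤-trans (subst (_≤ g) (lower-< v<j) lowv) (ℕₚ.m≤m+n g (y i)))
          where
          v<j : toℕ v < j
          v<j = ℕₚ.<-trans (subst (toℕ v <_) (sym (punchIn-≥ v i (ℕₚ.≮⇒≥ i≮v))) (s≤s (ℕₚ.≮⇒≥ i≮v))) p<j
      add : ∀ t → t ≤ D ∸ g → g ℕ.+ t ≤ D
      add t t≤ = subst (g ℕ.+ t ≤_) (ℕₚ.m+[n∸m]≡n g≤D) (ℕₚ.+-monoʳ-≤ g t≤)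
      high′ : ∀ i → PunchView v i → X i ℕ.+ b ≤ D
      high′ _ here      = subst (λ t → t ℕ.+ b ≤ D) (sym Xv) (add b b≤)
      high′ _ (there i) = subst (_≤ D) (trans (sym (ℕₚ.+-assoc g (y i) b)) (cong (ℕ._+ b) (sym (Xp i)))) (add (y i ℕ.+ b) (high i))
      raise : ∀ {p q c} → y p ℕ.+ c ≤ y q → X (punchIn v p) ℕ.+ c ≤ X (punchIn v q)
      raise {p} {q} {c} le rewrite Xp p | Xp q | ℕₚ.+-assoc g (y p) c = ℕₚ.+-monoʳ-≤ g le
      raise-v : ∀ {q c} → c ≤ y q → X v ℕ.+ c ≤ X (punchIn v q)
      raise-v {q} le rewrite Xp q | Xv = ℕₚ.+-monoʳ-≤ g le
      pair′ : ∀ i k → PunchView v i → PunchView v k → toℕ i < toℕ k → (X k ℕ.+ b ≤ X i) ⊎ (X i ℕ.+ a ≤ X k)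
      pair′ _ _ here      here      v<v = contradiction v<v (ℕₚ.<-irrefl refl)
      pair′ _ _ here      (there k) v<p = inj₂ (raise-v (above k (v<p⇒v≤i k v<p)))
      pair′ _ _ (there i) here      p<v = inj₁ (raise-v (below i (p<v⇒i<v i p<v)))
      pair′ _ _ (there i) (there k) p<p with pair i k (punchIn-cancel-< v i k p<p)
      ... | inj₁ q = inj₁ (raise {k} {i} q)
      ... | inj₂ q = inj₂ (raise {i} {k} q)
      first′ : ∀ u → PunchView v u → (toℕ u < toℕ v → X v < X u) × (toℕ v < toℕ u → X v ≤ X u)
      first′ _ here      = (λ v<v → contradiction v<v (ℕₚ.<-irrefl refl)) , (λ _ → ℕₚ.≤-refl)
      first′ _ (there i) =
        (λ p<v → ℕₚ.<-≤-trans (ℕₚ.m<m+n (X v) 1≤b) (raise-v (below i (p<v⇒i<v i p<v)))) ,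
        (λ v<p → ℕₚ.≤-trans (ℕₚ.m≤m+n (X v) a) (raise-v (above i (v<p⇒v≤i i v<p))))

  count-0 : ∀ n j → count n j 0 ≡ 0ℚ
  count-0 n j = Σbox-zero n 0 (λ x _ → ⟦⟧-no (λ gd → contradiction (ℕₚ.≤-trans 1≤b (proj₁ gd)) λ ()) (good? j 0 (lookup x)))

  count-zero : ∀ D → count 0 0 D ≡ ⟦ b ℕₚ.≤? D ⟧
  count-zero D = ⟦⟧-cong proj₁ (λ b≤D → b≤D , (λ ()) , (λ ()) , (λ ())) (good? 0 D (lookup [])) (b ℕₚ.≤? D)

  -- Placements are sorted by their unique first label v and its position g; the rest is a placement
  -- on the remaining length D - g, seen from v.
  count-suc : ∀ n j D → count (suc n) j D ≡ ΣFin {suc n} (λ v → ∫ (lower j (toℕ v)) (count n (toℕ v)) D)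
  count-suc n j D = begin
    Σbox (suc n) D (λ x → G x)
      ≡⟨ Σbox-cong (suc n) D (λ x _ → sym (split x)) ⟩
    Σbox (suc n) D (λ x → ΣFin (λ v → G x * H v x))
      ≡⟨ Σbox-Σ (suc n) D (λ v x → G x * H v x) ⟩
    ΣFin (λ v → Σbox (suc n) D (λ x → G x * H v x))
      ≡⟨ Σ-cong (λ v → trans (Σbox-insert n D v (λ x → G x * H v x)) (Σ-cong {D} (λ g → remove v (toℕ g) (ℕₚ.<⇒≤ (Finₚ.toℕ<n g))))) ⟩
    ΣFin {suc n} (λ v → ∫ (lower j (toℕ v)) (count n (toℕ v)) D) ∎
    where
    open ≡-Reasoning
    G : Vec ℕ (suc n) → ℚ
    G x = ⟦ good? j D (lookup x) ⟧
    H : Fin (suc n) → Vec ℕ (suc n) → ℚ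
    H v x = ⟦ first? v (lookup x) ⟧
    split : ∀ x → ΣFin (λ v → G x * H v x) ≡ G x
    split x with first-exists (lookup x)
    ... | v , fv = trans (Σ-*ˡ (G x) (λ v → H v x))
      (trans (cong (G x *_) (Σ-unique (λ v → first? v (lookup x)) v fv (λ w fw → first-unique fw fv))) (ℚₚ.*-identityʳ (G x)))
    remove : ∀ v g → g ≤ D →
      Σbox n D (λ x → G (insertAt x v g) * H v (insertAt x v g)) ≡ ⟦ lower j (toℕ v) ℕₚ.≤? g ⟧ * count n (toℕ v) (D ∸ g)
    remove v g g≤D = begin
      Σbox n D (λ x → G (insertAt x v g) * H v (insertAt x v g))
        ≡⟨ Σbox-shift n g D (λ x → G (insertAt x v g) * H v (insertAt x v g)) g≤D vanish ⟩
      Σbox n (D ∸ g) (λ y → G (X y) * H v (X y))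
        ≡⟨ Σbox-cong n (D ∸ g) (λ y _ → factor y) ⟩
      Σbox n (D ∸ g) (λ y → ⟦ lower j (toℕ v) ℕₚ.≤? g ⟧ * ⟦ good? (toℕ v) (D ∸ g) (lookup y) ⟧)
        ≡⟨ Σbox-*ˡ n (D ∸ g) ⟦ lower j (toℕ v) ℕₚ.≤? g ⟧ (λ y → ⟦ good? (toℕ v) (D ∸ g) (lookup y) ⟧) ⟩
      ⟦ lower j (toℕ v) ℕₚ.≤? g ⟧ * count n (toℕ v) (D ∸ g) ∎
      where
      X : Vec ℕ n → Vec ℕ (suc n)
      X y = insertAt (map (g ℕ.+_) y) v g
      vanish : ∀ x i → lookup x i < g → G (insertAt x v g) * H v (insertAt x v g) ≡ 0ℚ
      vanish x i x<g = trans (cong (G (insertAt x v g) *_) (⟦⟧-no not-first (first? v (lookup (insertAt x v g))))) (ℚₚ.*-zeroʳ (G (insertAt x v g)))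
        where
        not-first : ¬ First v (lookup (insertAt x v g))
        not-first fv = contradiction (First-≤ fv (punchIn v i))
          (ℕₚ.<⇒≱ (subst₂ _<_ (sym (insertAt-punchIn x v g i)) (sym (insertAt-lookup x v g)) x<g))
      factor : ∀ y → G (X y) * H v (X y) ≡ ⟦ lower j (toℕ v) ℕₚ.≤? g ⟧ * ⟦ good? (toℕ v) (D ∸ g) (lookup y) ⟧
      factor y = trans (⟦⟧-× gX fX (gX ×-dec fX))
        (trans (⟦⟧-cong to (from g≤D) (gX ×-dec fX) (lv ×-dec gy)) (sym (⟦⟧-× lv gy (lv ×-dec gy))))
        where
        open Remove v g D (lookup (X y)) (lookup y) (insertAt-lookup (map (g ℕ.+_) y) v g)
          (λ i → trans (insertAt-punchIn (map (g ℕ.+_) y) v g i) (lookup-map i (g ℕ.+_) y)) j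
        gX = good? j D (lookup (X y))
        fX = first? v (lookup (X y))
        lv = lower j (toℕ v) ℕₚ.≤? g
        gy = good? (toℕ v) (D ∸ g) (lookup y)

  count≗series : ∀ n → count n 0 ≗ series n 0
  count≗series n = series-unique count count-0 count-zero count-suc n 0 z≤n

-- Systems of difference equations

open Equivalence using (to; from)

-- Elimination without division: with a pivot α in the first column, every other row W is replaced
-- by α W minus the multiple of the pivot row that clears the column. `c₀` is the coefficient that
-- the pivot row receives when the relation is lifted back.
dependent : ∀ k {d} → k < d → (w : Fin d → Fin k → ℚ) →
  ∃ λ (c : Fin d → ℚ) → (∀ u → ΣFin (λ i → c i * w i u) ≡ 0ℚ) × ∃ λ i → c i ≢ 0ℚ
dependent zero    {suc d} _         w = (λ _ → 1ℚ) , (λ ()) , zero , λ ()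
dependent (suc k) {suc d} (s≤s k<d) w with Finₚ.any? (λ i → ¬? (w i zero ℚₚ.≟ 0ℚ))
... | no none with dependent k {suc d} (ℕₚ.m<n⇒m<1+n k<d) (λ i u → w i (suc u))
...   | c , rel , nz = c , rel′ , nz
  where
  w₀ : ∀ i → w i zero ≡ 0ℚ
  w₀ i with w i zero ℚₚ.≟ 0ℚ
  ... | yes e = e
  ... | no ne = contradiction (i , ne) none
  rel′ : ∀ u → ΣFin (λ i → c i * w i u) ≡ 0ℚ
  rel′ zero    = Σ-zero (λ i → trans (cong (c i *_) (w₀ i)) (ℚₚ.*-zeroʳ (c i)))
  rel′ (suc u) = rel u
dependent (suc k) {suc d} (s≤s k<d) w | yes (i₀ , α≢0)
  with dependent k k<d (λ i u → w i₀ zero * w (punchIn i₀ i) (suc u) - w (punchIn i₀ i) zero * w i₀ (suc u))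
... | c′ , rel , i₁ , nz = c , rel′ , punchIn i₀ i₁ ,
        λ e → nz (*-zero-cancelˡ α (c′ i₁) α≢0 (trans (sym (Funcₚ.insertAt-punchIn (λ i → α * c′ i) i₀ c₀ i₁)) e))
  where
  α = w i₀ zero
  W : Fin d → Fin (suc k) → ℚ
  W i = w (punchIn i₀ i)
  c₀ = - ΣFin (λ i → c′ i * W i zero)
  c : Fin (suc d) → ℚ
  c = Func.insertAt (λ i → α * c′ i) i₀ c₀
  expand : ∀ u → ΣFin (λ i → c i * w i u) ≡ ΣFin (λ i → c′ i * (α * W i u - W i zero * w i₀ u))
  expand u = begin
    ΣFin (λ i → c i * w i u)
      ≡⟨ Σ-remove i₀ (λ i → c i * w i u) ⟩
    c i₀ * w i₀ u + ΣFin (λ i → c (punchIn i₀ i) * W i u)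
      ≡⟨ cong₂ _+_ (cong (_* w i₀ u) (Funcₚ.insertAt-lookup (λ i → α * c′ i) i₀ c₀))
                   (Σ-cong (λ i → cong (_* W i u) (Funcₚ.insertAt-punchIn (λ i → α * c′ i) i₀ c₀ i))) ⟩
    c₀ * w i₀ u + ΣFin (λ i → α * c′ i * W i u)
      ≡⟨ lem (ΣFin (λ i → c′ i * W i zero)) (w i₀ u) (ΣFin (λ i → α * c′ i * W i u)) ⟩
    ΣFin (λ i → α * c′ i * W i u) - ΣFin (λ i → c′ i * W i zero) * w i₀ u
      ≡⟨ cong (λ t → ΣFin (λ i → α * c′ i * W i u) - t) (sym (Σ-*ʳ (w i₀ u) (λ i → c′ i * W i zero))) ⟩
    ΣFin (λ i → α * c′ i * W i u) - ΣFin (λ i → c′ i * W i zero * w i₀ u)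
      ≡⟨ sym (Σ-- (λ i → α * c′ i * W i u) (λ i → c′ i * W i zero * w i₀ u)) ⟩
    ΣFin (λ i → α * c′ i * W i u - c′ i * W i zero * w i₀ u)
      ≡⟨ Σ-cong (λ i → lem₂ α (c′ i) (W i u) (W i zero) (w i₀ u)) ⟩
    ΣFin (λ i → c′ i * (α * W i u - W i zero * w i₀ u)) ∎
    where
    open ≡-Reasoning
    lem : ∀ x y t → - x * y + t ≡ t - x * y
    lem = solve-∀ ℚ-ring
    lem₂ : ∀ α c x y t → α * c * x - c * y * t ≡ c * (α * x - y * t)
    lem₂ = solve-∀ ℚ-ring
  rel′ : ∀ u → ΣFin (λ i → c i * w i u) ≡ 0ℚ
  rel′ zero    = trans (expand zero) (Σ-zero (λ i → lem (c′ i) α (W i zero)))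
    where
    lem : ∀ c α x → c * (α * x - x * α) ≡ 0ℚ
    lem = solve-∀ ℚ-ring
  rel′ (suc u) = trans (expand (suc u)) (rel u)

-- R x y c expresses x - y = c; only the groupoid laws of such relations matter below.
record Torsor {X : Set} (R : X → X → ℤ → Set) : Set where
  field
    R-refl  : ∀ {x} → R x x (ℤ.+ 0)
    R-sym   : ∀ {x y c} → R x y c → R y x (ℤ.- c)
    R-trans : ∀ {x y w c e} → R x y c → R y w e → R x w (c ℤ.+ e)

Solves : ∀ {X : Set} (R : X → X → ℤ → Set) {n} → List (Hyp n) → (Fin n → X) → Set
Solves R B x = All (λ (i , j , c) → R (x i) (x j) c) B

ℚ-diff : ℚ → ℚ → ℤ → Set
ℚ-diff x y c = x - y ≡ ℤ→ℚ c

ℚ-torsor : Torsor ℚ-diff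
ℚ-torsor = record
  { R-refl  = λ {x} → ℚₚ.+-inverseʳ x
  ; R-sym   = λ {x} {y} {c} e → trans (lem₁ x y) (trans (cong -_ e) (sym (ℤ→ℚ-neg c)))
  ; R-trans = λ {x} {y} {w} {c} {e} p q → trans (lem₂ x y w) (trans (cong₂ _+_ p q) (sym (ℤ→ℚ-+ c e)))
  }
  where
  lem₁ : ∀ x y → y - x ≡ - (x - y)
  lem₁ = solve-∀ ℚ-ring
  lem₂ : ∀ x y w → x - w ≡ (x - y) + (y - w)
  lem₂ = solve-∀ ℚ-ring

-- A consistent system of difference equations, solved: the coordinates fall into classes,
-- each with a root from which its members differ by prescribed offsets.
record Solved {n : ℕ} (B : List (Hyp (suc n))) : Set₁ where
  field
    k   : ℕ
    π   : Fin (suc n) → Fin (suc k)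
    s   : Fin (suc k) → Fin (suc n)
    o   : Fin (suc n) → ℤ
    π-s : ∀ u → π (s u) ≡ u
    o-s : ∀ u → o (s u) ≡ ℤ.+ 0
    s-0 : s zero ≡ zero
    solves⇔ : ∀ {X R} → Torsor {X} R → ∀ x → Solves R B x ⇔ (∀ t → R (x t) (x (s (π t))) (o t))

-- An equation between two classes attaches the class of j to the root of the class of i. The
-- absorbed class is a successor, so class `zero`, rooted at coordinate `zero`, survives; this later
-- permits the normalisation of that coordinate to 0.
module Merge {n} {B : List (Hyp (suc n))} (i j : Fin (suc n)) (c : ℤ)
  (k : ℕ) (π : Fin (suc n) → Fin (suc (suc k))) (s : Fin (suc (suc k)) → Fin (suc n)) (o : Fin (suc n) → ℤ)
  (π-s : ∀ u → π (s u) ≡ u) (o-s : ∀ u → o (s u) ≡ ℤ.+ 0) (s-0 : s zero ≡ zero)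
  (solves⇔ : ∀ {X R} → Torsor {X} R → ∀ x → Solves R B x ⇔ (∀ t → R (x t) (x (s (π t))) (o t)))
  (p′ : Fin (suc k)) (πj : π j ≡ suc p′) (p≢πi : suc p′ ≢ π i) where

  p = suc p′

  π′ : Fin (suc n) → Fin (suc k)
  π′ t with p Finₚ.≟ π t
  ... | yes _ = punchOut p≢πi
  ... | no ne = punchOut ne

  -- The offset of the old root of class p from the root of i, added up along the path from that
  -- root to j, to i and to the root of i.
  δ : ℤ
  δ = ℤ.- o j ℤ.+ (ℤ.- c ℤ.+ o i)

  o′ : Fin (suc n) → ℤ
  o′ t with p Finₚ.≟ π t
  ... | yes _ = o t ℤ.+ δ
  ... | no ne = o t

  s′ : Fin (suc k) → Fin (suc n)
  s′ u = s (punchIn p u)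

  π′-s′ : ∀ u → π′ (s′ u) ≡ u
  π′-s′ u with p Finₚ.≟ π (s′ u)
  ... | yes e = contradiction (sym (trans e (π-s (punchIn p u)))) (Finₚ.punchInᵢ≢i p u)
  ... | no ne = trans (Finₚ.punchOut-cong p (π-s (punchIn p u))) (Finₚ.punchOut-punchIn p)

  o′-s′ : ∀ u → o′ (s′ u) ≡ ℤ.+ 0
  o′-s′ u with p Finₚ.≟ π (s′ u)
  ... | yes e = contradiction (sym (trans e (π-s (punchIn p u)))) (Finₚ.punchInᵢ≢i p u)
  ... | no ne = o-s (punchIn p u)

  module _ {X R} (T : Torsor {X} R) (x : Fin (suc n) → X) where
    open Torsor T

    Old New : Fin (suc n) → Set
    Old t = R (x t) (x (s (π t))) (o t)
    New t = R (x t) (x (s′ (π′ t))) (o′ t)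

    New-p : ∀ t → p ≡ π t → New t ≡ R (x t) (x (s (π i))) (o t ℤ.+ δ)
    New-p t e with p Finₚ.≟ π t
    ... | yes _ = cong (λ u → R (x t) (x (s u)) (o t ℤ.+ δ)) (Finₚ.punchIn-punchOut p≢πi)
    ... | no ne = contradiction e ne

    New-≢p : ∀ t → p ≢ π t → New t ≡ Old t
    New-≢p t ne with p Finₚ.≟ π t
    ... | yes e  = contradiction e ne
    ... | no ne′ = cong (λ u → R (x t) (x (s u)) (o t)) (Finₚ.punchIn-punchOut ne′)

    forth : R (x i) (x j) c → (∀ t → Old t) → ∀ t → New t
    forth h old t = case (p Finₚ.≟ π t)
      where
      case : Dec (p ≡ π t) → New t
      case (no ne) = subst id (sym (New-≢p t ne)) (old t)
      case (yes e) = subst id (sym (New-p t e))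
        (R-trans (subst (λ u → R (x t) (x (s u)) (o t)) (trans (sym e) (sym πj)) (old t))
                 (R-trans (R-sym (old j)) (R-trans (R-sym h) (old i))))

    back : (∀ t → New t) → R (x i) (x j) c × (∀ t → Old t)
    back new = subst (R (x i) (x j)) (lem₁ (o i) (o j) c) (R-trans old-i (R-sym (new-p j (sym πj)))) ,
               λ t → case t (p Finₚ.≟ π t)
      where
      lem₁ : ∀ a b c → a ℤ.+ ℤ.- (b ℤ.+ (ℤ.- b ℤ.+ (ℤ.- c ℤ.+ a))) ≡ c
      lem₁ = ℤ-solve-∀
      lem₂ : ∀ a d → a ℤ.+ d ℤ.+ ℤ.- (ℤ.+ 0 ℤ.+ d) ≡ a
      lem₂ = ℤ-solve-∀
      new-p : ∀ t → p ≡ π t → R (x t) (x (s (π i))) (o t ℤ.+ δ)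
      new-p t e = subst id (New-p t e) (new t)
      old-i : Old i
      old-i = subst id (New-≢p i p≢πi) (new i)
      case : ∀ t → Dec (p ≡ π t) → Old t
      case t (no ne) = subst id (New-≢p t ne) (new t)
      case t (yes e) = subst (λ u → R (x t) (x (s u)) (o t)) e
        (subst (R (x t) (x (s p))) (trans (cong (λ u → o t ℤ.+ δ ℤ.+ ℤ.- (u ℤ.+ δ)) (o-s p)) (lem₂ (o t) δ))
          (R-trans (new-p t e) (R-sym (new-p (s p) (sym (π-s p))))))

  merged : Solved ((i , j , c) ∷ B)
  merged = record
    { k = k ; π = π′ ; s = s′ ; o = o′ ; π-s = π′-s′ ; o-s = o′-s′ ; s-0 = s-0
    ; solves⇔ = λ T x → mk⇔ (λ { (h ∷ hs) → forth T x h (to (solves⇔ T x) hs) })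
                            (λ new → let (h , old) = back T x new in h ∷ from (solves⇔ T x) old) }

merge : ∀ {n} {B : List (Hyp (suc n))} i j c (F : Solved B) → Solved.π F j ≢ zero → Solved.π F i ≢ Solved.π F j →
  Solved ((i , j , c) ∷ B)
merge i j c record { k = zero ; π = π } πj≢0 _ with π j
... | zero = contradiction refl πj≢0
merge i j c record { k = suc k ; π = π ; s = s ; o = o ; π-s = π-s ; o-s = o-s ; s-0 = s-0 ; solves⇔ = sv } πj≢0 πi≢πj
  with π j in eq
... | zero   = contradiction refl πj≢0
... | suc p′ = Merge.merged i j c k π s o π-s o-s s-0 sv p′ eq (πi≢πj ∘ sym)

-- Each equation either joins two classes or lies within one, where it must be redundant.
solveSystem : ∀ {n} (B : List (Hyp (suc n))) (x₀ : Fin (suc n) → ℚ) → Solves ℚ-diff B x₀ → Solved B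
solveSystem {n} [] x₀ _ = record
  { k = n ; π = id ; s = id ; o = λ _ → ℤ.+ 0 ; π-s = λ _ → refl ; o-s = λ _ → refl ; s-0 = refl
  ; solves⇔ = λ T x → mk⇔ (λ _ _ → Torsor.R-refl T) (λ _ → []) }
solveSystem {n} ((i , j , c) ∷ B) x₀ (h₀ ∷ hs₀) with solveSystem B x₀ hs₀
... | F with Solved.π F i Finₚ.≟ Solved.π F j
...   | yes πi≡πj = record
  { k = k ; π = π ; s = s ; o = o ; π-s = π-s ; o-s = o-s ; s-0 = s-0
  ; solves⇔ = λ T x → mk⇔ (λ { (h ∷ hs) → to (solves⇔ T x) hs })
      (λ r → subst (ℛ T x) o≡c (diff T x r) ∷ from (solves⇔ T x) r) }
  where
  open Solved F
  ℛ : ∀ {X R} → Torsor {X} R → (Fin (suc n) → X) → ℤ → Set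
  ℛ {R = R} T x = R (x i) (x j)
  diff : ∀ {X R} (T : Torsor {X} R) x → (∀ t → R (x t) (x (s (π t))) (o t)) → R (x i) (x j) (o i ℤ.- o j)
  diff {R = R} T x r = Torsor.R-trans T (r i)
    (subst (λ u → R (x (s u)) (x j) (ℤ.- o j)) (sym πi≡πj) (Torsor.R-sym T (r j)))
  -- Consistency over ℚ enters here: it makes the offsets agree with c as integers, and hence in
  -- every other torsor.
  o≡c : o i ℤ.- o j ≡ c
  o≡c = ℤ→ℚ-injective (trans (sym (diff ℚ-torsor x₀ (to (solves⇔ ℚ-torsor x₀) hs₀))) h₀)
...   | no πi≢πj with Solved.π F j Finₚ.≟ zero
...     | no πj≢0  = merge i j c F πj≢0 πi≢πj
-- Class `zero` must not be absorbed, so the equation is reversed and the class of i is absorbed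
-- instead.
...     | yes πj≡0 = record
  { k = k ; π = π ; s = s ; o = o ; π-s = π-s ; o-s = o-s ; s-0 = s-0
  ; solves⇔ = λ T x → mk⇔ (λ { (h ∷ hs) → to (solves⇔ T x) (Torsor.R-sym T h ∷ hs) })
      (λ r → flip-head T x (from (solves⇔ T x) r)) }
  where
  open Solved (merge j i (ℤ.- c) F (λ πi≡0 → πi≢πj (trans πi≡0 (sym πj≡0))) (πi≢πj ∘ sym))
  flip-head : ∀ {X R} (T : Torsor {X} R) x → Solves R ((j , i , ℤ.- c) ∷ B) x → Solves R ((i , j , c) ∷ B) x
  flip-head {R = R} T x (h ∷ hs) = subst (R (x i) (x j)) (ℤₚ.neg-involutive c) (Torsor.R-sym T h) ∷ hs

-- Dimension of a flat and its number of points modulo q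

ι-inverse : ∀ m .{{_ : ℕ.NonZero m}} → ι m * (ℤ.+ 1 / m) ≡ 1ℚ
ι-inverse (suc m) = ℚₚ.toℚᵘ-injective (begin
  ℚ.toℚᵘ (ι (suc m) * (ℤ.+ 1 / suc m))                   ≈⟨ ℚₚ.toℚᵘ-homo-* (ι (suc m)) (ℤ.+ 1 / suc m) ⟩
  ℚ.toℚᵘ (ι (suc m)) ℚᵘ.* ℚ.toℚᵘ (ℤ.+ 1 / suc m)         ≈⟨ ℚᵘₚ.*-cong (ℚₚ.toℚᵘ-fromℚᵘ (ℚᵘ.mkℚᵘ (ℤ.+ suc m) 0)) (ℚₚ.toℚᵘ-fromℚᵘ (ℚᵘ.mkℚᵘ (ℤ.+ 1) m)) ⟩
  ℚᵘ.mkℚᵘ (ℤ.+ suc m) 0 ℚᵘ.* ℚᵘ.mkℚᵘ (ℤ.+ 1) m           ≈⟨ ℚᵘ.*≡* (cong ℤ.+_ (cross m)) ⟩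
  ℚᵘ.mkℚᵘ (ℤ.+ 1) 0                                      ≡⟨⟩
  ℚ.toℚᵘ 1ℚ ∎)
  where
  open ℚᵘₚ.≃-Reasoning
  cross : ∀ m → suc m ℕ.* 1 ℕ.* 1 ≡ suc (m ℕ.+ 0 ℕ.+ 0)
  cross m = trans (ℕₚ.*-identityʳ (suc m ℕ.* 1)) (trans (ℕₚ.*-identityʳ (suc m))
    (cong suc (sym (trans (ℕₚ.+-identityʳ (m ℕ.+ 0)) (ℕₚ.+-identityʳ m)))))

mean : ∀ {n} → Pt (suc n) → ℚ
mean {n} x = (ℤ.+ 1 / suc n) * ΣFin x

-- Projection along the diagonal, so that equations between differences are unaffected.
center : ∀ {n} → Pt (suc n) → Pt (suc n)
center x t = x t - mean x

center-InV : ∀ {n} (x : Pt (suc n)) → InV (center x)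
center-InV {n} x = begin
  ΣFin (λ t → x t - mean x)              ≡⟨ Σ-- x (λ _ → mean x) ⟩
  ΣFin x - ΣFin {suc n} (λ _ → mean x)   ≡⟨ cong (λ t → ΣFin x - t) (trans (Σ-constant (suc n) (mean x)) cancel) ⟩
  ΣFin x - ΣFin x                        ≡⟨ ℚₚ.+-inverseʳ (ΣFin x) ⟩
  0ℚ ∎
  where
  open ≡-Reasoning
  cancel : ι (suc n) * mean x ≡ ΣFin x
  cancel = trans (sym (ℚₚ.*-assoc (ι (suc n)) (ℤ.+ 1 / suc n) (ΣFin x)))
    (trans (cong (_* ΣFin x) (ι-inverse (suc n))) (ℚₚ.*-identityˡ (ΣFin x)))

center-diff : ∀ {n} (x : Pt (suc n)) i j → center x i - center x j ≡ x i - x j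
center-diff x i j = lem (x i) (x j) (mean x)
  where
  lem : ∀ a b m → (a - m) - (b - m) ≡ a - b
  lem = solve-∀ ℚ-ring

Inter⇔Solves : ∀ {n} (B : List (Hyp n)) x → Inter B x ⇔ (InV x × Solves ℚ-diff B x)
Inter⇔Solves B x = mk⇔ (λ (v , hs) → v , All.map proj₂ hs) (λ (v , hs) → v , All.map (v ,_) hs)

-- The k + 1 classes have freely chosen root values, and the condition of sum zero removes one
-- degree of freedom.
module Dimension {n} (A : SubV (suc n)) (B : List (Hyp (suc n))) (A≐ : A ≐ Inter B) (F : Solved B)
                 (x₀ : Pt (suc n)) (Ax₀ : A x₀) where
  open Solved F

  A⇔ : ∀ x → A x ⇔ (InV x × (∀ t → x t - x (s (π t)) ≡ ℤ→ℚ (o t)))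
  A⇔ x = mk⇔
    (λ Ax → let (v , hs) = to (Inter⇔Solves B x) (proj₁ (A≐ x) Ax) in v , to (solves⇔ ℚ-torsor x) hs)
    (λ (v , r) → proj₂ (A≐ x) (from (Inter⇔Solves B x) (v , from (solves⇔ ℚ-torsor x) r)))

  -- The extra points are x₀ moved by centered indicators of classes other than `zero`. Subtracting
  -- the relation at the root of `zero` from the one at another root removes the centering and
  -- isolates one coefficient.
  ≮-dim : ∀ {d} → HasDim A d → ¬ d < k
  ≮-dim {d} (_ , maximal) d<k = maximal (p , p∈A , independent)
    where
    u : Fin (suc d) → Fin k
    u i = Fin.inject≤ i d<k
    𝟙 : Fin (suc d) → Pt (suc n)
    𝟙 i t = ⟦ π t Finₚ.≟ suc (u i) ⟧
    p : Fin (suc (suc d)) → Pt (suc n)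
    p zero      = x₀
    p (suc i) t = x₀ t + center (𝟙 i) t
    p∈A : ∀ i → A (p i)
    p∈A zero    = Ax₀
    p∈A (suc i) = from (A⇔ (p (suc i)))
      ( trans (Σ-+ x₀ (center (𝟙 i))) (trans (cong₂ _+_ (proj₁ rx₀) (center-InV (𝟙 i))) (ℚₚ.+-identityˡ 0ℚ))
      , λ t → trans (lem (x₀ t) (x₀ (s (π t))) (center (𝟙 i) t) (center (𝟙 i) (s (π t))))
          (trans (cong₂ _+_ (proj₂ rx₀ t) (trans (center-diff (𝟙 i) t (s (π t))) (same i t))) (ℚₚ.+-identityʳ (ℤ→ℚ (o t)))))
      where
      rx₀ = to (A⇔ x₀) Ax₀
      lem : ∀ a b c e → (a + c) - (b + e) ≡ (a - b) + (c - e)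
      lem = solve-∀ ℚ-ring
      same : ∀ i t → 𝟙 i t - 𝟙 i (s (π t)) ≡ 0ℚ
      same i t = trans (cong (λ w → 𝟙 i t - ⟦ w Finₚ.≟ suc (u i) ⟧) (π-s (π t))) (ℚₚ.+-inverseʳ (𝟙 i t))
    independent : AffIndep p
    independent c rel j = begin
      c j                                           ≡⟨ sym (ℚₚ.*-identityʳ (c j)) ⟩
      c j * 1ℚ                                      ≡⟨ cong (c j *_) (sym diagonal) ⟩
      c j * Δ j                                     ≡⟨ sym (Σ-single j (λ i → c i * Δ i) (λ i i≢j → trans (cong (c i *_) (off-diagonal i i≢j)) (ℚₚ.*-zeroʳ (c i)))) ⟩
      ΣFin (λ i → c i * Δ i)                        ≡⟨ Σ-cong (λ i → lem (c i) (x₀ t₁) (x₀ t₀) (center (𝟙 i) t₁) (center (𝟙 i) t₀) (Δ i) (center-diff (𝟙 i) t₁ t₀)) ⟩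
      ΣFin (λ i → c i * (p (suc i) t₁ - p zero t₁) - c i * (p (suc i) t₀ - p zero t₀))
                                                    ≡⟨ Σ-- (λ i → c i * (p (suc i) t₁ - p zero t₁)) (λ i → c i * (p (suc i) t₀ - p zero t₀)) ⟩
      ΣFin (λ i → c i * (p (suc i) t₁ - p zero t₁)) - ΣFin (λ i → c i * (p (suc i) t₀ - p zero t₀))
                                                    ≡⟨ cong₂ (λ x y → x - y) (rel t₁) (rel t₀) ⟩
      0ℚ - 0ℚ                                       ≡⟨⟩
      0ℚ                                            ∎
      where
      open ≡-Reasoning
      t₁ t₀ : Fin (suc n)
      t₁ = s (suc (u j))
      t₀ = s zero
      Δ : Fin (suc d) → ℚ
      Δ i = 𝟙 i t₁ - 𝟙 i t₀
      lem′ : ∀ c a b x y → c * (x - y) ≡ c * ((a + x) - a) - c * ((b + y) - b)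
      lem′ = solve-∀ ℚ-ring
      lem : ∀ c a b x y w → x - y ≡ w → c * w ≡ c * ((a + x) - a) - c * ((b + y) - b)
      lem c a b x y _ refl = lem′ c a b x y
      at-t₀ : ∀ i → 𝟙 i t₀ ≡ 0ℚ
      at-t₀ i = ⟦⟧-no (λ e → contradiction (trans (sym (π-s zero)) e) λ ()) (π t₀ Finₚ.≟ suc (u i))
      diagonal : Δ j ≡ 1ℚ
      diagonal = cong₂ (λ x y → x - y) (⟦⟧-yes (π-s (suc (u j))) (π t₁ Finₚ.≟ suc (u j))) (at-t₀ j)
      off-diagonal : ∀ i → i ≢ j → Δ i ≡ 0ℚ
      off-diagonal i i≢j = cong₂ (λ x y → x - y)
        (⟦⟧-no (λ e → i≢j (sym (Finₚ.inject≤-injective d<k d<k j i (Finₚ.suc-injective (trans (sym (π-s (suc (u j)))) e))))) (π t₁ Finₚ.≟ suc (u i)))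
        (at-t₀ i)

  -- A direction of the flat is described by k root values relative to the root of `zero`. A
  -- relation among more than k such vectors makes the combination `V` constant, and a constant
  -- vector of sum zero vanishes.
  ≯-dim : ∀ {d} → HasDim A d → ¬ k < d
  ≯-dim {d} ((p , p∈A , independent) , _) k<d with dependent k k<d
    (λ i u → (p (suc i) (s (suc u)) - p zero (s (suc u))) - (p (suc i) (s zero) - p zero (s zero)))
  ... | c , rel , i₁ , nz = nz (independent c (λ t → trans (constant t) κ≡0) i₁)
    where
    v : Fin d → Pt (suc n)
    v i t = p (suc i) t - p zero t
    V : Pt (suc n)
    V t = ΣFin (λ i → c i * v i t)
    κ = V (s zero)
    difference : ∀ t t′ → ΣFin (λ i → c i * (v i t - v i t′)) ≡ V t - V t′
    difference t t′ = trans (Σ-cong (λ i → lem (c i) (v i t) (v i t′))) (Σ-- (λ i → c i * v i t) (λ i → c i * v i t′))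
      where
      lem : ∀ c x y → c * (x - y) ≡ c * x - c * y
      lem = solve-∀ ℚ-ring
    to-root : ∀ t → V t ≡ V (s (π t))
    to-root t = x-y≡0⇒x≡y (V t) (V (s (π t))) (trans (sym (difference t (s (π t))))
      (Σ-zero (λ i → trans (cong (c i *_) (lem (p (suc i) t) (p zero t) (p (suc i) (s (π t))) (p zero (s (π t)))
        (trans (proj₂ (to (A⇔ (p (suc i))) (p∈A (suc i))) t) (sym (proj₂ (to (A⇔ (p zero)) (p∈A zero)) t))))) (ℚₚ.*-zeroʳ (c i)))))
      where
      lem′ : ∀ a b e f → (a - b) - (e - f) ≡ (a - e) - (b - f)
      lem′ = solve-∀ ℚ-ring
      lem : ∀ a b e f → a - e ≡ b - f → (a - b) - (e - f) ≡ 0ℚ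
      lem a b e f eq = trans (lem′ a b e f) (trans (cong (λ x → x - (b - f)) eq) (ℚₚ.+-inverseʳ (b - f)))
    at-root : ∀ u → V (s u) ≡ κ
    at-root zero    = refl
    at-root (suc u) = x-y≡0⇒x≡y (V (s (suc u))) κ (trans (sym (difference (s (suc u)) (s zero))) (rel u))
    constant : ∀ t → V t ≡ κ
    constant t = trans (to-root t) (at-root (π t))
    v-InV : ∀ i → ΣFin (v i) ≡ 0ℚ
    v-InV i = trans (Σ-- (p (suc i)) (p zero))
      (cong₂ (λ x y → x - y) (proj₁ (to (A⇔ (p (suc i))) (p∈A (suc i)))) (proj₁ (to (A⇔ (p zero)) (p∈A zero))))
    V-InV : ΣFin V ≡ 0ℚ
    V-InV = trans (Σ-swap (λ t i → c i * v i t))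
      (Σ-zero (λ i → trans (Σ-*ˡ (c i) (v i)) (trans (cong (c i *_) (v-InV i)) (ℚₚ.*-zeroʳ (c i)))))
    κ≡0 : κ ≡ 0ℚ
    κ≡0 = *-zero-cancelˡ (ι (suc n)) κ (λ e → contradiction (ι-injective {suc n} {0} e) λ ())
      (trans (sym (Σ-constant (suc n) κ)) (trans (sym (Σ-cong constant)) V-InV))

  dim≡k : ∀ {d} → HasDim A d → d ≡ k
  dim≡k {d} h = ℕₚ.≤-antisym (ℕₚ.≮⇒≥ (≯-dim h)) (ℕₚ.≮⇒≥ (≮-dim h))

-- Solutions of a system modulo q

mod-diff : ℕ → ℕ → ℕ → ℤ → Set
mod-diff q x y c = ℤ.+ q ∣ (ℤ.+ x ℤ.- ℤ.+ y ℤ.- c)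

mod-diff? : ∀ q x y c → Dec (mod-diff q x y c)
mod-diff? q x y c = ℤ.+ q ∣? (ℤ.+ x ℤ.- ℤ.+ y ℤ.- c)

mod-torsor : ∀ q → Torsor (mod-diff q)
mod-torsor q = record
  { R-refl  = λ {x} → subst (ℤ.+ q ∣_) (sym (lem₀ (ℤ.+ x))) (divides (ℤ.+ 0) refl)
  ; R-sym   = λ {x} {y} {c} p → subst (ℤ.+ q ∣_) (lem₁ (ℤ.+ x) (ℤ.+ y) c) (∣m⇒∣-m p)
  ; R-trans = λ {x} {y} {w} {c} {e} p r → subst (ℤ.+ q ∣_) (lem₂ (ℤ.+ x) (ℤ.+ y) (ℤ.+ w) c e) (∣m∣n⇒∣m+n p r)
  }
  where
  lem₀ : ∀ x → x ℤ.- x ℤ.- ℤ.+ 0 ≡ ℤ.+ 0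
  lem₀ = ℤ-solve-∀
  lem₁ : ∀ x y c → ℤ.- (x ℤ.- y ℤ.- c) ≡ y ℤ.- x ℤ.- (ℤ.- c)
  lem₁ = ℤ-solve-∀
  lem₂ : ∀ x y w c e → (x ℤ.- y ℤ.- c) ℤ.+ (y ℤ.- w ℤ.- e) ≡ x ℤ.- w ℤ.- (c ℤ.+ e)
  lem₂ = ℤ-solve-∀

∣∧<⇒≡0 : ∀ {q z} → ℤ.+ q ∣ z → ℤ.∣ z ∣ < q → z ≡ ℤ.+ 0
∣∧<⇒≡0 {q} {z} q∣z lt with ℤ.∣ z ∣ in eq | ∣⇒∣ᵤ q∣z
... | zero  | _    = ℤₚ.∣i∣≡0⇒i≡0 eq
... | suc m | q∣m  = contradiction lt (ℕₚ.≤⇒≯ (ℕ∣.∣⇒≤ q∣m))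

∣x-y∣< : ∀ {x y q} → x < q → y < q → ℤ.∣ ℤ.+ x ℤ.- ℤ.+ y ∣ < q
∣x-y∣< {x} {y} {q} x<q y<q = ℕₚ.≤-<-trans
  (subst (λ t → ℤ.∣ t ∣ ≤ x ℕ.⊔ y) (sym (ℤₚ.m-n≡m⊖n x y)) (ℤₚ.∣m⊝n∣≤m⊔n x y))
  (ℕₚ.⊔-lub x<q y<q)

Σbox-unique : ∀ n q {P : Vec ℕ n → Set} (P? : ∀ x → Dec (P x)) (w : Vec ℕ n) → InBox q w → P w →
  (∀ x → InBox q x → P x → x ≡ w) → Σbox n q (λ x → ⟦ P? x ⟧) ≡ 1ℚ
Σbox-unique zero    q P? []      w<q Pw u = ⟦⟧-yes Pw (P? [])
Σbox-unique (suc n) q {P} P? (t ∷ w) w<q Pw u = trans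
  (Σ-single t′ (λ r → Σbox n q (λ x → ⟦ P? (toℕ r ∷ x) ⟧)) (λ r r≢t → Σbox-zero n q (λ x x<q →
    ⟦⟧-no (λ Px → r≢t (Finₚ.toℕ-injective (trans (∷-injectiveˡ (u (toℕ r ∷ x) (cons-box (Finₚ.toℕ<n r) x<q) Px)) (sym t≡)))) (P? (toℕ r ∷ x)))))
  (Σbox-unique n q (λ x → P? (toℕ t′ ∷ x)) w (w<q ∘ suc) (subst (λ r → P (r ∷ w)) (sym t≡) Pw)
    (λ x x<q Px → ∷-injectiveʳ (u (toℕ t′ ∷ x) (cons-box (Finₚ.toℕ<n t′) x<q) Px)))
  where
  t′ = Fin.fromℕ< (w<q zero)
  t≡ : toℕ t′ ≡ t
  t≡ = Finₚ.toℕ-fromℕ< (w<q zero)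
  cons-box : ∀ {r x} → r < q → InBox q x → InBox q (r ∷ x)
  cons-box r<q x<q zero    = r<q
  cons-box r<q x<q (suc i) = x<q i

Σbox-1 : ∀ n q → Σbox n q (λ _ → 1ℚ) ≡ ι q ^ℚ n
Σbox-1 zero    q = refl
Σbox-1 (suc n) q = trans (Σ-constant q (Σbox n q (λ _ → 1ℚ))) (cong (ι q *_) (Σbox-1 n q))

lookup-≗ : ∀ {n} (x y : Vec ℕ n) → (∀ i → lookup x i ≡ lookup y i) → x ≡ y
lookup-≗ x y e = trans (sym (tabulate∘lookup x)) (trans (tabulate-cong e) (tabulate∘lookup y))

-- Solutions with coordinate `zero` equal to 0 correspond to the k remaining root values y; the
-- correspondence is exploited by counting the pairs in `Match` in two ways.
module ModCount {n} (B : List (Hyp (suc n))) (F : Solved B) (q : ℕ) .{{_ : ℕ.NonZero q}} where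
  open Solved F

  sat? : ∀ (X : Fin (suc n) → ℕ) → Dec (Solves (mod-diff q) B X)
  sat? X = All.all? (λ (i , j , c) → mod-diff? q (X i) (X j) c) B

  value : Vec ℕ k → Fin (suc n) → ℕ
  value y t = (ℤ.+ lookup (0 ∷ y) (π t) ℤ.+ o t) %ℕ q

  value-mod : ∀ y t → mod-diff q (value y t) (lookup (0 ∷ y) (π t)) (o t)
  value-mod y t = divides (ℤ.- (m /ℕ q)) (lem (ℤ.+ value y t) (ℤ.+ lookup (0 ∷ y) (π t)) (o t) (m /ℕ q) (ℤ.+ q) (a≡a%ℕn+[a/ℕn]*n m q))
    where
    m = ℤ.+ lookup (0 ∷ y) (π t) ℤ.+ o t
    lem′ : ∀ r y o w → r ℤ.- y ℤ.- o ≡ ℤ.- w ℤ.+ ((r ℤ.+ w) ℤ.- (y ℤ.+ o))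
    lem′ = ℤ-solve-∀
    lem : ∀ r y o d q → y ℤ.+ o ≡ r ℤ.+ d ℤ.* q → r ℤ.- y ℤ.- o ≡ ℤ.- d ℤ.* q
    lem r y o d q e = trans (lem′ r y o (d ℤ.* q))
      (trans (cong (λ w → ℤ.- (d ℤ.* q) ℤ.+ (w ℤ.- (y ℤ.+ o))) (sym e))
        (trans (cong (λ w → ℤ.- (d ℤ.* q) ℤ.+ w) (ℤₚ.+-inverseʳ (y ℤ.+ o)))
          (trans (ℤₚ.+-identityʳ (ℤ.- (d ℤ.* q))) (ℤₚ.neg-distribˡ-* d q))))

  mod-unique : ∀ {x y} w c → x < q → y < q → mod-diff q x w c → mod-diff q y w c → x ≡ y
  mod-unique {x} {y} w c x<q y<q p r = ℤₚ.+-injective (ℤₚ.i-j≡0⇒i≡j (ℤ.+ x) (ℤ.+ y)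
    (∣∧<⇒≡0 (subst (ℤ.+ q ∣_) (lem (ℤ.+ x) (ℤ.+ y) (ℤ.+ w) c) (∣m∣n⇒∣m+n p (∣m⇒∣-m r))) (∣x-y∣< x<q y<q)))
    where
    lem : ∀ x y w c → (x ℤ.- w ℤ.- c) ℤ.+ ℤ.- (y ℤ.- w ℤ.- c) ≡ x ℤ.- y
    lem = ℤ-solve-∀

  Match : Vec ℕ n → Vec ℕ k → Set
  Match x y = ∀ t → lookup (0 ∷ x) t ≡ value y t

  match? : ∀ x y → Dec (Match x y)
  match? x y = Finₚ.all? (λ t → lookup (0 ∷ x) t ℕₚ.≟ value y t)

  0<q : 0 < q
  0<q = ℕ.>-nonZero⁻¹ q

  0∷-box : ∀ {m} {x : Vec ℕ m} → InBox q x → InBox q (0 ∷ x)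
  0∷-box x<q zero    = 0<q
  0∷-box x<q (suc i) = x<q i

  value-s : ∀ y → InBox q y → ∀ u → value y (s u) ≡ lookup (0 ∷ y) u
  value-s y y<q u = mod-unique (lookup (0 ∷ y) u) (ℤ.+ 0) (n%ℕd<d (ℤ.+ lookup (0 ∷ y) (π (s u)) ℤ.+ o (s u)) q) (0∷-box y<q u)
    (subst₂ (mod-diff q (value y (s u))) (cong (lookup (0 ∷ y)) (π-s u)) (o-s u) (value-mod y (s u)))
    (Torsor.R-refl (mod-torsor q) {lookup (0 ∷ y) u})

  match⇒sat : ∀ x y → InBox q y → Match x y → Solves (mod-diff q) B (lookup (0 ∷ x))
  match⇒sat x y y<q m = from (solves⇔ (mod-torsor q) (lookup (0 ∷ x))) λ t →
    subst₂ (λ v w → mod-diff q v w (o t)) (sym (m t)) (sym (trans (m (s (π t))) (value-s y y<q (π t)))) (value-mod y t)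

  count-matches : ∀ x → InBox q x → ⟦ sat? (lookup (0 ∷ x)) ⟧ ≡ Σbox k q (λ y → ⟦ match? x y ⟧)
  count-matches x x<q with sat? (lookup (0 ∷ x))
  ... | no ns  = sym (Σbox-zero k q (λ y y<q → ⟦⟧-no (ns ∘ match⇒sat x y y<q) (match? x y)))
  ... | yes st = sym (Σbox-unique k q (match? x) y⋆ y⋆<q matches unique)
    where
    X = lookup (0 ∷ x)
    y⋆ : Vec ℕ k
    y⋆ = tabulate (λ u → X (s (suc u)))
    y⋆-lookup : ∀ u → lookup (0 ∷ y⋆) u ≡ X (s u)
    y⋆-lookup zero    = sym (cong X s-0)
    y⋆-lookup (suc u) = lookup∘tabulate (λ u → X (s (suc u))) u
    y⋆<q : InBox q y⋆
    y⋆<q u = subst (_< q) (sym (y⋆-lookup (suc u))) (0∷-box x<q (s (suc u)))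
    matches : Match x y⋆
    matches t = mod-unique (lookup (0 ∷ y⋆) (π t)) (o t) (0∷-box x<q t) (n%ℕd<d (ℤ.+ lookup (0 ∷ y⋆) (π t) ℤ.+ o t) q)
      (subst (λ w → mod-diff q (X t) w (o t)) (sym (y⋆-lookup (π t))) (to (solves⇔ (mod-torsor q) X) st t))
      (value-mod y⋆ t)
    unique : ∀ y → InBox q y → Match x y → y ≡ y⋆
    unique y y<q m = lookup-≗ y y⋆ λ u →
      trans (sym (value-s y y<q (suc u))) (trans (sym (m (s (suc u)))) (sym (y⋆-lookup (suc u))))

  count-points : ∀ y → InBox q y → Σbox n q (λ x → ⟦ match? x y ⟧) ≡ 1ℚ
  count-points y y<q = Σbox-unique n q (λ x → match? x y) w w<q w-matches
    (λ x _ m → lookup-≗ x w (λ i → trans (m (suc i)) (sym (w-lookup i))))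
    where
    w : Vec ℕ n
    w = tabulate (λ i → value y (suc i))
    w-lookup : ∀ i → lookup w i ≡ value y (suc i)
    w-lookup i = lookup∘tabulate (λ i → value y (suc i)) i
    w<q : InBox q w
    w<q i = subst (_< q) (sym (w-lookup i)) (n%ℕd<d (ℤ.+ lookup (0 ∷ y) (π (suc i)) ℤ.+ o (suc i)) q)
    w-matches : Match w y
    w-matches zero    = sym (trans (cong (value y) (sym s-0)) (value-s y y<q zero))
    w-matches (suc i) = w-lookup i

  count-sat : Σbox n q (λ x → ⟦ sat? (lookup (0 ∷ x)) ⟧) ≡ ι q ^ℚ k
  count-sat = begin
    Σbox n q (λ x → ⟦ sat? (lookup (0 ∷ x)) ⟧)             ≡⟨ Σbox-cong n q count-matches ⟩
    Σbox n q (λ x → Σbox k q (λ y → ⟦ match? x y ⟧))       ≡⟨ Σbox-swap n k q (λ x y → ⟦ match? x y ⟧) ⟩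
    Σbox k q (λ y → Σbox n q (λ x → ⟦ match? x y ⟧))       ≡⟨ Σbox-cong k q count-points ⟩
    Σbox k q (λ _ → 1ℚ)                                    ≡⟨ Σbox-1 k q ⟩
    ι q ^ℚ k                                               ∎
    where open ≡-Reasoning

-- Points modulo q and the arrangement

-- The bound on q makes room for n + 2 disjoint intervals of length b. The n + 1 points cannot meet
-- all of them, so the circle can be cut inside one that is free.
module Lift (b n q : ℕ) (large : suc (suc n) ℕ.* b ≤ q) (X : Fin (suc n) → ℕ) (X<q : ∀ i → X i < q) where

  Hit : Fin (suc (suc n)) → Set
  Hit t = ∃ λ i → toℕ t ℕ.* b ≤ X i × X i < suc (toℕ t) ℕ.* b

  hit? : ∀ t → Dec (Hit t)
  hit? t = Finₚ.any? (λ i → (toℕ t ℕ.* b ℕₚ.≤? X i) ×-dec (X i ℕₚ.<? suc (toℕ t) ℕ.* b))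

  not-all-hit : ¬ (∀ t → Hit t)
  not-all-hit hit with Finₚ.pigeonhole (ℕₚ.n<1+n (suc n)) (proj₁ ∘ hit)
  ... | t , t′ , t<t′ , same = ℕₚ.<-irrefl refl
    (ℕₚ.<-≤-trans (proj₂ (proj₂ (hit t)))
      (ℕₚ.≤-trans (ℕₚ.*-monoˡ-≤ b t<t′) (subst (λ i → toℕ t′ ℕ.* b ≤ X i) (sym same) (proj₁ (proj₂ (hit t′))))))

  free : ∃ λ t → ¬ Hit t
  free = Finₚ.¬∀⟶∃¬ (suc (suc n)) Hit hit? not-all-hit

  t L : ℕ
  t = toℕ (proj₁ free)
  L = suc t ℕ.* b

  L≤q : L ≤ q
  L≤q = ℕₚ.≤-trans (ℕₚ.*-monoˡ-≤ b (Finₚ.toℕ<n (proj₁ free))) large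

  -- The points read along the circle from the right end L of an interval [tb, L) that they avoid.
  unrolled : ∀ i → ∃₂ λ w e → w ℕ.+ b < suc q × w ℕ.+ L ≡ X i ℕ.+ e ℕ.* q
  unrolled i with X i ℕₚ.<? t ℕ.* b
  ... | yes X<tb = X i ℕ.+ q ∸ L , 1 , s≤s bound , trans (ℕₚ.m∸n+n≡m L≤X+q) (cong (X i ℕ.+_) (sym (ℕₚ.+-identityʳ q)))
    where
    L≤X+q : L ≤ X i ℕ.+ q
    L≤X+q = ℕₚ.≤-trans L≤q (ℕₚ.m≤n+m q (X i))
    bound : X i ℕ.+ q ∸ L ℕ.+ b ≤ q
    bound = ℕₚ.+-cancelʳ-≤ (t ℕ.* b) (X i ℕ.+ q ∸ L ℕ.+ b) q (begin
      X i ℕ.+ q ∸ L ℕ.+ b ℕ.+ t ℕ.* b   ≡⟨ ℕₚ.+-assoc (X i ℕ.+ q ∸ L) b (t ℕ.* b) ⟩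
      X i ℕ.+ q ∸ L ℕ.+ L               ≡⟨ ℕₚ.m∸n+n≡m L≤X+q ⟩
      X i ℕ.+ q                         ≤⟨ ℕₚ.+-monoˡ-≤ q (ℕₚ.<⇒≤ X<tb) ⟩
      t ℕ.* b ℕ.+ q                     ≡⟨ ℕₚ.+-comm (t ℕ.* b) q ⟩
      q ℕ.+ t ℕ.* b                     ∎)
      where open ℕₚ.≤-Reasoning
  ... | no X≮tb = X i ∸ L , 0 , s≤s bound , trans (ℕₚ.m∸n+n≡m L≤X) (sym (ℕₚ.+-identityʳ (X i)))
    where
    L≤X : L ≤ X i
    L≤X = ℕₚ.≮⇒≥ (λ X<L → proj₂ free (i , ℕₚ.≮⇒≥ X≮tb , X<L))
    bound : X i ∸ L ℕ.+ b ≤ q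
    bound = begin
      X i ∸ L ℕ.+ b              ≤⟨ ℕₚ.+-monoʳ-≤ (X i ∸ L) (ℕₚ.m≤m+n b (t ℕ.* b)) ⟩
      X i ∸ L ℕ.+ L              ≡⟨ ℕₚ.m∸n+n≡m L≤X ⟩
      X i                        ≤⟨ ℕₚ.<⇒≤ (X<q i) ⟩
      q                          ∎
      where open ℕₚ.≤-Reasoning

  w : Fin (suc n) → ℕ
  w i = proj₁ (unrolled i)

  e : Fin (suc n) → ℕ
  e i = proj₁ (proj₂ (unrolled i))

  w-X : ∀ i → ℤ.+ w i ≡ ℤ.+ X i ℤ.+ ℤ.+ e i ℤ.* ℤ.+ q ℤ.- ℤ.+ L
  w-X i = begin
    ℤ.+ w i                                            ≡⟨ lem (ℤ.+ w i) (ℤ.+ L) ⟩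
    ℤ.+ w i ℤ.+ ℤ.+ L ℤ.- ℤ.+ L                        ≡⟨ cong (λ u → u ℤ.- ℤ.+ L) (begin
      ℤ.+ w i ℤ.+ ℤ.+ L                                  ≡⟨ sym (ℤₚ.pos-+ (w i) L) ⟩
      ℤ.+ (w i ℕ.+ L)                                    ≡⟨ cong ℤ.+_ (proj₂ (proj₂ (proj₂ (unrolled i)))) ⟩
      ℤ.+ (X i ℕ.+ e i ℕ.* q)                            ≡⟨ ℤₚ.pos-+ (X i) (e i ℕ.* q) ⟩
      ℤ.+ X i ℤ.+ ℤ.+ (e i ℕ.* q)                        ≡⟨ cong (λ u → ℤ.+ X i ℤ.+ u) (ℤₚ.pos-* (e i) q) ⟩
      ℤ.+ X i ℤ.+ ℤ.+ e i ℤ.* ℤ.+ q                      ∎) ⟩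
    ℤ.+ X i ℤ.+ ℤ.+ e i ℤ.* ℤ.+ q ℤ.- ℤ.+ L            ∎
    where
    open ≡-Reasoning
    lem : ∀ x l → x ≡ x ℤ.+ l ℤ.- l
    lem = ℤ-solve-∀

  shift : ∀ i j c → ℤ.+ w i ℤ.- ℤ.+ w j ℤ.- c ≡ (ℤ.+ X i ℤ.- ℤ.+ X j ℤ.- c) ℤ.+ (ℤ.+ e i ℤ.- ℤ.+ e j) ℤ.* ℤ.+ q
  shift i j c = trans (cong₂ (λ x y → x ℤ.- y ℤ.- c) (w-X i) (w-X j))
    (lem (ℤ.+ X i) (ℤ.+ X j) (ℤ.+ e i) (ℤ.+ e j) (ℤ.+ q) (ℤ.+ L) c)
    where
    lem : ∀ x y e f q l c → (x ℤ.+ e ℤ.* q ℤ.- l) ℤ.- (y ℤ.+ f ℤ.* q ℤ.- l) ℤ.- c ≡ (x ℤ.- y ℤ.- c) ℤ.+ (e ℤ.- f) ℤ.* q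
    lem = ℤ-solve-∀

  -- The free interval confines the values `w` to a range of length q - b. Hence w i - w j - c is
  -- smaller than q in size and vanishes as soon as q divides it.
  lift⇔ : ∀ i j c → ℤ.∣ c ∣ < b → mod-diff q (X i) (X j) c ⇔ (ℤ.+ w i ℤ.- ℤ.+ w j ≡ c)
  lift⇔ i j c ∣c∣<b = mk⇔
    (λ p → ℤₚ.i-j≡0⇒i≡j (ℤ.+ w i ℤ.- ℤ.+ w j) c
      (∣∧<⇒≡0 (subst (ℤ.+ q ∣_) (sym (shift i j c)) (∣m∣n⇒∣m+n p (divides (ℤ.+ e i ℤ.- ℤ.+ e j) refl))) bound))
    (λ { refl → divides (ℤ.- (ℤ.+ e i ℤ.- ℤ.+ e j)) (multiple i j) })
    where
    lem : ∀ x e f q → x ≡ (x ℤ.+ (e ℤ.- f) ℤ.* q) ℤ.+ (ℤ.- (e ℤ.- f)) ℤ.* q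
    lem = ℤ-solve-∀
    multiple : ∀ i j → ℤ.+ X i ℤ.- ℤ.+ X j ℤ.- (ℤ.+ w i ℤ.- ℤ.+ w j) ≡ (ℤ.- (ℤ.+ e i ℤ.- ℤ.+ e j)) ℤ.* ℤ.+ q
    multiple i j = trans (lem m (ℤ.+ e i) (ℤ.+ e j) (ℤ.+ q))
      (trans (cong (ℤ._+ (ℤ.- (ℤ.+ e i ℤ.- ℤ.+ e j)) ℤ.* ℤ.+ q)
               (trans (sym (shift i j (ℤ.+ w i ℤ.- ℤ.+ w j))) (ℤₚ.+-inverseʳ (ℤ.+ w i ℤ.- ℤ.+ w j))))
             (ℤₚ.+-identityˡ ((ℤ.- (ℤ.+ e i ℤ.- ℤ.+ e j)) ℤ.* ℤ.+ q)))
      where m = ℤ.+ X i ℤ.- ℤ.+ X j ℤ.- (ℤ.+ w i ℤ.- ℤ.+ w j)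
    b≤q : b ≤ q
    b≤q = ℕₚ.≤-trans (ℕₚ.m≤m+n b (suc n ℕ.* b)) large
    w<  : ∀ i → w i < suc (q ∸ b)
    w< i = s≤s (ℕₚ.m+n≤o⇒m≤o∸n (w i) (ℕ.s≤s⁻¹ (proj₁ (proj₂ (proj₂ (unrolled i))))))
    bound : ℤ.∣ ℤ.+ w i ℤ.- ℤ.+ w j ℤ.- c ∣ < q
    bound = begin-strict
      ℤ.∣ ℤ.+ w i ℤ.- ℤ.+ w j ℤ.- c ∣              ≤⟨ ℤₚ.∣i-j∣≤∣i∣+∣j∣ (ℤ.+ w i ℤ.- ℤ.+ w j) c ⟩
      ℤ.∣ ℤ.+ w i ℤ.- ℤ.+ w j ∣ ℕ.+ ℤ.∣ c ∣        <⟨ ℕₚ.+-mono-≤-< (ℕ.s≤s⁻¹ (∣x-y∣< (w< i) (w< j))) ∣c∣<b ⟩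
      q ∸ b ℕ.+ b                                  ≡⟨ ℕₚ.m∸n+n≡m b≤q ⟩
      q                                            ∎
      where open ℕₚ.≤-Reasoning

-- Points modulo q off the arrangement as placements on the circle

module Arrangement (a d′ : ℕ) where
  open Closed a d′ using (b)
  open Count a d′

  -- Writing c as e - a moves the range of constants into the natural numbers.
  arr⇒ : ∀ {n} {i j : Fin n} {c} → InArr a b (i , j , c) → ∃ λ e → 1 ≤ e × e < a ℕ.+ b × c ≡ ℤ.+ e ℤ.- ℤ.+ a
  arr⇒ {c = c} (_ , lo , hi) = normal (c ℤ.+ ℤ.+ a) refl
    (subst (ℤ._≤ c ℤ.+ ℤ.+ a) (lem₁ (ℤ.+ a)) (ℤₚ.+-monoˡ-≤ (ℤ.+ a) lo))
    (ℤₚ.+-monoˡ-≤ (ℤ.+ a) hi)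
    where
    lem₁ : ∀ a → ℤ.+ 1 ℤ.- a ℤ.+ a ≡ ℤ.+ 1
    lem₁ = ℤ-solve-∀
    lem₂ : ∀ a c → c ≡ c ℤ.+ a ℤ.- a
    lem₂ = ℤ-solve-∀
    lem₃ : ∀ a b → ℤ.+ 1 ℤ.+ (b ℤ.- ℤ.+ 1 ℤ.+ a) ≡ a ℤ.+ b
    lem₃ = ℤ-solve-∀
    normal : ∀ z → c ℤ.+ ℤ.+ a ≡ z → ℤ.+ 1 ℤ.≤ c ℤ.+ ℤ.+ a → c ℤ.+ ℤ.+ a ℤ.≤ ℤ.+ b ℤ.- ℤ.+ 1 ℤ.+ ℤ.+ a →
      ∃ λ e → 1 ≤ e × e < a ℕ.+ b × c ≡ ℤ.+ e ℤ.- ℤ.+ a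
    normal (ℤ.+ e) eq lo hi = e , ℤₚ.drop‿+≤+ (subst (ℤ.+ 1 ℤ.≤_) eq lo) ,
      ℤₚ.drop‿+≤+ (subst₂ ℤ._≤_ (cong (λ u → ℤ.+ 1 ℤ.+ u) eq) (trans (lem₃ (ℤ.+ a) (ℤ.+ b)) (sym (ℤₚ.pos-+ a b))) (ℤₚ.+-monoʳ-≤ (ℤ.+ 1) hi)) ,
      trans (lem₂ (ℤ.+ a) c) (cong (λ z → z ℤ.- ℤ.+ a) eq)
    normal ℤ.-[1+ e ] eq lo hi with subst (ℤ.+ 1 ℤ.≤_) eq lo
    ... | ()

  ⇒arr : ∀ {n} {i j : Fin n} {e} → toℕ i < toℕ j → 1 ≤ e → e < a ℕ.+ b → InArr a b (i , j , ℤ.+ e ℤ.- ℤ.+ a)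
  ⇒arr {e = e} i<j 1≤e e<a+b = i<j , ℤₚ.+-monoˡ-≤ (ℤ.- ℤ.+ a) (ℤ.+≤+ 1≤e) ,
    subst₂ ℤ._≤_ (lem₁ (ℤ.+ e) (ℤ.+ a)) (trans (cong (λ z → ℤ.- (ℤ.+ 1) ℤ.+ (z ℤ.- ℤ.+ a)) (ℤₚ.pos-+ a b)) (lem₂ (ℤ.+ a) (ℤ.+ b)))
      (ℤₚ.+-monoʳ-≤ (ℤ.- (ℤ.+ 1)) (ℤₚ.+-monoˡ-≤ (ℤ.- ℤ.+ a) (ℤ.+≤+ e<a+b)))
    where
    lem₁ : ∀ e a → ℤ.- (ℤ.+ 1) ℤ.+ ((ℤ.+ 1 ℤ.+ e) ℤ.- a) ≡ e ℤ.- a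
    lem₁ = ℤ-solve-∀
    lem₂ : ∀ a b → ℤ.- (ℤ.+ 1) ℤ.+ ((a ℤ.+ b) ℤ.- a) ≡ b ℤ.- ℤ.+ 1
    lem₂ = ℤ-solve-∀

  -- For negative constants the bound rests on a < b.
  ∣arr∣<b : ∀ {n} {i j : Fin n} {c} → InArr a b (i , j , c) → ℤ.∣ c ∣ < b
  ∣arr∣<b {i = i} {j} h with arr⇒ {i = i} {j} h
  ... | e , 1≤e , e<a+b , refl with ℕₚ.≤-total a e
  ...   | inj₁ a≤e = subst (_< b) (sym (trans (cong ℤ.∣_∣ (ℤₚ.m-n≡m⊖n e a)) (cong ℤ.∣_∣ (ℤₚ.⊖-≥ a≤e))))
                       (ℕₚ.+-cancelˡ-< a (e ∸ a) b (subst (_< a ℕ.+ b) (sym (ℕₚ.m+[n∸m]≡n a≤e)) e<a+b))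
  ...   | inj₂ e≤a = subst (_< b) (sym (trans (cong ℤ.∣_∣ (ℤₚ.m-n≡m⊖n e a)) (ℤₚ.∣⊖∣-≤ e≤a)))
                       (ℕₚ.≤-<-trans (ℕₚ.m∸n≤m a e) (ℕₚ.m<m+n a (s≤s z≤n)))

  inArr? : ∀ {n} (h : Hyp n) → Dec (InArr a b h)
  inArr? (i , j , c) = (toℕ i ℕₚ.<? toℕ j) ×-dec (ℤ.+ 1 ℤ.- ℤ.+ a ℤₚ.≤? c) ×-dec (c ℤₚ.≤? ℤ.+ b ℤ.- ℤ.+ 1)

  candidates : ∀ n → List (Hyp n)
  candidates n = cartesianProduct (allFin n) (cartesianProduct (allFin n) (List.map (λ e → ℤ.+ e ℤ.- ℤ.+ a) (upTo (a ℕ.+ b))))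

  arr⇒candidate : ∀ {n} {h : Hyp n} → InArr a b h → h ∈ candidates n
  arr⇒candidate {h = i , j , c} arr with arr⇒ {i = i} {j} arr
  ... | e , _ , e<a+b , refl = ∈-cartesianProduct⁺ (∈-allFin i)
    (∈-cartesianProduct⁺ (∈-allFin j) (∈-map⁺ (λ e → ℤ.+ e ℤ.- ℤ.+ a) (∈-upTo⁺ e<a+b)))

  no-multiple : ∀ {q z m} → ℤ.+ q ∣ z → z ≡ ℤ.+ m → 1 ≤ m → m < q → ⊥
  no-multiple q∣z refl 1≤m m<q = ℕₚ.<⇒≢ 1≤m (sym (ℤₚ.+-injective (∣∧<⇒≡0 q∣z m<q)))

  module _ {n} (q : ℕ) (b≤q : b ≤ q) (x : Fin n → ℕ) (x<q : ∀ i → x i < q) (X : Fin (suc n) → ℕ)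
           (X0 : X zero ≡ 0) (Xs : ∀ i → X (suc i) ≡ x i) where

    Avoids : Set
    Avoids = ∀ i j c → InArr a b (i , j , c) → ¬ mod-diff q (X i) (X j) c

    -- A violated inequality exhibits a hyperplane through the point: its constant is - x i for
    -- `low`, q - x i for `high`, and x i - x k for `pair`.
    avoids⇒good : Avoids → Good 0 q x
    avoids⇒good av = b≤q , low , high , pair
      where
      hit : ∀ i j e → toℕ i < toℕ j → 1 ≤ e → e < a ℕ.+ b → ¬ mod-diff q (X i) (X j) (ℤ.+ e ℤ.- ℤ.+ a)
      hit i j e i<j 1≤e e<a+b = av i j (ℤ.+ e ℤ.- ℤ.+ a) (⇒arr {i = i} {j} i<j 1≤e e<a+b)
      at : ∀ {i j x y e z} → X i ≡ x → X j ≡ y → ℤ.+ x ℤ.- ℤ.+ y ℤ.- (ℤ.+ e ℤ.- ℤ.+ a) ≡ z → ℤ.+ q ∣ z → mod-diff q (X i) (X j) (ℤ.+ e ℤ.- ℤ.+ a)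
      at refl refl refl q∣z = q∣z
      low : ∀ i → a ≤ x i
      low i = ℕₚ.≮⇒≥ λ x<a → hit zero (suc i) (a ∸ x i) (s≤s z≤n) (ℕₚ.m<n⇒0<n∸m x<a)
        (ℕₚ.≤-<-trans (ℕₚ.m∸n≤m a (x i)) (ℕₚ.m<m+n a 1≤b))
        (at X0 (Xs i) (lem (ℤ.+ x i) (ℤ.+ (a ∸ x i)) (ℤ.+ a) (trans (sym (ℤₚ.pos-+ (a ∸ x i) (x i))) (cong ℤ.+_ (ℕₚ.m∸n+n≡m (ℕₚ.<⇒≤ x<a))))) (divides (ℤ.+ 0) refl))
        where
        lem′ : ∀ x e → ℤ.+ 0 ℤ.- x ℤ.- (e ℤ.- (e ℤ.+ x)) ≡ ℤ.+ 0
        lem′ = ℤ-solve-∀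
        lem : ∀ x e a → e ℤ.+ x ≡ a → ℤ.+ 0 ℤ.- x ℤ.- (e ℤ.- a) ≡ ℤ.+ 0
        lem x e _ refl = lem′ x e
      high : ∀ i → x i ℕ.+ b ≤ q
      high i = ℕₚ.≮⇒≥ λ q<x+b → hit zero (suc i) (q ∸ x i ℕ.+ a) (s≤s z≤n)
        (ℕₚ.≤-trans (ℕₚ.m<n⇒0<n∸m (x<q i)) (ℕₚ.m≤m+n (q ∸ x i) a))
        (subst (q ∸ x i ℕ.+ a <_) (ℕₚ.+-comm b a) (ℕₚ.+-monoˡ-< a
          (ℕₚ.+-cancelˡ-< (x i) (q ∸ x i) b (subst (_< x i ℕ.+ b) (sym (ℕₚ.m+[n∸m]≡n (ℕₚ.<⇒≤ (x<q i)))) q<x+b))))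
        (at X0 (Xs i) (trans (cong (λ z → ℤ.+ 0 ℤ.- ℤ.+ x i ℤ.- (z ℤ.- ℤ.+ a)) (ℤₚ.pos-+ (q ∸ x i) a))
            (lem (ℤ.+ x i) (ℤ.+ (q ∸ x i)) (ℤ.+ a) (ℤ.+ q) (trans (sym (ℤₚ.pos-+ (q ∸ x i) (x i))) (cong ℤ.+_ (ℕₚ.m∸n+n≡m (ℕₚ.<⇒≤ (x<q i)))))))
          (∣m⇒∣-m ∣-refl))
        where
        lem′ : ∀ x e a → ℤ.+ 0 ℤ.- x ℤ.- (e ℤ.+ a ℤ.- a) ≡ ℤ.- (e ℤ.+ x)
        lem′ = ℤ-solve-∀
        lem : ∀ x e a q → e ℤ.+ x ≡ q → ℤ.+ 0 ℤ.- x ℤ.- (e ℤ.+ a ℤ.- a) ≡ ℤ.- q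
        lem x e a _ refl = lem′ x e a
      pair : ∀ i k → toℕ i < toℕ k → (x k ℕ.+ b ≤ x i) ⊎ (x i ℕ.+ a ≤ x k)
      pair i k i<k with x k ℕ.+ b ℕₚ.≤? x i | x i ℕ.+ a ℕₚ.≤? x k
      ... | yes p | _     = inj₁ p
      ... | no _  | yes r = inj₂ r
      ... | no p≰ | no r≰ = contradiction
        (at (Xs i) (Xs k) (lem (ℤ.+ x i) (ℤ.+ x k) (ℤ.+ (x i ℕ.+ a ∸ x k)) (ℤ.+ a)
            (trans (sym (ℤₚ.pos-+ (x i ℕ.+ a ∸ x k) (x k))) (trans (cong ℤ.+_ (ℕₚ.m∸n+n≡m (ℕₚ.<⇒≤ (ℕₚ.≰⇒> r≰)))) (ℤₚ.pos-+ (x i) a))))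
          (divides (ℤ.+ 0) refl))
        (hit (suc i) (suc k) (x i ℕ.+ a ∸ x k) (s≤s i<k) (ℕₚ.m<n⇒0<n∸m (ℕₚ.≰⇒> r≰))
          (ℕₚ.+-cancelˡ-< (x k) (x i ℕ.+ a ∸ x k) (a ℕ.+ b) (subst₂ _<_ (sym (ℕₚ.m+[n∸m]≡n (ℕₚ.<⇒≤ (ℕₚ.≰⇒> r≰))))
            (trans (ℕₚ.+-assoc (x k) b a) (cong (x k ℕ.+_) (ℕₚ.+-comm b a))) (ℕₚ.+-monoˡ-< a (ℕₚ.≰⇒> p≰)))))
        where
        lem′ : ∀ x y e a → x ℤ.- y ℤ.- (e ℤ.- a) ≡ x ℤ.+ a ℤ.- (e ℤ.+ y)
        lem′ = ℤ-solve-∀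
        lem : ∀ x y e a → e ℤ.+ y ≡ x ℤ.+ a → x ℤ.- y ℤ.- (e ℤ.- a) ≡ ℤ.+ 0
        lem x y e a eq = trans (lem′ x y e a) (trans (cong (λ z → x ℤ.+ a ℤ.- z) eq) (ℤₚ.+-inverseʳ (x ℤ.+ a)))

    -- Up to sign, X i - X j - c lies strictly between 0 and q, so q cannot divide it.
    good⇒avoids : Good 0 q x → Avoids
    good⇒avoids (_ , low , high , pair) i j c arr md with arr⇒ {i = i} {j} arr
    good⇒avoids (_ , low , high , pair) zero (suc j) c arr md | e , 1≤e , e<a+b , refl =
      no-multiple (∣m⇒∣-m md) value (ℕₚ.≤-trans 1≤e (ℕₚ.m≤n+m e (x j ∸ a))) bound
      where
      x≡ : x j ∸ a ℕ.+ a ≡ x j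
      x≡ = ℕₚ.m∸n+n≡m (low j)
      lem : ∀ r a e → ℤ.- (ℤ.+ 0 ℤ.- (r ℤ.+ a) ℤ.- (e ℤ.- a)) ≡ r ℤ.+ e
      lem = ℤ-solve-∀
      value : ℤ.- (ℤ.+ X zero ℤ.- ℤ.+ X (suc j) ℤ.- (ℤ.+ e ℤ.- ℤ.+ a)) ≡ ℤ.+ (x j ∸ a ℕ.+ e)
      value = trans (cong₂ (λ u v → ℤ.- (ℤ.+ u ℤ.- v ℤ.- (ℤ.+ e ℤ.- ℤ.+ a))) X0
                (trans (cong ℤ.+_ (trans (Xs j) (sym x≡))) (ℤₚ.pos-+ (x j ∸ a) a)))
              (trans (lem (ℤ.+ (x j ∸ a)) (ℤ.+ a) (ℤ.+ e)) (sym (ℤₚ.pos-+ (x j ∸ a) e)))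
      bound : x j ∸ a ℕ.+ e < q
      bound = ℕₚ.<-≤-trans (ℕₚ.+-monoʳ-< (x j ∸ a) e<a+b)
        (subst (_≤ q) (trans (cong (ℕ._+ b) (sym x≡)) (ℕₚ.+-assoc (x j ∸ a) a b)) (high j))
    good⇒avoids (_ , low , high , pair) (suc i) (suc j) c arr md | e , 1≤e , e<a+b , refl
      with pair i j (ℕ.s≤s⁻¹ (proj₁ arr))
    ... | inj₁ x+b≤ = no-multiple md value (ℕₚ.≤-trans (ℕₚ.m<n⇒0<n∸m e<a+b) (ℕₚ.m≤m+n f r)) bound
      where
      r f : ℕ
      r = x i ∸ (x j ℕ.+ b)
      f = a ℕ.+ b ∸ e
      x≡ : x j ℕ.+ b ℕ.+ r ≡ x i
      x≡ = ℕₚ.m+[n∸m]≡n x+b≤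
      e+f : ℤ.+ e ℤ.+ ℤ.+ f ≡ ℤ.+ a ℤ.+ ℤ.+ b
      e+f = trans (sym (ℤₚ.pos-+ e f)) (trans (cong ℤ.+_ (ℕₚ.m+[n∸m]≡n (ℕₚ.<⇒≤ e<a+b))) (ℤₚ.pos-+ a b))
      lem′ : ∀ y b r e a → (y ℤ.+ b ℤ.+ r) ℤ.- y ℤ.- (e ℤ.- a) ≡ (a ℤ.+ b) ℤ.- e ℤ.+ r
      lem′ = ℤ-solve-∀
      lem″ : ∀ e f r → (e ℤ.+ f) ℤ.- e ℤ.+ r ≡ f ℤ.+ r
      lem″ = ℤ-solve-∀
      value : ℤ.+ X (suc i) ℤ.- ℤ.+ X (suc j) ℤ.- (ℤ.+ e ℤ.- ℤ.+ a) ≡ ℤ.+ (f ℕ.+ r)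
      value = trans (cong₂ (λ u v → u ℤ.- ℤ.+ v ℤ.- (ℤ.+ e ℤ.- ℤ.+ a))
                (trans (cong ℤ.+_ (trans (Xs i) (sym x≡))) (trans (ℤₚ.pos-+ (x j ℕ.+ b) r) (cong (ℤ._+ ℤ.+ r) (ℤₚ.pos-+ (x j) b)))) (Xs j))
              (trans (lem′ (ℤ.+ x j) (ℤ.+ b) (ℤ.+ r) (ℤ.+ e) (ℤ.+ a))
                (trans (cong (λ z → z ℤ.- ℤ.+ e ℤ.+ ℤ.+ r) (sym e+f)) (trans (lem″ (ℤ.+ e) (ℤ.+ f) (ℤ.+ r)) (sym (ℤₚ.pos-+ f r)))))
      bound : f ℕ.+ r < q
      bound = ℕₚ.≤-<-trans (ℕₚ.≤-trans (ℕₚ.+-monoˡ-≤ r (ℕₚ.≤-trans (ℕₚ.m∸n≤m (a ℕ.+ b) e) (ℕₚ.+-monoˡ-≤ b (low j)))) (ℕₚ.≤-reflexive x≡)) (x<q i)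
    ... | inj₂ x+a≤ = no-multiple (∣m⇒∣-m md) value (ℕₚ.≤-trans 1≤e (ℕₚ.m≤n+m e r)) bound
      where
      r : ℕ
      r = x j ∸ (x i ℕ.+ a)
      x≡ : x i ℕ.+ a ℕ.+ r ≡ x j
      x≡ = ℕₚ.m+[n∸m]≡n x+a≤
      lem : ∀ y a r e → ℤ.- (y ℤ.- (y ℤ.+ a ℤ.+ r) ℤ.- (e ℤ.- a)) ≡ r ℤ.+ e
      lem = ℤ-solve-∀
      value : ℤ.- (ℤ.+ X (suc i) ℤ.- ℤ.+ X (suc j) ℤ.- (ℤ.+ e ℤ.- ℤ.+ a)) ≡ ℤ.+ (r ℕ.+ e)
      value = trans (cong₂ (λ u v → ℤ.- (ℤ.+ u ℤ.- v ℤ.- (ℤ.+ e ℤ.- ℤ.+ a))) (Xs i)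
                (trans (cong ℤ.+_ (trans (Xs j) (sym x≡))) (trans (ℤₚ.pos-+ (x i ℕ.+ a) r) (cong (ℤ._+ ℤ.+ r) (ℤₚ.pos-+ (x i) a)))))
              (trans (lem (ℤ.+ x i) (ℤ.+ a) (ℤ.+ r) (ℤ.+ e)) (sym (ℤₚ.pos-+ r e)))
      bound : r ℕ.+ e < q
      bound = ℕₚ.<-≤-trans (ℕₚ.+-monoʳ-< r e<a+b) (begin
        r ℕ.+ (a ℕ.+ b)       ≡⟨ sym (ℕₚ.+-assoc r a b) ⟩
        r ℕ.+ a ℕ.+ b         ≤⟨ ℕₚ.+-monoˡ-≤ b (ℕₚ.≤-trans (ℕₚ.≤-reflexive (ℕₚ.+-comm r a)) (ℕₚ.+-monoˡ-≤ r (ℕₚ.m≤n+m a (x i)))) ⟩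
        x i ℕ.+ a ℕ.+ r ℕ.+ b ≡⟨ cong (ℕ._+ b) x≡ ⟩
        x j ℕ.+ b             ≤⟨ high j ⟩
        q                     ∎)
        where open ℕₚ.≤-Reasoning

-- Möbius inversion and interpolation

module Counting (a d′ n : ℕ) (P : PosetData (suc n) a (a ℕ.+ suc d′))
                (q : ℕ) (large : suc (suc n) ℕ.* (a ℕ.+ suc d′) ≤ q) where
  open PosetData P
  open Closed a d′ using (b)
  open Count a d′
  open Arrangement a d′

  b≤q : b ≤ q
  b≤q = ℕₚ.≤-trans (ℕₚ.m≤m+n b (suc n ℕ.* b)) large

  instance
    q≢0 : ℕ.NonZero q
    q≢0 = ℕ.>-nonZero (ℕₚ.≤-trans 1≤b b≤q)

  equations : Fin m → List (Hyp (suc n))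
  equations i = proj₁ (proj₂ (flat i))

  equations-arr : ∀ i → All (InArr a b) (equations i)
  equations-arr i = proj₁ (proj₂ (proj₂ (flat i)))

  zs≐ : ∀ i → zs i ≐ Inter (equations i)
  zs≐ i = proj₂ (proj₂ (proj₂ (flat i)))

  point : ∀ i → Pt (suc n)
  point i = proj₁ (proj₁ (flat i))

  solved : ∀ i → Solved (equations i)
  solved i = solveSystem (equations i) (point i)
    (proj₂ (to (Inter⇔Solves (equations i) (point i)) (proj₁ (zs≐ i (point i)) (proj₂ (proj₁ (flat i))))))

  sat? : ∀ i (X : Fin (suc n) → ℕ) → Dec (Solves (mod-diff q) (equations i) X)
  sat? i = ModCount.sat? (equations i) (solved i) q

  count-flat : ∀ i → ι q ^ℚ dim i ≡ Σbox n q (λ x → ⟦ sat? i (lookup (0 ∷ x)) ⟧)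
  count-flat i = trans
    (cong (ι q ^ℚ_) (Dimension.dim≡k (zs i) (equations i) (zs≐ i) (solved i) (point i) (proj₂ (proj₁ (flat i))) (dim-spec i)))
    (sym (ModCount.count-sat (equations i) (solved i) q))

  Σℤ→ℚ : ∀ {k} (f : Fin k → ℤ) → ℤ→ℚ (ΣFinℤ f) ≡ ΣFin (λ i → ℤ→ℚ (f i))
  Σℤ→ℚ {zero}  f = refl
  Σℤ→ℚ {suc k} f = trans (ℤ→ℚ-+ (f zero) (ΣFinℤ (f ∘ suc))) (cong (ℤ→ℚ (f zero) +_) (Σℤ→ℚ (f ∘ suc)))

  module Incidence (x : Vec ℕ n) (x<q : InBox q x) where
    X : Fin (suc n) → ℕ
    X = lookup (0 ∷ x)

    X<q : ∀ i → X i < q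
    X<q zero    = ℕₚ.≤-trans 1≤b b≤q
    X<q (suc i) = x<q i

    open Lift b n q large X X<q using (w; lift⇔)

    Through : Hyp (suc n) → Set
    Through (i , j , c) = InArr a b (i , j , c) × mod-diff q (X i) (X j) c

    through? : ∀ h → Dec (Through h)
    through? (i , j , c) = inArr? (i , j , c) ×-dec mod-diff? q (X i) (X j) c

    throughs : List (Hyp (suc n))
    throughs = filter through? (candidates (suc n))

    ∈-throughs : ∀ {h} → Through h → h ∈ throughs
    ∈-throughs th = ∈-filter⁺ through? (arr⇒candidate (proj₁ th)) th

    all-throughs : All Through throughs
    all-throughs = All.tabulate (λ h∈ → proj₂ (∈-filter⁻ through? {xs = candidates (suc n)} h∈))

    -- A rational point lying on exactly those hyperplanes that x lies on modulo q.
    Y : Pt (suc n)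
    Y = center (ι ∘ w)

    Y-diff : ∀ i j → Y i - Y j ≡ ℤ→ℚ (ℤ.+ w i ℤ.- ℤ.+ w j)
    Y-diff i j = trans (center-diff (ι ∘ w) i j) (sym (ℤ→ℚ-- (ℤ.+ w i) (ℤ.+ w j)))

    Y⇔ : ∀ i j c → InArr a b (i , j , c) → mod-diff q (X i) (X j) c ⇔ (Y i - Y j ≡ ℤ→ℚ c)
    Y⇔ i j c arr = mk⇔
      (λ md → trans (Y-diff i j) (cong ℤ→ℚ (to (lift⇔ i j c (∣arr∣<b {i = i} {j} arr)) md)))
      (λ e → from (lift⇔ i j c (∣arr∣<b {i = i} {j} arr)) (ℤ→ℚ-injective (trans (sym (Y-diff i j)) e)))

    Y∈ : Inter throughs Y
    Y∈ = from (Inter⇔Solves throughs Y)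
      (center-InV (ι ∘ w) , All.map (λ { {i , j , c} (arr , md) → to (Y⇔ i j c arr) md }) all-throughs)

    -- The smallest flat through x. Its equations hold for x only modulo q; the rational point `Y`
    -- shows that they are consistent over ℚ, so that the flat occurs in the enumeration.
    top : Fin m
    top = proj₁ (cover (Inter throughs) ((Y , Y∈) , throughs , All.map proj₁ all-throughs , λ _ → id , id))

    top≐ : zs top ≐ Inter throughs
    top≐ = proj₂ (cover (Inter throughs) ((Y , Y∈) , throughs , All.map proj₁ all-throughs , λ _ → id , id))

    -- The flats through x thus form the interval from 0̂ to `top`. Containment is tested at `Y`,
    -- whose incidences are those of x; conversely, equations satisfied by x are among `throughs`.
    le-top⇔ : ∀ v → (le v top ≡ true) ⇔ Solves (mod-diff q) (equations v) X
    le-top⇔ v = mk⇔ forth back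
      where
      forth : le v top ≡ true → Solves (mod-diff q) (equations v) X
      forth e = All.zipWith (λ { {i , j , c} (arr , eq) → from (Y⇔ i j c arr) eq })
        ( equations-arr v
        , proj₂ (to (Inter⇔Solves (equations v) Y) (proj₁ (zs≐ v Y) (to (le-spec v top) e Y (proj₂ (top≐ Y) Y∈)))) )
      back : Solves (mod-diff q) (equations v) X → le v top ≡ true
      back sat = from (le-spec v top) λ y y∈ →
        let (y∈V , ys) = proj₁ (top≐ y) y∈
        in proj₂ (zs≐ v y) (y∈V , All.zipWith (λ th → All.lookup ys (∈-throughs th)) (equations-arr v , sat))

    -- Raising the difference to 1 + c misses c whatever c is. Hence `top` can be 0̂ only if no
    -- hyperplane passes through x.
    escape : ∀ i j c → toℕ i < toℕ j → ∃ λ y → InV y × ¬ (y i - y j ≡ ℤ→ℚ c)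
    escape i j c i<j = center bump , center-InV bump , λ e →
      contradiction (ℤ→ℚ-injective (trans (sym e) (trans (center-diff bump i j) bump-diff))) c≢1+c
      where
      bump : Pt (suc n)
      bump t = ⟦ t Finₚ.≟ i ⟧ * ℤ→ℚ (ℤ.+ 1 ℤ.+ c)
      lem : ∀ z → 1ℚ * z - 0ℚ * z ≡ z
      lem = solve-∀ ℚ-ring
      bump-diff : bump i - bump j ≡ ℤ→ℚ (ℤ.+ 1 ℤ.+ c)
      bump-diff = trans (cong₂ (λ s t → s * ℤ→ℚ (ℤ.+ 1 ℤ.+ c) - t * ℤ→ℚ (ℤ.+ 1 ℤ.+ c)) (⟦⟧-yes refl (i Finₚ.≟ i))
                          (⟦⟧-no (λ j≡i → ℕₚ.<⇒≢ i<j (cong toℕ (sym j≡i))) (j Finₚ.≟ i)))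
                        (lem (ℤ→ℚ (ℤ.+ 1 ℤ.+ c)))
      lem₁ : ∀ c → ℤ.+ 1 ℤ.+ c ℤ.- c ≡ ℤ.+ 1
      lem₁ = ℤ-solve-∀
      c≢1+c : c ≢ ℤ.+ 1 ℤ.+ c
      c≢1+c e = contradiction (trans (sym (lem₁ c)) (trans (cong (λ z → z ℤ.- c) (sym e)) (ℤₚ.+-inverseʳ c))) λ ()

    bot≡top⇔ : (bot ≡ top) ⇔ Good 0 q (lookup x)
    bot≡top⇔ = mk⇔
      (λ e → avoids⇒good q b≤q (lookup x) x<q X refl (λ _ → refl) (forth e))
      (λ good → distinct bot top (back (good⇒avoids q b≤q (lookup x) x<q X refl (λ _ → refl) good)))
      where
      forth : bot ≡ top → ∀ i j c → InArr a b (i , j , c) → ¬ mod-diff q (X i) (X j) c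
      forth e i j c arr md = let (y , y∈V , y∉) = escape i j c (proj₁ arr) in
        y∉ (proj₂ (All.lookup (proj₂ (proj₁ (top≐ y) (subst (λ v → zs v y) e (proj₂ (bot-spec y) y∈V)))) (∈-throughs (arr , md))))
      back : (∀ i j c → InArr a b (i , j , c) → ¬ mod-diff q (X i) (X j) c) → zs bot ≐ zs top
      back avoids y =
        (λ y∈ → proj₂ (top≐ y) (proj₁ (bot-spec y) y∈ ,
          All.map (λ { {i , j , c} (arr , md) → contradiction md (avoids i j c arr) }) all-throughs)) ,
        (λ y∈ → proj₂ (bot-spec y) (proj₁ (proj₁ (top≐ y) y∈)))

    moebius : ΣFin (λ i → ℤ→ℚ (μ i) * ⟦ sat? i X ⟧) ≡ ⟦ good? 0 q (lookup x) ⟧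
    moebius = begin
      ΣFin (λ i → ℤ→ℚ (μ i) * ⟦ sat? i X ⟧)             ≡⟨ Σ-cong (λ i → sym (guarded (μ i) (le i top) (le-top⇔ i) (sat? i X))) ⟩
      ΣFin (λ i → ℤ→ℚ (if le i top then μ i else ℤ.+ 0)) ≡⟨ sym (Σℤ→ℚ (λ i → if le i top then μ i else ℤ.+ 0)) ⟩
      ℤ→ℚ (ΣFinℤ (λ i → if le i top then μ i else ℤ.+ 0)) ≡⟨ cong ℤ→ℚ (μ-spec top) ⟩
      ℤ→ℚ (if isYes (bot Finₚ.≟ top) then ℤ.+ 1 else ℤ.+ 0) ≡⟨ bracket (bot Finₚ.≟ top) ⟩
      ⟦ bot Finₚ.≟ top ⟧                                ≡⟨ ⟦⟧-cong (to bot≡top⇔) (from bot≡top⇔) (bot Finₚ.≟ top) (good? 0 q (lookup x)) ⟩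
      ⟦ good? 0 q (lookup x) ⟧                          ∎
      where
      open ≡-Reasoning
      guarded : ∀ {A : Set} c t → (t ≡ true) ⇔ A → (p : Dec A) →
        ℤ→ℚ (if t then c else ℤ.+ 0) ≡ ℤ→ℚ c * ⟦ p ⟧
      guarded c true  t⇔A (yes _)  = sym (ℚₚ.*-identityʳ (ℤ→ℚ c))
      guarded c true  t⇔A (no ¬A)  = contradiction (to t⇔A refl) ¬A
      guarded c false t⇔A (yes a)  = contradiction (from t⇔A a) λ ()
      guarded c false t⇔A (no _)   = sym (ℚₚ.*-zeroʳ (ℤ→ℚ c))
      bracket : ∀ {A : Set} (p : Dec A) → ℤ→ℚ (if isYes p then ℤ.+ 1 else ℤ.+ 0) ≡ ⟦ p ⟧
      bracket (yes _) = refl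
      bracket (no _)  = refl

  charPoly≡count : charPoly P (ι q) ≡ count n 0 q
  charPoly≡count = begin
    ΣFin (λ i → ℤ→ℚ (μ i) * (ι q ^ℚ dim i))
      ≡⟨ Σ-cong (λ i → trans (cong (ℤ→ℚ (μ i) *_) (count-flat i)) (sym (Σbox-*ˡ n q (ℤ→ℚ (μ i)) (λ x → ⟦ sat? i (lookup (0 ∷ x)) ⟧)))) ⟩
    ΣFin (λ i → Σbox n q (λ x → ℤ→ℚ (μ i) * ⟦ sat? i (lookup (0 ∷ x)) ⟧))
      ≡⟨ sym (Σbox-Σ n q (λ i x → ℤ→ℚ (μ i) * ⟦ sat? i (lookup (0 ∷ x)) ⟧)) ⟩
    Σbox n q (λ x → ΣFin (λ i → ℤ→ℚ (μ i) * ⟦ sat? i (lookup (0 ∷ x)) ⟧))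
      ≡⟨ Σbox-cong n q (λ x x<q → Incidence.moebius x x<q) ⟩
    count n 0 q ∎
    where open ≡-Reasoning

-- Interpolation from large integers

IsPoly-charPoly : ∀ {n a b} (P : PosetData n a b) → IsPoly (charPoly P)
IsPoly-charPoly P = IsPoly-Σ (λ i → IsPoly-*ˡ (ℤ→ℚ (μ i)) (suc (dim i) , Poly-^ (dim i)))
  where open PosetData P

cleared : ∀ a d′ n (P : PosetData (suc n) a (a ℕ.+ suc d′)) q →
  (ι (suc d′) ^ℚ suc n) * charPoly P q ≡ iter (suc n) (Sab a (a ℕ.+ suc d′)) (λ x → x ^ℚ n) q
cleared a d′ n P q = x-y≡0⇒x≡y (c * charPoly P q) (rhs q)
  (trans (lem (c * charPoly P q) (rhs q)) (Poly-zero (proj₂ difference) r r-injective root q))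
  where
  open Evaluation a d′
  b c : _
  b = a ℕ.+ suc d′
  c = ι (suc d′) ^ℚ suc n
  rhs : ℚ → ℚ
  rhs = iter (suc n) (Sab a b) (λ x → x ^ℚ n)
  lem : ∀ x y → x - y ≡ x + (- 1ℚ) * y
  lem = solve-∀ ℚ-ring
  difference : IsPoly (λ x → c * charPoly P x + (- 1ℚ) * rhs x)
  difference = IsPoly-+ (IsPoly-*ˡ c (IsPoly-charPoly P))
                        (IsPoly-*ˡ (- 1ℚ) (IsPoly-iter-Sab {a} {b} (suc n) (suc n , Poly-^ n)))
  -- The summand (n + 2) b makes room for the cut of the circle, and the successor gives the bound 1
  -- ≤ M of `series-eval`.
  M : ℕ → ℕ
  M k = suc (k ℕ.+ suc (suc n) ℕ.* b)
  r : ℕ → ℚ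
  r k = ι (M k ℕ.+ suc n ℕ.* s)
  r-injective : ∀ {j k} → r j ≡ r k → j ≡ k
  r-injective {j} {k} e = ℕₚ.+-cancelʳ-≡ (suc (suc n) ℕ.* b) j k
    (ℕₚ.suc-injective (ℕₚ.+-cancelʳ-≡ (suc n ℕ.* s) (M j) (M k) (ι-injective e)))
  root : ∀ k → c * charPoly P (r k) + (- 1ℚ) * rhs (r k) ≡ 0ℚ
  root k = trans (sym (lem (c * charPoly P (r k)) (rhs (r k))))
    (trans (cong (λ t → t - rhs (r k)) (trans (cong (c *_) (trans (Counting.charPoly≡count a d′ n P Q large) (Count.count≗series a d′ n Q)))
                                              (series-eval n (M k) (s≤s z≤n))))
           (ℚₚ.+-inverseʳ (rhs (r k))))
    where
    Q = M k ℕ.+ suc n ℕ.* s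
    large : suc (suc n) ℕ.* b ≤ Q
    large = ℕₚ.≤-trans (ℕₚ.m≤n+m (suc (suc n) ℕ.* b) (suc k)) (ℕₚ.m≤m+n (M k) (suc n ℕ.* s))

theorem9p7 : (a b : ℕ) (a<b : a < b) (n : ℕ) → 1 ≤ n →
    (P : PosetData n a b) → (q : ℚ) →
    charPoly P q ≡ invPow a b n a<b * iter n (Sab a b) (λ x → x ^ℚ (n ∸ 1)) q
theorem9p7 a b a<b (suc n) _ P q with b ∸ suc a | trans (ℕₚ.+-suc a (b ∸ suc a)) (ℕₚ.m+[n∸m]≡n a<b)
... | d′ | refl = begin
  charPoly P q
    ≡⟨ sym (ℚₚ.*-identityˡ (charPoly P q)) ⟩
  1ℚ * charPoly P q
    ≡⟨ cong (_* charPoly P q) (sym inverse) ⟩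
  (ι (suc d′) ^ℚ suc n) * invPow a b (suc n) a<b * charPoly P q
    ≡⟨ lem (ι (suc d′) ^ℚ suc n) (invPow a b (suc n) a<b) (charPoly P q) ⟩
  invPow a b (suc n) a<b * ((ι (suc d′) ^ℚ suc n) * charPoly P q)
    ≡⟨ cong (invPow a b (suc n) a<b *_) (cleared a d′ n P q) ⟩
  invPow a b (suc n) a<b * iter (suc n) (Sab a b) (λ x → x ^ℚ n) q ∎
  where
  open ≡-Reasoning
  lem : ∀ x y w → x * y * w ≡ y * (x * w)
  lem = solve-∀ ℚ-ring
  inverse : (ι (suc d′) ^ℚ suc n) * invPow a b (suc n) a<b ≡ 1ℚ
  inverse = trans
    (cong (_* invPow a b (suc n) a<b) (trans (sym (ι-^ (suc d′) (suc n))) (cong (λ d → ι (d ℕ.^ suc n)) (sym (ℕₚ.m+n∸m≡n a (suc d′))))))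
    (ι-inverse ((b ∸ a) ℕ.^ suc n))
    where instance _ = ℕ.>-nonZero (ℕₚ.m^n>0 (b ∸ a) {{ℕ.>-nonZero (ℕₚ.m<n⇒0<n∸m a<b)}} (suc n))
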